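{- Let $X$ be a finite set of points in $\mathbb{R}^d$, and let $r\ge1$ and $m\ge0$ be integers. If $|X|\ge(d+1)(r-1)+m+1$, then $\mathbf{Tver}(X,r)$ is homologically $(m-1)$-connected, i.e. $\widetilde H_j(\mathbf{Tver}(X,r);\mathbb{Q})=0$ for all $-1\le j\le m-1$.
   Context: $\mathbf{Tver}(X,r)$ is the order complex of the poset of ordered tuples $(X_1,\ldots,X_r)$ of pairwise disjoint (possibly empty) subsets of $X$ with $\bigcap_{i=1}^r\mathrm{conv}(X_i)\neq\emptyset$, ordered by $(X_1,\ldots,X_r)\le(Y_1,\ldots,Y_r)$ iff $X_i\subseteq Y_i$ for all $i$; i.e. its vertices are these tuples and its simplices are the chains. $\widetilde H_{ -1}=0$ means the complex has at least one vertex. -}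

module Defs where

open import Data.Bool.Base using (if_then_else_)
open import Data.Bool.Properties as Bool using ()
open import Data.Fin.Base using (Fin; zero; suc; toℕ)
open import Data.Fin.Properties as Fin using ()
open import Data.Fin.Subset using (Subset; _⊆_; _∩_; _∉_; Empty)
open import Data.Fin.Subset.Properties using (_⊆?_; ⊆-antisym)
open import Data.Integer.Base as ℤ using (ℤ; +_; -[1+_]; -1ℤ)
open import Data.List.Base using (List; []; _∷_; map; concatMap; allFin)
open import Data.Nat.Base as ℕ using (ℕ; zero; suc; _⊔_)
open import Data.Nat.Properties as ℕ using (m≤m⊔n; m≤n⊔m)
open import Data.Product.Base using (∃; _×_; _,_; proj₁)
open import Data.Rational.Base using (ℚ; 0ℚ; 1ℚ; ½; _+_; _*_; _-_; -_; _<_; _≤_; ∣_∣; 1/_; Positive; nonNegative)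
open import Data.Rational.Properties as ℚ using (module ≤-Reasoning)
open import Data.Rational.Solver using (module +-*-Solver)
open import Data.Unit.Base using (⊤)
open import Data.Vec.Base using (Vec; []; _∷_; lookup; removeAt)
open import Data.Vec.Functional as Vector using (Vector)
open import Data.Vec.Properties as Vec using ()
open import Data.Vec.Relation.Binary.Pointwise.Extensional using (ext; Pointwise-≡⇒≡)
open import Data.Vec.Relation.Binary.Pointwise.Inductive as Pointwise using ()
open import Data.Vec.Relation.Unary.All using (All; []; _∷_)
open import Data.Vec.Relation.Unary.AllPairs using (AllPairs; []; _∷_)
open import Level using (0ℓ)
open import Relation.Binary.Bundles using (DecPoset)
open import Relation.Binary.Core using (Rel)
import Relation.Binary.Construct.NonStrictToStrict as NonStrictToStrict
import Relation.Binary.Construct.On as On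
open import Relation.Binary.PropositionalEquality using (_≡_; _≢_; refl; sym; cong; subst; isEquivalence)
open import Relation.Nullary.Decidable.Core using (does)

-- Equality and order of reals are the relations _≈ʳ_ and _≤ʳ_ between the
-- limits; with excluded middle this setoid is the classical field ℝ.
IsCauchy : (ℕ → ℚ) → Set
IsCauchy u = ∀ ε → 0ℚ < ε → ∃ λ N → ∀ m n → N ℕ.≤ m → N ℕ.≤ n → ∣ u m - u n ∣ < ε

record ℝ : Set where
  constructor mkℝ
  field
    seq    : ℕ → ℚ
    cauchy : IsCauchy seq

open ℝ public

infix 4 _≈ʳ_ _≤ʳ_

_≈ʳ_ : Rel ℝ 0ℓ
x ≈ʳ y = ∀ ε → 0ℚ < ε → ∃ λ N → ∀ n → N ℕ.≤ n → ∣ seq x n - seq y n ∣ < ε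

_≤ʳ_ : Rel ℝ 0ℓ
x ≤ʳ y = ∀ ε → 0ℚ < ε → ∃ λ N → ∀ n → N ℕ.≤ n → seq x n ≤ seq y n + ε

abstract
  const-cauchy : ∀ q → IsCauchy (λ _ → q)
  const-cauchy q ε 0<ε = 0 , λ _ _ _ _ → subst (_< ε) (sym (cong ∣_∣ (ℚ.+-inverseʳ q))) 0<ε

  *-pos : ∀ p .{{_ : Positive p}} q → 0ℚ < q → 0ℚ < p * q
  *-pos p q 0<q = subst (_< p * q) (ℚ.*-zeroʳ p) (ℚ.*-monoʳ-<-pos p 0<q)

  scale : ∀ p .{{_ : Positive p}} ε → 0ℚ < ε → ∃ λ δ → 0ℚ < δ × p * δ ≡ ε
  scale p ε 0<ε = p⁻¹ * ε , *-pos p⁻¹ {{ℚ.1/pos⇒pos p}} ε 0<ε , (begin-equality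
      p * (p⁻¹ * ε)  ≡⟨ sym (ℚ.*-assoc p p⁻¹ ε) ⟩
      (p * p⁻¹) * ε  ≡⟨ cong (_* ε) (ℚ.*-inverseʳ p {{ℚ.pos⇒nonZero p}}) ⟩
      1ℚ * ε         ≡⟨ ℚ.*-identityˡ ε ⟩
      ε ∎)
    where
    open ≤-Reasoning
    p⁻¹ : ℚ
    p⁻¹ = (1/ p) {{ℚ.pos⇒nonZero p}}

  +-cauchy : ∀ u v → IsCauchy u → IsCauchy v → IsCauchy (λ n → u n + v n)
  +-cauchy u v cu cv ε 0<ε
    with M , hu ← cu (½ * ε) (*-pos ½ ε 0<ε) | N , hv ← cv (½ * ε) (*-pos ½ ε 0<ε) =
    M ⊔ N , λ m n p q → begin-strict
      ∣ (u m + v m) - (u n + v n) ∣      ≡⟨ cong ∣_∣ (rearrange (u m) (v m) (u n) (v n)) ⟩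
      ∣ (u m - u n) + (v m - v n) ∣      ≤⟨ ℚ.∣p+q∣≤∣p∣+∣q∣ (u m - u n) (v m - v n) ⟩
      ∣ u m - u n ∣ + ∣ v m - v n ∣      <⟨ ℚ.+-mono-< (hu m n (ℕ.≤-trans (m≤m⊔n M N) p) (ℕ.≤-trans (m≤m⊔n M N) q))
                                                     (hv m n (ℕ.≤-trans (m≤n⊔m M N) p) (ℕ.≤-trans (m≤n⊔m M N) q)) ⟩
      ½ * ε + ½ * ε                      ≡⟨ sym (ℚ.*-distribʳ-+ ε ½ ½) ⟩
      (½ + ½) * ε                        ≡⟨ ℚ.*-identityˡ ε ⟩
      ε ∎
    where
    open ≤-Reasoning
    rearrange : ∀ a b c d → (a + b) - (c + d) ≡ (a - c) + (b - d)
    rearrange = solve 4 (λ a b c d → (a :+ b) :- (c :+ d) := (a :- c) :+ (b :- d)) refl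
      where open +-*-Solver

  eventually-bounded : ∀ u → IsCauchy u →
    ∃ λ B → ∃ λ N → Positive B × (∀ n → N ℕ.≤ n → ∣ u n ∣ ≤ B)
  eventually-bounded u cu with N , h ← cu 1ℚ (ℚ.positive⁻¹ 1ℚ) =
    1ℚ + ∣ u N ∣ , N
    , ℚ.pos+nonNeg⇒pos 1ℚ ∣ u N ∣ {{nonNegative (ℚ.0≤∣p∣ (u N))}}
    , λ n p → begin
        ∣ u n ∣                   ≡⟨ cong ∣_∣ (split (u n) (u N)) ⟩
        ∣ (u n - u N) + u N ∣     ≤⟨ ℚ.∣p+q∣≤∣p∣+∣q∣ (u n - u N) (u N) ⟩
        ∣ u n - u N ∣ + ∣ u N ∣   ≤⟨ ℚ.+-monoˡ-≤ ∣ u N ∣ (ℚ.<⇒≤ (h n N p ℕ.≤-refl)) ⟩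
        1ℚ + ∣ u N ∣ ∎
    where
    open ≤-Reasoning
    split : ∀ a b → a ≡ (a - b) + b
    split = solve 2 (λ a b → a := (a :- b) :+ b) refl
      where open +-*-Solver

  ∣*∣-bound : ∀ C .{{_ : Positive C}} δ a b → ∣ a ∣ ≤ C → ∣ b ∣ < δ → ∣ a * b ∣ < C * δ
  ∣*∣-bound C δ a b a≤C b<δ = begin-strict
      ∣ a * b ∣      ≡⟨ ℚ.∣p*q∣≡∣p∣*∣q∣ a b ⟩
      ∣ a ∣ * ∣ b ∣  ≤⟨ ℚ.*-monoʳ-≤-nonNeg ∣ b ∣ {{nonNegative (ℚ.0≤∣p∣ b)}} a≤C ⟩
      C * ∣ b ∣      <⟨ ℚ.*-monoʳ-<-pos C b<δ ⟩
      C * δ ∎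
    where open ≤-Reasoning

  ∣Δ*∣-bound : ∀ A .{{_ : Positive A}} B .{{_ : Positive B}} δ a b c d →
    ∣ a ∣ ≤ A → ∣ d ∣ ≤ B → ∣ a - c ∣ < δ → ∣ b - d ∣ < δ → ∣ a * b - c * d ∣ < (A + B) * δ
  ∣Δ*∣-bound A B δ a b c d a≤A d≤B ac<δ bd<δ = begin-strict
      ∣ a * b - c * d ∣                    ≡⟨ cong ∣_∣ (rearrange a b c d) ⟩
      ∣ a * (b - d) + d * (a - c) ∣        ≤⟨ ℚ.∣p+q∣≤∣p∣+∣q∣ (a * (b - d)) (d * (a - c)) ⟩
      ∣ a * (b - d) ∣ + ∣ d * (a - c) ∣    <⟨ ℚ.+-mono-< (∣*∣-bound A δ a (b - d) a≤A bd<δ)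
                                                       (∣*∣-bound B δ d (a - c) d≤B ac<δ) ⟩
      A * δ + B * δ                        ≡⟨ sym (ℚ.*-distribʳ-+ δ A B) ⟩
      (A + B) * δ ∎
    where
    open ≤-Reasoning
    rearrange : ∀ a b c d → a * b - c * d ≡ a * (b - d) + d * (a - c)
    rearrange = solve 4 (λ a b c d → a :* b :- c :* d := a :* (b :- d) :+ d :* (a :- c)) refl
      where open +-*-Solver

  *-cauchy : ∀ u v → IsCauchy u → IsCauchy v → IsCauchy (λ n → u n * v n)
  *-cauchy u v cu cv ε 0<ε =
    let A , K , A>0 , bu = eventually-bounded u cu
        B , L , B>0 , bv = eventually-bounded v cv
        δ , 0<δ , Cδ≡ε = scale (A + B) {{ℚ.pos+pos⇒pos A {{A>0}} B {{B>0}}}} ε 0<ε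
        M , hu = cu δ 0<δ
        N , hv = cv δ 0<δ
        KL≤ = m≤m⊔n (K ⊔ L) (M ⊔ N)
        MN≤ = m≤n⊔m (K ⊔ L) (M ⊔ N)
        M≤  = ℕ.≤-trans (m≤m⊔n M N) MN≤
        N≤  = ℕ.≤-trans (m≤n⊔m M N) MN≤
        K≤  = ℕ.≤-trans (m≤m⊔n K L) KL≤
        L≤  = ℕ.≤-trans (m≤n⊔m K L) KL≤
    in (K ⊔ L) ⊔ (M ⊔ N) , λ m n p q →
      subst (∣ u m * v m - u n * v n ∣ <_) Cδ≡ε
        (∣Δ*∣-bound A {{A>0}} B {{B>0}} δ (u m) (v m) (u n) (v n)
          (bu m (ℕ.≤-trans K≤ p)) (bv n (ℕ.≤-trans L≤ q))
          (hu m n (ℕ.≤-trans M≤ p) (ℕ.≤-trans M≤ q))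
          (hv m n (ℕ.≤-trans N≤ p) (ℕ.≤-trans N≤ q)))

0ʳ 1ʳ : ℝ
0ʳ = mkℝ (λ _ → 0ℚ) (const-cauchy 0ℚ)
1ʳ = mkℝ (λ _ → 1ℚ) (const-cauchy 1ℚ)

infixl 6 _+ʳ_
infixl 7 _*ʳ_

_+ʳ_ _*ʳ_ : ℝ → ℝ → ℝ
x +ʳ y = mkℝ (λ n → seq x n + seq y n) (+-cauchy (seq x) (seq y) (cauchy x) (cauchy y))
x *ʳ y = mkℝ (λ n → seq x n * seq y n) (*-cauchy (seq x) (seq y) (cauchy x) (cauchy y))

sumʳ : ∀ {n} → Vector ℝ n → ℝ
sumʳ = Vector.foldr _+ʳ_ 0ʳ

Point : ℕ → Set
Point d = Vector ℝ d

infix 4 _≈ᵖ_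

_≈ᵖ_ : ∀ {d} → Rel (Point d) 0ℓ
p ≈ᵖ q = ∀ c → p c ≈ʳ q c

-- A finite set of n points is an injective family x : Fin n → ℝᵈ, and its
-- subsets are the images of the subsets S of the index set; the hull of the
-- empty subset is empty because its weights would have to add up to 0.
record InConv {d n : ℕ} (x : Fin n → Point d) (S : Subset n) (p : Point d) : Set where
  field
    weight     : Vector ℝ n
    weight≥0   : ∀ i → 0ʳ ≤ʳ weight i
    supported  : ∀ i → i ∉ S → weight i ≈ʳ 0ʳ
    weight-sum : sumʳ weight ≈ʳ 1ʳ
    barycentre : (λ c → sumʳ (λ i → weight i *ʳ x i c)) ≈ᵖ p

module OrderComplex (P : DecPoset 0ℓ 0ℓ 0ℓ) where

  private module P = DecPoset P
  open NonStrictToStrict P._≈_ P._≤_ using () renaming (_<_ to _≺_)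

  -- A chain with k elements, listed in increasing order; it is a simplex of
  -- dimension k - 1 (the empty simplex for k = 0), oriented by that listing.
  record Simplex (k : ℕ) : Set where
    constructor simplex
    field
      vertices   : Vec P.Carrier k
      increasing : AllPairs _≺_ vertices

  open Simplex public

  removeAt-All : ∀ {Q : P.Carrier → Set} {k} {xs : Vec P.Carrier (suc k)} →
    All Q xs → ∀ i → All Q (removeAt xs i)
  removeAt-All (_ ∷ qs)          zero    = qs
  removeAt-All (q ∷ qs@(_ ∷ _))  (suc i) = q ∷ removeAt-All qs i

  removeAt-AllPairs : ∀ {k} {xs : Vec P.Carrier (suc k)} →
    AllPairs _≺_ xs → ∀ i → AllPairs _≺_ (removeAt xs i)
  removeAt-AllPairs (_ ∷ rs)         zero    = rs
  removeAt-AllPairs (q ∷ rs@(_ ∷ _)) (suc i) = removeAt-All q i ∷ removeAt-AllPairs rs i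

  face : ∀ {k} → Simplex (suc k) → Fin (suc k) → Simplex k
  face σ i = simplex (removeAt (vertices σ) i) (removeAt-AllPairs (increasing σ) i)

  -- Formal ℚ-linear combinations of simplices; two of them are equal when
  -- every simplex has the same total coefficient in both.
  Chain : ℕ → Set
  Chain k = List (ℚ × Simplex k)

  coefficient : ∀ {k} → Chain k → Simplex k → ℚ
  coefficient []            σ = 0ℚ
  coefficient ((a , τ) ∷ c) σ =
    (if does (Pointwise.decidable P._≟_ (vertices τ) (vertices σ)) then a else 0ℚ) + coefficient c σ

  infix 4 _≈ᶜ_

  _≈ᶜ_ : ∀ {k} → Rel (Chain k) 0ℓ
  c ≈ᶜ c′ = ∀ σ → coefficient c σ ≡ coefficient c′ σ

  sign : ℕ → ℚ
  sign zero    = 1ℚ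
  sign (suc i) = - sign i

  ∂ : ∀ {k} → Chain (suc k) → Chain k
  ∂ {k} = concatMap λ (a , σ) → map (λ i → sign (toℕ i) * a , face σ i) (allFin (suc k))

  IsCycle : ∀ {k} → Chain k → Set
  IsCycle {zero}  _ = ⊤
  IsCycle {suc k} c = ∂ c ≈ᶜ []

  IsBoundary : ∀ {k} → Chain k → Set
  IsBoundary {k} c = ∃ λ (b : Chain (suc k)) → ∂ b ≈ᶜ c

  -- Vanishing of reduced homology with rational coefficients.  Chains of
  -- degree j are spanned by the simplices with j + 1 vertices, so they are
  -- all zero for j < -1.
  H̃_≡0 : ℤ → Set
  H̃ + j          ≡0 = ∀ (z : Chain (suc j)) → IsCycle z → IsBoundary z
  H̃ -[1+ zero  ] ≡0 = ∀ (z : Chain zero) → IsCycle z → IsBoundary z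
  H̃ -[1+ suc _ ] ≡0 = ⊤

  HomologicallyConnected : ℤ → Set
  HomologicallyConnected k = ∀ j → -1ℤ ℤ.≤ j → j ℤ.≤ k → H̃ j ≡0

tuples : ℕ → ℕ → DecPoset 0ℓ 0ℓ 0ℓ
tuples n r = record
  { Carrier = Vec (Subset n) r
  ; _≈_     = _≡_
  ; _≤_     = λ X Y → ∀ i → lookup X i ⊆ lookup Y i
  ; isDecPartialOrder = record
    { isPartialOrder = record
      { isPreorder = record
        { isEquivalence = isEquivalence
        ; reflexive     = λ { refl _ x∈X → x∈X }
        ; trans         = λ X≤Y Y≤Z i x∈X → Y≤Z i (X≤Y i x∈X)
        }
      ; antisym = λ X≤Y Y≤X → Pointwise-≡⇒≡ (ext λ i → ⊆-antisym (X≤Y i) (Y≤X i))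
      }
    ; _≟_  = Vec.≡-dec (Vec.≡-dec Bool._≟_)
    ; _≤?_ = λ X Y → Fin.all? λ i → lookup X i ⊆? lookup Y i
    }
  }

record IsTverberg {d n r : ℕ} (x : Fin n → Point d) (X : Vec (Subset n) r) : Set where
  field
    disjoint     : ∀ i j → i ≢ j → Empty (lookup X i ∩ lookup X j)
    intersecting : ∃ λ p → ∀ i → InConv x (lookup X i) p

TverPoset : ∀ {d n} → (Fin n → Point d) → ℕ → DecPoset 0ℓ 0ℓ 0ℓ
TverPoset {n = n} x r = On.decPoset (tuples n r) (proj₁ {B = IsTverberg x})

{-# OPTIONS --safe #-}
module Submission where

-- With parts indexed by {0, …, r} (the theorem's r is r + 1 here), Sarkaria's
-- trick says that a partial map σ from points to parts has intersecting hulls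
-- iff 0 lies in the convex hull of the vectors vec j (σ j) of ℝᴰ, where
-- D = (d + 1) r; for each point j the vectors vec j i sum to 0.  If it does not,
-- there is a unique shortest u with ⟨u , vec j (σ j)⟩ ≥ c j (σ j) on the domain
-- of σ.  For a generic c > 0 the tight constraints form a set B ⊆ σ of at most
-- D points that depends only on u, so the non-intersecting maps are partitioned
-- into cells [B , T], with T = {(j , i) : ⟨u , vec j i⟩ ≥ c j i} containing all
-- of {j} × {0, …, r} for no j.  Adding the cells to the intersecting maps in the
-- order of decreasing |u| ends with the poset of all partial maps, a cone.  Each
-- step glues in the cone above B along {σ ≥ B : σ ⊄ T}, which is homotopy
-- equivalent to a join of at least n - D nonempty sets, hence acyclic in the
-- relevant degrees; by Mayer–Vietoris acyclicity passes back to the start.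

-- The right-hand sides c carry the difficulty. If they were all equal, different minimal sets of
-- tight constraints could give the same u, and the maps belonging to u need not form an interval.
-- For generic c, a vector u in the span of B that is tight on B is tight nowhere else; so u
-- determines B, and a linear dependence within B would contradict genericity, whence the bound D.
-- The order of the cells works because extra constraints can only lengthen the shortest vector,
-- strictly unless it stays the same: enlarging a map leads to an intersecting map, to a longer u or
-- to the same cell, so every stage is an upset. This matters because a chain lies in an upset as
-- soon as its least element does, so that unions of upsets are unions of order complexes. In the
-- descent the attaching set has to be acyclic in the degree of the stage itself, so no degrees are
-- lost, however many cells there are, and n - D ≥ m + 1 covers all degrees up to m - 1. The
-- shortest u is found by algebra over an ordered field instead of compactness.

module Chains where

  open import Data.List.Base using (List; []; _∷_; _++_; map; concatMap; filter)
  open import Data.List.Relation.Unary.All as All using (All; []; _∷_)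
  open import Data.List.Relation.Unary.All.Properties as All using ()
  open import Data.Product.Base using (∃; ∃₂; _×_; _,_; proj₂; map₂)
  open import Data.Rational.Base using (ℚ; 0ℚ; 1ℚ; _+_; _*_; _-_; -_)
  open import Data.Rational.Properties as ℚ using ()
  open import Data.Rational.Solver using (module +-*-Solver)
  open import Data.Sum.Base using (_⊎_; inj₁; inj₂)
  open import Function.Base using (_∘_)
  open import Level using (0ℓ)
  open import Relation.Binary.Core using (Rel)
  open import Relation.Binary.PropositionalEquality using (_≡_; refl; sym; trans; cong; cong₂; module ≡-Reasoning)
  open import Relation.Nullary using (yes; no; contradiction)
  open import Relation.Unary using (Decidable)

  minus-congʳ : ∀ p {q q′ : ℚ} → q ≡ q′ → p - q ≡ p - q′
  minus-congʳ p = cong (λ t → p - t)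

  -- Formal rational combinations and the simplicial boundary.

  module FreeModule where

    private variable
      X Y : Set

    Comb : Set → Set
    Comb X = List (ℚ × X)

    ⟪_,_⟫ : Comb X → (X → ℚ) → ℚ
    ⟪ [] , φ ⟫          = 0ℚ
    ⟪ (a , x) ∷ c , φ ⟫ = a * φ x + ⟪ c , φ ⟫

    infix 4 _≋_

    -- Equality is tested by linear functionals, so that ∂ is handled through its
    -- transpose δ below.
    _≋_ : Rel (Comb X) 0ℓ
    c ≋ c′ = ∀ φ → ⟪ c , φ ⟫ ≡ ⟪ c′ , φ ⟫

    AllSupp : (X → Set) → Comb X → Set
    AllSupp Q = All (Q ∘ proj₂)

    ⟪⟫-cong-on : ∀ {φ ψ : X → ℚ} {c} → AllSupp (λ x → φ x ≡ ψ x) c → ⟪ c , φ ⟫ ≡ ⟪ c , ψ ⟫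
    ⟪⟫-cong-on []                          = refl
    ⟪⟫-cong-on {c = (a , _) ∷ _} (eq ∷ eqs) = cong₂ _+_ (cong (a *_) eq) (⟪⟫-cong-on eqs)

    ⟪⟫-cong : ∀ {φ ψ : X → ℚ} c → (∀ x → φ x ≡ ψ x) → ⟪ c , φ ⟫ ≡ ⟪ c , ψ ⟫
    ⟪⟫-cong c eq = ⟪⟫-cong-on (All.universal (λ _ → eq _) c)

    ⟪⟫-++ : ∀ (c c′ : Comb X) φ → ⟪ c ++ c′ , φ ⟫ ≡ ⟪ c , φ ⟫ + ⟪ c′ , φ ⟫
    ⟪⟫-++ []            c′ φ = sym (ℚ.+-identityˡ _)
    ⟪⟫-++ ((a , x) ∷ c) c′ φ =
      trans (cong (a * φ x +_) (⟪⟫-++ c c′ φ)) (sym (ℚ.+-assoc (a * φ x) _ _))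

    ⟪⟫-zero : ∀ (c : Comb X) → ⟪ c , (λ _ → 0ℚ) ⟫ ≡ 0ℚ
    ⟪⟫-zero []            = refl
    ⟪⟫-zero ((a , _) ∷ c) = cong₂ _+_ (ℚ.*-zeroʳ a) (⟪⟫-zero c)

    ⟪⟫-+ : ∀ (c : Comb X) φ ψ → ⟪ c , (λ x → φ x + ψ x) ⟫ ≡ ⟪ c , φ ⟫ + ⟪ c , ψ ⟫
    ⟪⟫-+ []            φ ψ = refl
    ⟪⟫-+ ((a , x) ∷ c) φ ψ = trans (cong (a * (φ x + ψ x) +_) (⟪⟫-+ c φ ψ))
      (solve 5 (λ a p q s t → a :* (p :+ q) :+ (s :+ t) := (a :* p :+ s) :+ (a :* q :+ t)) refl
        a (φ x) (ψ x) ⟪ c , φ ⟫ ⟪ c , ψ ⟫)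
      where open +-*-Solver

    ⟪⟫-* : ∀ (c : Comb X) b φ → ⟪ c , (λ x → b * φ x) ⟫ ≡ b * ⟪ c , φ ⟫
    ⟪⟫-* []            b φ = sym (ℚ.*-zeroʳ b)
    ⟪⟫-* ((a , x) ∷ c) b φ = trans (cong (a * (b * φ x) +_) (⟪⟫-* c b φ))
      (solve 4 (λ a b p s → a :* (b :* p) :+ b :* s := b :* (a :* p :+ s)) refl a b (φ x) ⟪ c , φ ⟫)
      where open +-*-Solver

    ⟪⟫-neg : ∀ (c : Comb X) φ → ⟪ c , (λ x → - φ x) ⟫ ≡ - ⟪ c , φ ⟫
    ⟪⟫-neg []            φ = refl
    ⟪⟫-neg ((a , x) ∷ c) φ = trans (cong (a * (- φ x) +_) (⟪⟫-neg c φ))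
      (solve 3 (λ a p s → a :* (:- p) :+ :- s := :- (a :* p :+ s)) refl a (φ x) ⟪ c , φ ⟫)
      where open +-*-Solver

    ⟪⟫-minus : ∀ (c : Comb X) φ ψ → ⟪ c , (λ x → φ x - ψ x) ⟫ ≡ ⟪ c , φ ⟫ - ⟪ c , ψ ⟫
    ⟪⟫-minus c φ ψ = trans (⟪⟫-+ c φ (-_ ∘ ψ)) (cong (⟪ c , φ ⟫ +_) (⟪⟫-neg c ψ))

    ⟪⟫-map : ∀ (f : X → Y) c φ → ⟪ map (map₂ f) c , φ ⟫ ≡ ⟪ c , φ ∘ f ⟫
    ⟪⟫-map f []            φ = refl
    ⟪⟫-map f ((a , x) ∷ c) φ = cong (a * φ (f x) +_) (⟪⟫-map f c φ)

    AllSupp-map : ∀ {Q : Y → Set} {f : X → Y} {c} → AllSupp (Q ∘ f) c → AllSupp Q (map (map₂ f) c)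
    AllSupp-map = All.map⁺

    scaled : ℚ → Comb X → Comb X
    scaled b = map λ (a , x) → b * a , x

    ⟪⟫-scaled : ∀ b (c : Comb X) φ → ⟪ scaled b c , φ ⟫ ≡ b * ⟪ c , φ ⟫
    ⟪⟫-scaled b []            φ = sym (ℚ.*-zeroʳ b)
    ⟪⟫-scaled b ((a , x) ∷ c) φ = trans (cong (b * a * φ x +_) (⟪⟫-scaled b c φ))
      (solve 4 (λ a b p s → b :* a :* p :+ b :* s := b :* (a :* p :+ s)) refl a b (φ x) ⟪ c , φ ⟫)
      where open +-*-Solver

    negate : Comb X → Comb X
    negate = map λ (a , x) → - a , x

    ⟪⟫-negate : ∀ (c : Comb X) φ → ⟪ negate c , φ ⟫ ≡ - ⟪ c , φ ⟫
    ⟪⟫-negate []            φ = refl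
    ⟪⟫-negate ((a , x) ∷ c) φ = trans (cong (- a * φ x +_) (⟪⟫-negate c φ))
      (solve 3 (λ a p s → (:- a) :* p :+ :- s := :- (a :* p :+ s)) refl a (φ x) ⟪ c , φ ⟫)
      where open +-*-Solver

    AllSupp-negate : ∀ {Q : X → Set} {c} → AllSupp Q c → AllSupp Q (negate c)
    AllSupp-negate = All.map⁺

    extend : (X → Comb Y) → Comb X → Comb Y
    extend f = concatMap λ (a , x) → scaled a (f x)

    ⟪⟫-extend : ∀ (f : X → Comb Y) c φ → ⟪ extend f c , φ ⟫ ≡ ⟪ c , (λ x → ⟪ f x , φ ⟫) ⟫
    ⟪⟫-extend f []            φ = refl
    ⟪⟫-extend f ((a , x) ∷ c) φ = trans (⟪⟫-++ (scaled a (f x)) (extend f c) φ)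
      (cong₂ _+_ (⟪⟫-scaled a (f x) φ) (⟪⟫-extend f c φ))

    AllSupp-scaled : ∀ {Q : X → Set} {b c} → AllSupp Q c → AllSupp Q (scaled b c)
    AllSupp-scaled = All.map⁺

    AllSupp-extend : ∀ {P : X → Set} {Q : Y → Set} {f : X → Comb Y} →
      (∀ {x} → P x → AllSupp Q (f x)) → ∀ {c} → AllSupp P c → AllSupp Q (extend f c)
    AllSupp-extend h []       = []
    AllSupp-extend h {(a , _) ∷ _} (p ∷ ps) = All.++⁺ (AllSupp-scaled {b = a} (h p)) (AllSupp-extend h ps)

    split : ∀ {P Q : X → Set} c → AllSupp (λ x → P x ⊎ Q x) c →
      ∃₂ λ a b → AllSupp P a × AllSupp Q b × (∀ φ → ⟪ c , φ ⟫ ≡ ⟪ a , φ ⟫ + ⟪ b , φ ⟫)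
    split []      []              = [] , [] , [] , [] , λ _ → refl
    split ((e , x) ∷ c) (inj₁ p ∷ pqs) with a , b , pa , qb , eq ← split c pqs =
      (e , x) ∷ a , b , p ∷ pa , qb , λ φ →
        trans (cong (e * φ x +_) (eq φ)) (sym (ℚ.+-assoc (e * φ x) _ _))
    split ((e , x) ∷ c) (inj₂ q ∷ pqs) with a , b , pa , qb , eq ← split c pqs =
      a , (e , x) ∷ b , pa , q ∷ qb , λ φ →
        trans (cong (e * φ x +_) (eq φ))
          (solve 3 (λ e s t → e :+ (s :+ t) := s :+ (e :+ t)) refl (e * φ x) ⟪ a , φ ⟫ ⟪ b , φ ⟫)
      where open +-*-Solver

    indicator : ∀ {P : X → Set} → Decidable P → (X → ℚ) → X → ℚ
    indicator P? φ x with P? x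
    ... | yes _ = φ x
    ... | no  _ = 0ℚ

    indicator-yes : ∀ {P : X → Set} (P? : Decidable P) φ {x} → P x → indicator P? φ x ≡ φ x
    indicator-yes P? φ {x} p with P? x
    ... | yes _ = refl
    ... | no ¬p = contradiction p ¬p

    restrict : ∀ {P : X → Set} → Decidable P → Comb X → Comb X
    restrict P? = filter (P? ∘ proj₂)

    ⟪⟫-restrict : ∀ {P : X → Set} (P? : Decidable P) c φ →
      ⟪ restrict P? c , φ ⟫ ≡ ⟪ c , indicator P? φ ⟫
    ⟪⟫-restrict P? []            φ = refl
    ⟪⟫-restrict P? ((a , x) ∷ c) φ with P? x
    ... | yes _ = cong (a * φ x +_) (⟪⟫-restrict P? c φ)
    ... | no  _ = trans (⟪⟫-restrict P? c φ) (sym (trans (cong (_+ _) (ℚ.*-zeroʳ a)) (ℚ.+-identityˡ _)))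

    -- Equal combinations may be different lists, with cancelling entries outside `P`. Discarding
    -- the entries of `c` outside `P` keeps its value: it amounts to pairing with φ cut off to `P`,
    -- and on `c′` the cut-off changes nothing. So a chain known in two ways to lie in two sets has
    -- a representative in their intersection.
    common-support : ∀ {P Q : X → Set} → Decidable P → ∀ {c c′} → AllSupp Q c → AllSupp P c′ → c ≋ c′ →
      ∃ λ e → AllSupp (λ x → P x × Q x) e × e ≋ c
    common-support P? {c} {c′} qc pc′ eq =
        restrict P? c
      , All.zip (All.all-filter (P? ∘ proj₂) c , All.filter⁺ (P? ∘ proj₂) qc)
      , λ φ → begin
          ⟪ restrict P? c , φ ⟫     ≡⟨ ⟪⟫-restrict P? c φ ⟩
          ⟪ c , indicator P? φ ⟫    ≡⟨ eq _ ⟩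
          ⟪ c′ , indicator P? φ ⟫   ≡⟨ ⟪⟫-cong-on (All.map (indicator-yes P? φ) pc′) ⟩
          ⟪ c′ , φ ⟫                ≡⟨ sym (eq φ) ⟩
          ⟪ c , φ ⟫ ∎
      where open ≡-Reasoning

  open FreeModule

  -- Lists of all lengths are treated at once: with bd [] = [] the recursion is
  -- uniform, and length is tracked by Increasing.
  module Boundary {A : Set} where

    bd : List A → Comb (List A)
    bd []       = []
    bd (x ∷ xs) = (1ℚ , xs) ∷ negate (map (map₂ (x ∷_)) (bd xs))

    ∂ : Comb (List A) → Comb (List A)
    ∂ = extend bd

    δ : (List A → ℚ) → List A → ℚ
    δ φ []       = 0ℚ
    δ φ (x ∷ xs) = φ xs - δ (φ ∘ (x ∷_)) xs

    ⟪bd⟫ : ∀ σ φ → ⟪ bd σ , φ ⟫ ≡ δ φ σ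
    ⟪bd⟫ []       φ = refl
    ⟪bd⟫ (x ∷ xs) φ = cong₂ _+_ (ℚ.*-identityˡ (φ xs))
      (trans (⟪⟫-negate (map (map₂ (x ∷_)) (bd xs)) φ)
        (cong -_ (trans (⟪⟫-map (x ∷_) (bd xs) φ) (⟪bd⟫ xs (φ ∘ (x ∷_))))))

    ⟪∂⟫ : ∀ c φ → ⟪ ∂ c , φ ⟫ ≡ ⟪ c , δ φ ⟫
    ⟪∂⟫ c φ = trans (⟪⟫-extend bd c φ) (⟪⟫-cong c (λ σ → ⟪bd⟫ σ φ))

    δ-cong : ∀ {φ ψ} → (∀ σ → φ σ ≡ ψ σ) → ∀ σ → δ φ σ ≡ δ ψ σ
    δ-cong eq []       = refl
    δ-cong eq (x ∷ xs) = cong₂ _-_ (eq xs) (δ-cong (λ σ → eq (x ∷ σ)) xs)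

    δ-zero : ∀ σ → δ (λ _ → 0ℚ) σ ≡ 0ℚ
    δ-zero []       = refl
    δ-zero (x ∷ xs) = minus-congʳ 0ℚ (δ-zero xs)

    δ-minus : ∀ φ ψ σ → δ (λ τ → φ τ - ψ τ) σ ≡ δ φ σ - δ ψ σ
    δ-minus φ ψ []       = refl
    δ-minus φ ψ (x ∷ xs) = trans (minus-congʳ (φ xs - ψ xs) (δ-minus (φ ∘ (x ∷_)) (ψ ∘ (x ∷_)) xs))
      (solve 4 (λ p q s t → (p :- q) :- (s :- t) := (p :- s) :- (q :- t)) refl
        (φ xs) (ψ xs) (δ (φ ∘ (x ∷_)) xs) (δ (ψ ∘ (x ∷_)) xs))
      where open +-*-Solver

    -- In the recursion the term `δ φ xs` arises twice, from deleting x before and after another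
    -- vertex, with opposite signs; what remains is the same claim for xs.
    δδ : ∀ φ σ → δ (δ φ) σ ≡ 0ℚ
    δδ φ []       = refl
    δδ φ (x ∷ xs) = begin
      δ φ xs - δ (λ τ → φ τ - δ φₓ τ) xs      ≡⟨ minus-congʳ (δ φ xs) (δ-minus φ (δ φₓ) xs) ⟩
      δ φ xs - (δ φ xs - δ (δ φₓ) xs)         ≡⟨ solve 2 (λ a b → a :- (a :- b) := b) refl (δ φ xs) _ ⟩
      δ (δ φₓ) xs                             ≡⟨ δδ φₓ xs ⟩
      0ℚ ∎
      where
      open ≡-Reasoning
      open +-*-Solver
      φₓ = φ ∘ (x ∷_)

    ∂∂ : ∀ c → ∂ (∂ c) ≋ []
    ∂∂ c φ = trans (⟪∂⟫ (∂ c) φ) (trans (⟪∂⟫ c (δ φ)) (trans (⟪⟫-cong c (δδ φ)) (⟪⟫-zero c)))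

    ∂-cong : ∀ c c′ → c ≋ c′ → ∂ c ≋ ∂ c′
    ∂-cong c c′ eq φ = trans (⟪∂⟫ c φ) (trans (eq (δ φ)) (sym (⟪∂⟫ c′ φ)))

    ∂-++ : ∀ c c′ φ → ⟪ ∂ (c ++ c′) , φ ⟫ ≡ ⟪ ∂ c , φ ⟫ + ⟪ ∂ c′ , φ ⟫
    ∂-++ c c′ φ = trans (⟪∂⟫ (c ++ c′) φ) (trans (⟪⟫-++ c c′ (δ φ))
      (sym (cong₂ _+_ (⟪∂⟫ c φ) (⟪∂⟫ c′ φ))))

    ∂-negate : ∀ c φ → ⟪ ∂ (negate c) , φ ⟫ ≡ - ⟪ ∂ c , φ ⟫
    ∂-negate c φ = trans (⟪∂⟫ (negate c) φ) (trans (⟪⟫-negate c (δ φ)) (cong -_ (sym (⟪∂⟫ c φ))))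

  open Boundary

  module _ {A B : Set} (f : A → B) where

    δ-map : ∀ φ σ → δ φ (map f σ) ≡ δ (φ ∘ map f) σ
    δ-map φ []       = refl
    δ-map φ (x ∷ xs) = minus-congʳ (φ (map f xs)) (δ-map (φ ∘ (f x ∷_)) xs)

    ∂-map : ∀ c φ → ⟪ ∂ (map (map₂ (map f)) c) , φ ⟫ ≡ ⟪ ∂ c , φ ∘ map f ⟫
    ∂-map c φ = begin
      ⟪ ∂ (map (map₂ (map f)) c) , φ ⟫   ≡⟨ ⟪∂⟫ (map (map₂ (map f)) c) φ ⟩
      ⟪ map (map₂ (map f)) c , δ φ ⟫     ≡⟨ ⟪⟫-map (map f) c (δ φ) ⟩
      ⟪ c , δ φ ∘ map f ⟫                ≡⟨ ⟪⟫-cong c (δ-map φ) ⟩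
      ⟪ c , δ (φ ∘ map f) ⟫              ≡⟨ ⟪∂⟫ c (φ ∘ map f) ⟨
      ⟪ ∂ c , φ ∘ map f ⟫ ∎
      where open ≡-Reasoning

-- Reduced homology of a poset by weakly increasing chains.

module PosetHomology where

  open import Axiom.ExcludedMiddle using (ExcludedMiddle)
  open import Data.List.Base using (List; []; _∷_; _++_; map)
  open import Data.List.Properties using (map-id)
  open import Data.List.Relation.Unary.All as All using (All; []; _∷_)
  open import Data.List.Relation.Unary.All.Properties as All using ()
  open import Data.Nat.Base using (ℕ; zero; suc)
  open import Data.Product.Base using (∃; _×_; _,_; proj₁; proj₂; map₂)
  open import Data.Rational.Base using (ℚ; 0ℚ; 1ℚ; _+_; _-_; -_)
  open import Data.Rational.Properties as ℚ using ()
  open import Data.Rational.Solver using (module +-*-Solver)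
  open import Data.Sum.Base using (_⊎_)
  open import Function.Base using (_∘_; id)
  open import Level using (0ℓ)
  open import Relation.Binary.Core using (Rel)
  open import Relation.Binary.Definitions using (Transitive)
  open import Relation.Binary.PropositionalEquality using (_≡_; refl; sym; trans; cong; cong₂; module ≡-Reasoning)
  open import Relation.Unary using (_⊆_; _∩_)
  open Chains
  open FreeModule
  open Boundary

  module WeakChains {A : Set} (_≤_ : Rel A 0ℓ) where

    private variable
      U V Y P M : A → Set
      k : ℕ

    -- Repetitions are allowed, so that a monotone map carries chains to chains even where it
    -- identifies elements. Degenerate chains are discarded only on the return to the order complex.
    data Increasing (U : A → Set) : ℕ → List A → Set where
      []  : Increasing U 0 []
      _∷_ : ∀ {k x xs} → U x × All (x ≤_) xs → Increasing U k xs → Increasing U (suc k) (x ∷ xs)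

    Chain∈ : (A → Set) → ℕ → Comb (List A) → Set
    Chain∈ U k = AllSupp (Increasing U k)

    increasing-mono : U ⊆ V → ∀ {σ} → Increasing U k σ → Increasing V k σ
    increasing-mono U⊆V []              = []
    increasing-mono U⊆V ((u , x≤) ∷ us) = (U⊆V u , x≤) ∷ increasing-mono U⊆V us

    increasing-∩ : ∀ {σ} → Increasing U k σ → Increasing V k σ → Increasing (U ∩ V) k σ
    increasing-∩ []              []             = []
    increasing-∩ ((u , x≤) ∷ us) ((v , _) ∷ vs) = ((u , v) , x≤) ∷ increasing-∩ us vs

    increasing-All : ∀ {σ} → Increasing U k σ → All U σ
    increasing-All []             = []
    increasing-All ((u , _) ∷ us) = u ∷ increasing-All us

    increasing-upset : (∀ {x y} → x ≤ y → U x → U y) →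
      ∀ {x σ} → U x → Increasing V k (x ∷ σ) → Increasing U k (x ∷ σ)
    increasing-upset {U} {V} up u ((_ , x≤) ∷ vs) = (u , x≤) ∷ go x≤ vs
      where
      go : ∀ {k σ} → All (_ ≤_) σ → Increasing V k σ → Increasing U k σ
      go []        []             = []
      go (x≤y ∷ x≤) ((_ , y≤) ∷ vs) = (up x≤y u , y≤) ∷ go x≤ vs

    bd-All : ∀ {Q : A → Set} {σ} → All Q σ → AllSupp (All Q) (bd σ)
    bd-All []       = []
    bd-All (q ∷ qs) = qs ∷ AllSupp-negate (AllSupp-map (All.map (q ∷_) (bd-All qs)))

    bd-increasing : ∀ {σ} → Increasing U (suc k) σ → AllSupp (Increasing U k) (bd σ)
    bd-increasing ((u , [])        ∷ [])         = [] ∷ []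
    bd-increasing ((u , x≤@(_ ∷ _)) ∷ us@(_ ∷ _)) = us ∷ AllSupp-negate (AllSupp-map
      (All.zipWith (λ (x≤τ , vs) → (u , x≤τ) ∷ vs) (bd-All x≤ , bd-increasing us)))

    ∂-∈ : ∀ {c} → Chain∈ U (suc k) c → Chain∈ U k (∂ c)
    ∂-∈ = AllSupp-extend bd-increasing

    negate-∈ : ∀ {c} → Chain∈ U k c → Chain∈ U k (negate c)
    negate-∈ = AllSupp-negate

    -- For `U ⊆ V` this is the vanishing of the map that the inclusion induces on homology. Keeping
    -- `U` and `V` apart allows inductions over sets whose cycles die only in a larger set.
    BoundsIn : ℕ → (A → Set) → (A → Set) → Set
    BoundsIn k U V = ∀ z → Chain∈ U k z → ∂ z ≋ [] → ∃ λ b → Chain∈ V (suc k) b × ∂ b ≋ z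

    -- k counts vertices: this is the vanishing of H̃ₖ₋₁.
    Acyclic : ℕ → (A → Set) → Set
    Acyclic k U = BoundsIn k U U

    boundsIn-mono : ∀ {U′ V′} → U′ ⊆ U → V ⊆ V′ → BoundsIn k U V → BoundsIn k U′ V′
    boundsIn-mono U′⊆U V⊆V′ h z z∈ ∂z with b , b∈ , ∂b ← h z (All.map (increasing-mono U′⊆U) z∈) ∂z =
      b , All.map (increasing-mono V⊆V′) b∈ , ∂b

    -- Prepending the least element is a contraction: ∂ (a ∷ σ) = σ - a ∷ ∂ σ, and the last term
    -- vanishes on a cycle.
    cone : ∀ {a} → U a → (∀ {x} → U x → a ≤ x) → Acyclic k U
    cone {a = a} ua a≤ z z∈ ∂z =
        map (map₂ (a ∷_)) z
      , AllSupp-map (All.map (λ us → (ua , All.map a≤ (increasing-All us)) ∷ us) z∈)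
      , λ φ → begin
          ⟪ ∂ (map (map₂ (a ∷_)) z) , φ ⟫           ≡⟨ ⟪∂⟫ (map (map₂ (a ∷_)) z) φ ⟩
          ⟪ map (map₂ (a ∷_)) z , δ φ ⟫             ≡⟨ ⟪⟫-map (a ∷_) z (δ φ) ⟩
          ⟪ z , (λ σ → φ σ - δ (φ ∘ (a ∷_)) σ) ⟫    ≡⟨ ⟪⟫-minus z φ (δ (φ ∘ (a ∷_))) ⟩
          ⟪ z , φ ⟫ - ⟪ z , δ (φ ∘ (a ∷_)) ⟫        ≡⟨ minus-congʳ ⟪ z , φ ⟫ (trans (sym (⟪∂⟫ z _)) (∂z _)) ⟩
          ⟪ z , φ ⟫ - 0ℚ                            ≡⟨ ℚ.+-identityʳ ⟪ z , φ ⟫ ⟩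
          ⟪ z , φ ⟫ ∎
      where open ≡-Reasoning

    map-increasing : ∀ f → (∀ {x y} → x ≤ y → f x ≤ f y) → (∀ {x} → U x → V (f x)) →
      ∀ {σ} → Increasing U k σ → Increasing V k (map f σ)
    map-increasing f f-mono fU []              = []
    map-increasing f f-mono fU ((u , x≤) ∷ us) =
      (fU u , All.map⁺ (All.map f-mono x≤)) ∷ map-increasing f f-mono fU us

    module _ (f g : A → A) where

      -- The prism operator between f and g: the alternating sum of the chains f x₀, ..., f xᵢ, g
      -- xᵢ, ..., g xₖ. Its transpose is `η`.
      prism : List A → Comb (List A)
      prism []       = []
      prism (x ∷ xs) = (1ℚ , f x ∷ g x ∷ map g xs) ∷ negate (map (map₂ (f x ∷_)) (prism xs))

      η : (List A → ℚ) → List A → ℚ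
      η φ []       = 0ℚ
      η φ (x ∷ xs) = φ (f x ∷ g x ∷ map g xs) - η (φ ∘ (f x ∷_)) xs

      ⟪prism⟫ : ∀ σ φ → ⟪ prism σ , φ ⟫ ≡ η φ σ
      ⟪prism⟫ []       φ = refl
      ⟪prism⟫ (x ∷ xs) φ = cong₂ _+_ (ℚ.*-identityˡ (φ (f x ∷ g x ∷ map g xs)))
        (trans (⟪⟫-negate (map (map₂ (f x ∷_)) (prism xs)) φ)
          (cong -_ (trans (⟪⟫-map (f x ∷_) (prism xs) φ) (⟪prism⟫ xs (φ ∘ (f x ∷_))))))

      η-minus : ∀ φ ψ σ → η (λ τ → φ τ - ψ τ) σ ≡ η φ σ - η ψ σ
      η-minus φ ψ σ = trans (sym (⟪prism⟫ σ _))
        (trans (⟪⟫-minus (prism σ) φ ψ) (cong₂ _-_ (⟪prism⟫ σ φ) (⟪prism⟫ σ ψ)))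

      -- Transposed form of the homotopy formula ∂ P + P ∂ = g - f for the prism operator P.
      ηδ+δη : ∀ φ σ → η (δ φ) σ + δ (η φ) σ ≡ φ (map g σ) - φ (map f σ)
      ηδ+δη φ []       = sym (ℚ.+-inverseʳ (φ []))
      ηδ+δη φ (x ∷ xs) = begin
        (gσ - (m - δ χ gxs) - η (λ τ → φ τ - δ ψ τ) xs) + (e - δ (λ τ → χ (map g τ) - η ψ τ) xs)
          ≡⟨ cong₂ (λ s t → (gσ - (m - δ χ gxs) - s) + (e - t)) (η-minus φ (δ ψ) xs) (δ-minus (χ ∘ map g) (η ψ) xs) ⟩
        (gσ - (m - δ χ gxs) - (e - η (δ ψ) xs)) + (e - (δ (χ ∘ map g) xs - δ (η ψ) xs))
          ≡⟨ cong (λ s → (gσ - (m - s) - (e - η (δ ψ) xs)) + (e - (δ (χ ∘ map g) xs - δ (η ψ) xs))) (δ-map g χ xs) ⟩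
        (gσ - (m - δ (χ ∘ map g) xs) - (e - η (δ ψ) xs)) + (e - (δ (χ ∘ map g) xs - δ (η ψ) xs))
          ≡⟨ solve 6 (λ G m d e p q → (G :- (m :- d) :- (e :- p)) :+ (e :- (d :- q)) := G :- m :+ (p :+ q)) refl
               gσ m (δ (χ ∘ map g) xs) e (η (δ ψ) xs) (δ (η ψ) xs) ⟩
        gσ - m + (η (δ ψ) xs + δ (η ψ) xs)
          ≡⟨ cong (gσ - m +_) (ηδ+δη ψ xs) ⟩
        gσ - m + (m - φ (f x ∷ map f xs))
          ≡⟨ solve 3 (λ a b c → a :- b :+ (b :- c) := a :- c) refl gσ m (φ (f x ∷ map f xs)) ⟩
        gσ - φ (f x ∷ map f xs) ∎
        where
        open ≡-Reasoning
        open +-*-Solver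
        gxs = map g xs
        gσ = φ (g x ∷ gxs)
        ψ = φ ∘ (f x ∷_)
        χ = ψ ∘ (g x ∷_)
        m = ψ gxs
        e = η φ xs

      module _ (f-mono : ∀ {x y} → x ≤ y → f x ≤ f y) (g-mono : ∀ {x y} → x ≤ y → g x ≤ g y)
               (≤-trans : Transitive _≤_) (f≤g : ∀ {x} → U x → f x ≤ g x)
               (fU : ∀ {x} → U x → V (f x)) (gU : ∀ {x} → U x → V (g x)) where

        prism-All : ∀ {x σ} → All (x ≤_) σ → All U σ → AllSupp (All (f x ≤_)) (prism σ)
        prism-All []         []       = []
        prism-All (x≤y ∷ x≤) (u ∷ us) =
          (f-mono x≤y ∷ fx≤gy x≤y u ∷ All.map⁺ (All.zipWith (λ (p , u) → fx≤gy p u) (x≤ , us)))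
          ∷ AllSupp-negate (AllSupp-map (All.map (f-mono x≤y ∷_) (prism-All x≤ us)))
          where
          fx≤gy : ∀ {x y} → x ≤ y → U y → f x ≤ g y
          fx≤gy p u = ≤-trans (f-mono p) (f≤g u)

        prism-increasing : ∀ {σ} → Increasing U k σ → AllSupp (Increasing V (suc k)) (prism σ)
        prism-increasing []                      = []
        prism-increasing (_∷_ {x = x} (u , x≤) us) =
          ((fU u , f≤g u ∷ All.map⁺ (All.map (λ p → ≤-trans (f≤g u) (g-mono p)) x≤))
            ∷ (gU u , All.map⁺ (All.map g-mono x≤)) ∷ map-increasing g g-mono gU us)
          ∷ AllSupp-negate (AllSupp-map
              (All.zipWith (λ (q , vs) → (fU u , q) ∷ vs) (prism-All x≤ (increasing-All us) , prism-increasing us)))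

        homotopy : ∀ z → Chain∈ U k z → ∂ z ≋ [] → ∃ λ b → Chain∈ V (suc k) b ×
          (∀ φ → ⟪ ∂ b , φ ⟫ ≡ ⟪ z , φ ∘ map g ⟫ - ⟪ z , φ ∘ map f ⟫)
        homotopy z z∈ ∂z =
            extend prism z
          , AllSupp-extend prism-increasing z∈
          , λ φ → begin
              ⟪ ∂ (extend prism z) , φ ⟫                ≡⟨ ⟪∂⟫ (extend prism z) φ ⟩
              ⟪ extend prism z , δ φ ⟫                  ≡⟨ ⟪⟫-extend prism z (δ φ) ⟩
              ⟪ z , (λ σ → ⟪ prism σ , δ φ ⟫) ⟫         ≡⟨ ⟪⟫-cong z (λ σ → ⟪prism⟫ σ (δ φ)) ⟩
              ⟪ z , η (δ φ) ⟫                           ≡⟨ ℚ.+-identityʳ ⟪ z , η (δ φ) ⟫ ⟨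
              ⟪ z , η (δ φ) ⟫ + 0ℚ                      ≡⟨ cong (⟪ z , η (δ φ) ⟫ +_) (trans (sym (⟪∂⟫ z (η φ))) (∂z (η φ))) ⟨
              ⟪ z , η (δ φ) ⟫ + ⟪ z , δ (η φ) ⟫         ≡⟨ ⟪⟫-+ z (η (δ φ)) (δ (η φ)) ⟨
              ⟪ z , (λ σ → η (δ φ) σ + δ (η φ) σ) ⟫     ≡⟨ ⟪⟫-cong z (ηδ+δη φ) ⟩
              ⟪ z , (λ σ → φ (map g σ) - φ (map f σ)) ⟫ ≡⟨ ⟪⟫-minus z (φ ∘ map g) (φ ∘ map f) ⟩
              ⟪ z , φ ∘ map g ⟫ - ⟪ z , φ ∘ map f ⟫ ∎
          where open ≡-Reasoning

    -- The zigzag id ≥ f ≤ g deforms U, inside V, into the acyclic set C.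
    zigzag : (f g : A → A) → (∀ {x y} → x ≤ y → f x ≤ f y) → (∀ {x y} → x ≤ y → g x ≤ g y) → Transitive _≤_ →
      (∀ {x} → U x → f x ≤ x) → (∀ {x} → U x → f x ≤ g x) → U ⊆ V → (∀ {x} → U x → V (f x)) →
      ∀ {C} → (∀ {x} → U x → C (g x)) → C ⊆ V → Acyclic k C → BoundsIn k U V
    zigzag f g f-mono g-mono ≤-trans f≤id f≤g U⊆V fU gU C⊆V hC z z∈ ∂z
      with b₁ , b₁∈ , ∂b₁ ← homotopy f id f-mono id ≤-trans f≤id fU U⊆V z z∈ ∂z
         | b₂ , b₂∈ , ∂b₂ ← homotopy f g f-mono g-mono ≤-trans f≤g fU (λ u → C⊆V (gU u)) z z∈ ∂z
         | β , β∈ , ∂β ← hC (map (map₂ (map g)) z) (AllSupp-map (All.map (map-increasing g g-mono gU) z∈))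
                            (λ φ → trans (∂-map g z φ) (∂z (φ ∘ map g)))
      = b₁ ++ β ++ negate b₂
      , All.++⁺ b₁∈ (All.++⁺ (All.map (increasing-mono C⊆V) β∈) (negate-∈ b₂∈))
      , λ φ → begin
          ⟪ ∂ (b₁ ++ β ++ negate b₂) , φ ⟫                                ≡⟨ ∂-++ b₁ (β ++ negate b₂) φ ⟩
          ⟪ ∂ b₁ , φ ⟫ + ⟪ ∂ (β ++ negate b₂) , φ ⟫                       ≡⟨ cong (⟪ ∂ b₁ , φ ⟫ +_) (∂-++ β (negate b₂) φ) ⟩
          ⟪ ∂ b₁ , φ ⟫ + (⟪ ∂ β , φ ⟫ + ⟪ ∂ (negate b₂) , φ ⟫)
            ≡⟨ cong₂ _+_ (∂b₁ φ) (cong₂ _+_ (trans (∂β φ) (⟪⟫-map (map g) z φ)) (trans (∂-negate b₂ φ) (cong -_ (∂b₂ φ)))) ⟩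
          (⟪ z , φ ∘ map id ⟫ - ⟪ z , φ ∘ map f ⟫) + (⟪ z , φ ∘ map g ⟫ - (⟪ z , φ ∘ map g ⟫ - ⟪ z , φ ∘ map f ⟫))
            ≡⟨ telescope ⟪ z , φ ∘ map id ⟫ ⟪ z , φ ∘ map f ⟫ ⟪ z , φ ∘ map g ⟫ ⟩
          ⟪ z , φ ∘ map id ⟫                                              ≡⟨ ⟪⟫-cong z (λ σ → cong φ (map-id σ)) ⟩
          ⟪ z , φ ⟫ ∎
      where
      open ≡-Reasoning
      telescope : ∀ p q s → (p - q) + (s - (s - q)) ≡ p
      telescope = solve 3 (λ p q s → (p :- q) :+ (s :- (s :- q)) := p) refl
        where open +-*-Solver

    module MayerVietoris (em : ExcludedMiddle 0ℓ) where

      private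
        p≡s-q : ∀ p q {s : ℚ} → s ≡ q + p → p ≡ s - q
        p≡s-q p q refl = solve 2 (λ p q → p := q :+ p :- q) refl p q
          where open +-*-Solver

        regroup : ∀ a q b → a + q + (b - q) ≡ a + b
        regroup = solve 3 (λ a q b → a :+ q :+ (b :- q) := a :+ b) refl
          where open +-*-Solver

      -- Stronger than a cover of `U` by `P` and `M`: each chain must lie entirely in one of them,
      -- which is what Mayer-Vietoris for order complexes needs.
      Splits : (A → Set) → (A → Set) → (A → Set) → ℕ → Set
      Splits U P M k = ∀ {σ} → Increasing U k σ → Increasing P k σ ⊎ Increasing M k σ

      ∂-common : ∀ {b c} → Chain∈ M (suc k) b → Chain∈ P k c → ∂ b ≋ c →
        ∃ λ e → Chain∈ (P ∩ M) k e × e ≋ ∂ b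
      ∂-common b∈ c∈ eq with e , e∈ , e≋ ← common-support (λ _ → em) (∂-∈ b∈) c∈ eq =
        e , All.map (λ (p , m) → increasing-∩ p m) e∈ , e≋

      -- Mayer-Vietoris for descending from a union to a part. A filling of z in `U` is a + b with a
      -- in `P` and b in `M`; then ∂ b = z - ∂ a lies in both, is a cycle there and is filled by
      -- some q, so a + q fills z inside `P`.
      acyclic-part : P ⊆ U → Splits U P M (suc k) → Acyclic k U → Acyclic k (P ∩ M) → Acyclic k P
      acyclic-part P⊆U splits hU hPM z z∈ ∂z
        with w , w∈ , ∂w≋z ← hU z (All.map (increasing-mono P⊆U) z∈) ∂z
        with a , b , a∈ , b∈ , w≋ab ← split w (All.map splits w∈)
        = finish (∂-common b∈ (All.++⁺ z∈ (negate-∈ (∂-∈ a∈))) ∂b≋z-∂a)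
        where
        open ≡-Reasoning
        z≋∂a+∂b : ∀ φ → ⟪ z , φ ⟫ ≡ ⟪ ∂ a , φ ⟫ + ⟪ ∂ b , φ ⟫
        z≋∂a+∂b φ = begin
          ⟪ z , φ ⟫                    ≡⟨ ∂w≋z φ ⟨
          ⟪ ∂ w , φ ⟫                  ≡⟨ ⟪∂⟫ w φ ⟩
          ⟪ w , δ φ ⟫                  ≡⟨ w≋ab (δ φ) ⟩
          ⟪ a , δ φ ⟫ + ⟪ b , δ φ ⟫    ≡⟨ cong₂ _+_ (⟪∂⟫ a φ) (⟪∂⟫ b φ) ⟨
          ⟪ ∂ a , φ ⟫ + ⟪ ∂ b , φ ⟫ ∎
        ∂b≋z-∂a : ∂ b ≋ z ++ negate (∂ a)
        ∂b≋z-∂a φ = begin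
          ⟪ ∂ b , φ ⟫                         ≡⟨ p≡s-q ⟪ ∂ b , φ ⟫ ⟪ ∂ a , φ ⟫ (z≋∂a+∂b φ) ⟩
          ⟪ z , φ ⟫ - ⟪ ∂ a , φ ⟫             ≡⟨ cong (⟪ z , φ ⟫ +_) (⟪⟫-negate (∂ a) φ) ⟨
          ⟪ z , φ ⟫ + ⟪ negate (∂ a) , φ ⟫    ≡⟨ ⟪⟫-++ z (negate (∂ a)) φ ⟨
          ⟪ z ++ negate (∂ a) , φ ⟫ ∎
        finish : (∃ λ e → Chain∈ _ _ e × e ≋ ∂ b) → _
        finish (e , e∈ , e≋∂b)
          with q , q∈ , ∂q≋e ← hPM e e∈ (λ φ → trans (∂-cong e (∂ b) e≋∂b φ) (∂∂ b φ))
          = a ++ q , All.++⁺ a∈ (All.map (increasing-mono proj₁) q∈) , λ φ → begin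
              ⟪ ∂ (a ++ q) , φ ⟫           ≡⟨ ∂-++ a q φ ⟩
              ⟪ ∂ a , φ ⟫ + ⟪ ∂ q , φ ⟫    ≡⟨ cong (⟪ ∂ a , φ ⟫ +_) (trans (∂q≋e φ) (e≋∂b φ)) ⟩
              ⟪ ∂ a , φ ⟫ + ⟪ ∂ b , φ ⟫    ≡⟨ z≋∂a+∂b φ ⟨
              ⟪ z , φ ⟫ ∎

      -- Mayer-Vietoris for building up a union. Write z = a + b; the chain ∂ b = - ∂ a lies in the
      -- overlap, one degree lower, and has a filling q there. Now a + q and b - q are cycles in `P`
      -- and `M` that are filled separately, the first within `Y`.
      boundsIn-union : M ⊆ Y → Splits U P M k → BoundsIn k P Y → Acyclic k M →
        (∀ {l} → k ≡ suc l → Acyclic l (P ∩ M)) → BoundsIn k U Y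
      -- The only chain without vertices is the empty list, which lies in `P` as well, so there is
      -- nothing to split.
      boundsIn-union {k = zero} M⊆Y splits hP hM hPM z z∈ ∂z = hP z (All.map (λ { [] → [] }) z∈) ∂z
      boundsIn-union {k = suc l} M⊆Y splits hP hM hPM z z∈ ∂z
        with a , b , a∈ , b∈ , z≋ab ← split z (All.map splits z∈)
        = finish (∂-common b∈ (negate-∈ (∂-∈ a∈)) ∂b≋-∂a)
        where
        open ≡-Reasoning
        0≡∂a+∂b : ∀ φ → 0ℚ ≡ ⟪ ∂ a , φ ⟫ + ⟪ ∂ b , φ ⟫
        0≡∂a+∂b φ = begin
          0ℚ                           ≡⟨ ∂z φ ⟨
          ⟪ ∂ z , φ ⟫                  ≡⟨ ⟪∂⟫ z φ ⟩
          ⟪ z , δ φ ⟫                  ≡⟨ z≋ab (δ φ) ⟩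
          ⟪ a , δ φ ⟫ + ⟪ b , δ φ ⟫    ≡⟨ cong₂ _+_ (⟪∂⟫ a φ) (⟪∂⟫ b φ) ⟨
          ⟪ ∂ a , φ ⟫ + ⟪ ∂ b , φ ⟫ ∎
        ∂b≋-∂a : ∂ b ≋ negate (∂ a)
        ∂b≋-∂a φ = begin
          ⟪ ∂ b , φ ⟫             ≡⟨ p≡s-q ⟪ ∂ b , φ ⟫ ⟪ ∂ a , φ ⟫ (0≡∂a+∂b φ) ⟩
          0ℚ - ⟪ ∂ a , φ ⟫        ≡⟨ ℚ.+-identityˡ (- ⟪ ∂ a , φ ⟫) ⟩
          - ⟪ ∂ a , φ ⟫           ≡⟨ ⟪⟫-negate (∂ a) φ ⟨
          ⟪ negate (∂ a) , φ ⟫ ∎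
        finish : (∃ λ e → Chain∈ _ _ e × e ≋ ∂ b) → _
        finish (e , e∈ , e≋∂b)
          with q , q∈ , ∂q≋e ← hPM refl e e∈ (λ φ → trans (∂-cong e (∂ b) e≋∂b φ) (∂∂ b φ))
          = conclude
              (hP (a ++ q) (All.++⁺ a∈ (All.map (increasing-mono proj₁) q∈)) λ φ →
                trans (∂-++ a q φ) (trans (cong (⟪ ∂ a , φ ⟫ +_) (∂q≋∂b φ)) (sym (0≡∂a+∂b φ))))
              (hM (b ++ negate q) (All.++⁺ b∈ (negate-∈ (All.map (increasing-mono proj₂) q∈))) λ φ →
                trans (∂-++ b (negate q) φ) (trans (cong (⟪ ∂ b , φ ⟫ +_) (trans (∂-negate q φ) (cong -_ (∂q≋∂b φ))))
                  (ℚ.+-inverseʳ ⟪ ∂ b , φ ⟫)))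
          where
          ∂q≋∂b : ∂ q ≋ ∂ b
          ∂q≋∂b φ = trans (∂q≋e φ) (e≋∂b φ)
          conclude : (∃ λ α → Chain∈ _ _ α × ∂ α ≋ a ++ q) → (∃ λ β → Chain∈ _ _ β × ∂ β ≋ b ++ negate q) → _
          conclude (α , α∈ , ∂α) (β , β∈ , ∂β) = α ++ β , All.++⁺ α∈ (All.map (increasing-mono M⊆Y) β∈) , λ φ → begin
            ⟪ ∂ (α ++ β) , φ ⟫                                      ≡⟨ ∂-++ α β φ ⟩
            ⟪ ∂ α , φ ⟫ + ⟪ ∂ β , φ ⟫                               ≡⟨ cong₂ _+_ (∂α φ) (∂β φ) ⟩
            ⟪ a ++ q , φ ⟫ + ⟪ b ++ negate q , φ ⟫                  ≡⟨ cong₂ _+_ (⟪⟫-++ a q φ) (⟪⟫-++ b (negate q) φ) ⟩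
            ⟪ a , φ ⟫ + ⟪ q , φ ⟫ + (⟪ b , φ ⟫ + ⟪ negate q , φ ⟫)  ≡⟨ cong (λ t → ⟪ a , φ ⟫ + ⟪ q , φ ⟫ + (⟪ b , φ ⟫ + t)) (⟪⟫-negate q φ) ⟩
            ⟪ a , φ ⟫ + ⟪ q , φ ⟫ + (⟪ b , φ ⟫ - ⟪ q , φ ⟫)         ≡⟨ regroup ⟪ a , φ ⟫ ⟪ q , φ ⟫ ⟪ b , φ ⟫ ⟩
            ⟪ a , φ ⟫ + ⟪ b , φ ⟫                                   ≡⟨ z≋ab φ ⟨
            ⟪ z , φ ⟫ ∎

-- Partial maps: joins and the removal of a cell.

module PartialMaps where

  open import Axiom.ExcludedMiddle using (ExcludedMiddle)
  open import Data.Fin.Base using (Fin)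
  open import Data.Fin.Properties using (_≟_)
  open import Data.List.Base using (List; []; _∷_; length; allFin; filter)
  open import Data.List.Membership.Propositional using (_∈_; _∉_)
  open import Data.List.Membership.Propositional.Properties using (∈-filter⁺; ∈-filter⁻; ∈-allFin)
  open import Data.List.Relation.Unary.All as All using (All; []; _∷_)
  open import Data.List.Relation.Unary.AllPairs using ([]; _∷_)
  open import Data.List.Relation.Unary.Any using (here; there)
  open import Data.List.Relation.Unary.Unique.Propositional using (Unique)
  open import Data.List.Relation.Unary.Unique.Propositional.Properties using (allFin⁺; filter⁺)
  open import Data.Maybe.Base using (Maybe; just; nothing)
  open import Data.Maybe.Properties using (just-injective)
  open import Data.Nat.Base as ℕ using (ℕ; suc; s≤s)
  open import Data.Product.Base using (∃; ∃₂; _×_; _,_; proj₂)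
  open import Data.Sum.Base using (_⊎_; inj₁; inj₂)
  open import Data.Vec.Base using (Vec; lookup; _[_]≔_)
  open import Data.Vec.Properties using (lookup∘update; lookup∘update′)
  open import Function.Base using (id; _∘_; case_of_)
  open import Level using (0ℓ)
  open import Relation.Binary.PropositionalEquality using (_≡_; _≢_; refl; sym; trans; subst)
  open import Relation.Nullary using (¬_; Dec; yes; no; contradiction)
  open import Relation.Unary using (_∩_; _∪_)
  open PosetHomology

  module _ {n r : ℕ} where

    -- A tuple of pairwise disjoint subsets of Fin n, as the partial map sending
    -- a point to the index of the part that contains it.
    PartialMap : Set
    PartialMap = Vec (Maybe (Fin r)) n

    private variable
      σ τ B : PartialMap
      i i′ : Fin r
      j j′ : Fin n

    infix 4 _⊑_

    record _⊑_ (σ τ : PartialMap) : Set where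
      constructor mk⊑
      field
        transfer : ∀ {j i} → lookup σ j ≡ just i → lookup τ j ≡ just i

    open _⊑_ public

    ⊑-refl : σ ⊑ σ
    ⊑-refl = mk⊑ id

    ⊑-trans : ∀ {σ τ ρ} → σ ⊑ τ → τ ⊑ ρ → σ ⊑ ρ
    ⊑-trans σ⊑τ τ⊑ρ = mk⊑ (transfer τ⊑ρ ∘ transfer σ⊑τ)

    erase : Fin n → PartialMap → PartialMap
    erase j σ = σ [ j ]≔ nothing

    assign : Fin n → Fin r → PartialMap → PartialMap
    assign j i σ = σ [ j ]≔ just i

    lookup-erase⁻ : ∀ σ → lookup (erase j σ) j′ ≡ just i → j′ ≢ j × lookup σ j′ ≡ just i
    lookup-erase⁻ {j} {j′} σ eq with j′ ≟ j
    ... | yes refl = contradiction (trans (sym (lookup∘update j σ nothing)) eq) λ ()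
    ... | no j′≢j  = j′≢j , trans (sym (lookup∘update′ j′≢j σ nothing)) eq

    lookup-erase⁺ : ∀ σ → j′ ≢ j → lookup σ j′ ≡ just i → lookup (erase j σ) j′ ≡ just i
    lookup-erase⁺ σ j′≢j eq = trans (lookup∘update′ j′≢j σ nothing) eq

    lookup-assign : ∀ σ → lookup (assign j i σ) j ≡ just i
    lookup-assign {j} σ = lookup∘update j σ _

    erase-⊑ : ∀ σ → erase j σ ⊑ σ
    erase-⊑ σ = mk⊑ (proj₂ ∘ lookup-erase⁻ σ)

    erase-⊑-assign : ∀ σ → erase j σ ⊑ assign j i σ
    erase-⊑-assign σ = mk⊑ λ eq → let j′≢j , eq′ = lookup-erase⁻ σ eq in trans (lookup∘update′ j′≢j σ _) eq′

    erase-mono : σ ⊑ τ → erase j σ ⊑ erase j τ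
    erase-mono {σ} {τ} σ⊑τ = mk⊑ λ eq →
      let j′≢j , eq′ = lookup-erase⁻ σ eq in lookup-erase⁺ τ j′≢j (transfer σ⊑τ eq′)

    assign-least : erase j σ ⊑ τ → lookup τ j ≡ just i → assign j i σ ⊑ τ
    assign-least {j} {σ} {τ} {i} σ⊑τ τj = mk⊑ go
      where
      go : lookup (assign j i σ) j′ ≡ just i′ → lookup τ j′ ≡ just i′
      go {j′} eq with j′ ≟ j
      ... | yes refl = trans τj (trans (sym (lookup-assign σ)) eq)
      ... | no j′≢j  = transfer σ⊑τ (lookup-erase⁺ σ j′≢j (trans (sym (lookup∘update′ j′≢j σ _)) eq))

    assign-mono : σ ⊑ τ → assign j i σ ⊑ assign j i τ
    assign-mono {σ} {τ} σ⊑τ =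
      assign-least (⊑-trans (erase-mono σ⊑τ) (erase-⊑-assign τ)) (lookup-assign τ)

    ⊑-assign : lookup σ j ≡ nothing → σ ⊑ assign j i σ
    ⊑-assign {σ} {j} {i} isFree = mk⊑ go
      where
      go : lookup σ j′ ≡ just i′ → lookup (assign j i σ) j′ ≡ just i′
      go {j′} eq with j′ ≟ j
      ... | yes refl = contradiction (trans (sym isFree) eq) λ ()
      ... | no j′≢j  = trans (lookup∘update′ j′≢j σ _) eq

    free? : ∀ (B : PartialMap) j → Dec (lookup B j ≡ nothing)
    free? B j with lookup B j
    ... | nothing = yes refl
    ... | just _  = no λ ()

    free : PartialMap → List (Fin n)
    free B = filter (free? B) (allFin n)

    open WeakChains {PartialMap} _⊑_ public

    module _ (em : ExcludedMiddle 0ℓ) where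

      open MayerVietoris em

      -- A chain lies in every upset that contains its least element, so for upsets a cover of the
      -- elements is a cover of the chains.
      upset-splits : ∀ {U P M k} → (∀ {σ τ} → σ ⊑ τ → P σ → P τ) → (∀ {σ τ} → σ ⊑ τ → M σ → M τ) →
        (∀ {σ} → U σ → P σ ⊎ M σ) → Splits U P M k
      upset-splits P-up M-up cases []                    = inj₁ []
      upset-splits P-up M-up cases us@((u , _) ∷ _) with cases u
      ... | inj₁ p = inj₁ (increasing-upset P-up p us)
      ... | inj₂ m = inj₂ (increasing-upset M-up m us)

      module _ (G : Fin n → Fin r → Set) where

        Hits : List (Fin n) → PartialMap → Set
        Hits J σ = ∃ λ j → j ∈ J × ∃ λ i → lookup σ j ≡ just i × G j i

        hits-up : ∀ {J} → σ ⊑ τ → Hits J σ → Hits J τ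
        hits-up σ⊑τ (j , j∈J , i , eq , g) = j , j∈J , i , transfer σ⊑τ eq , g

        Above∩Hits : PartialMap → List (Fin n) → PartialMap → Set
        Above∩Hits B J σ = B ⊑ σ × Hits J σ

        -- Up to homotopy this is the join of the nonempty sets G j with j ∈ J.
        join-acyclic : ∀ J → Unique J → ∀ B → (∀ {j} → j ∈ J → lookup B j ≡ nothing) →
          (∀ {j} → j ∈ J → ∃ (G j)) → ∀ {k} → k ℕ.< length J → Acyclic k (Above∩Hits B J)
        join-acyclic (j ∷ J) (j∉J ∷ J!) B B-free nonempty {k} (s≤s k≤) =
          boundsIn-mono include id (spread (allFin r))
          where
          Y = Above∩Hits B (j ∷ J)

          -- These sets interpolate between the join over `J` and the join over `j ∷ J`: each new i
          -- in `G j` adds the cone above `assign j i B`.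
          Stage : List (Fin r) → PartialMap → Set
          Stage is σ = B ⊑ σ × (Hits J σ ⊎ ∃ λ i → i ∈ is × lookup σ j ≡ just i × G j i)

          include : ∀ {σ} → Y σ → Stage (allFin r) σ
          include (B⊑σ , _ , here refl , i , eq , g) = B⊑σ , inj₂ (i , ∈-allFin i , eq , g)
          include (B⊑σ , j′ , there j′∈J , h)        = B⊑σ , inj₁ (j′ , j′∈J , h)

          stage-up : ∀ {is σ τ} → σ ⊑ τ → Stage is σ → Stage is τ
          stage-up σ⊑τ (B⊑σ , inj₁ h)                = ⊑-trans B⊑σ σ⊑τ , inj₁ (hits-up σ⊑τ h)
          stage-up σ⊑τ (B⊑σ , inj₂ (i , i∈ , eq , g)) = ⊑-trans B⊑σ σ⊑τ , inj₂ (i , i∈ , transfer σ⊑τ eq , g)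

          not-j : ∀ {j′} → j′ ∈ J → j′ ≢ j
          not-j j′∈J refl = All.lookup j∉J j′∈J refl

          above⊆Y : ∀ {i} → G j i → ∀ {σ} → assign j i B ⊑ σ → Y σ
          above⊆Y {i} g le = ⊑-trans (⊑-assign (B-free (here refl))) le
                               , j , here refl , i , transfer le (lookup-assign B) , g

          above-acyclic : ∀ {i} → Acyclic k (assign j i B ⊑_)
          above-acyclic = cone ⊑-refl id

          -- One i in `G j` contracts the join over `J` inside `Y`: forget the value at j, then set
          -- it to i, which lands in the cone above `assign j i B`. For k = length `J` the induction
          -- hypothesis does not make the join over `J` acyclic, so its cycles have to be filled in
          -- `Y`.
          start : BoundsIn k (Above∩Hits B J) Y
          start with i , g ← nonempty (here refl) =
            zigzag (erase j) (assign j i)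
              erase-mono assign-mono
              ⊑-trans
              (λ {σ} _ → erase-⊑ σ) (λ {σ} _ → erase-⊑-assign σ)
              (λ (B⊑σ , j′ , j′∈J , h) → B⊑σ , j′ , there j′∈J , h)
              (λ {σ} (B⊑σ , j′ , j′∈J , i , eq , g) →
                  mk⊑ (λ eqB → lookup-erase⁺ σ (λ { refl → contradiction (trans (sym eqB) (B-free (here refl))) λ () }) (transfer B⊑σ eqB))
                , j′ , there j′∈J , i , lookup-erase⁺ σ (not-j j′∈J) eq , g)
              (λ {σ} (B⊑σ , _) → assign-mono B⊑σ)
              (above⊆Y g) above-acyclic

          spread : ∀ is → BoundsIn k (Stage is) Y
          spread []       = boundsIn-mono (λ { (B⊑σ , inj₁ h) → B⊑σ , h ; (_ , inj₂ (_ , () , _)) }) id start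
          -- If i is not in `G j` or occurs again in `is`, then adding it changes nothing.
          spread (i ∷ is) with em {G j i × i ∉ is}
          ... | no redundant = boundsIn-mono shrink id (spread is)
            where
            shrink : ∀ {σ} → Stage (i ∷ is) σ → Stage is σ
            shrink (B⊑σ , inj₁ h)                              = B⊑σ , inj₁ h
            shrink (B⊑σ , inj₂ (i′ , there i′∈is , h))         = B⊑σ , inj₂ (i′ , i′∈is , h)
            shrink (B⊑σ , inj₂ (i′ , here refl , eq , g)) with em {i ∈ is}
            ... | yes i∈is = B⊑σ , inj₂ (i , i∈is , eq , g)
            ... | no i∉is  = contradiction (g , i∉is) redundant
          ... | yes (g , i∉is) = boundsIn-union (above⊆Y g)
              (upset-splits stage-up (λ σ⊑τ le → ⊑-trans le σ⊑τ) cases)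
              (spread is) above-acyclic on-overlap
            where
            cases : ∀ {σ} → Stage (i ∷ is) σ → Stage is σ ⊎ (assign j i B ⊑ σ)
            cases (B⊑σ , inj₁ h)                      = inj₁ (B⊑σ , inj₁ h)
            cases (B⊑σ , inj₂ (i′ , there i′∈is , h)) = inj₁ (B⊑σ , inj₂ (i′ , i′∈is , h))
            cases (B⊑σ , inj₂ (_ , here refl , eq , _)) =
              inj₂ (assign-least (⊑-trans (erase-⊑ B) B⊑σ) eq)
            -- Above `assign j i B` the value at j is i, which is not in `is`, so only hits in `J`
            -- remain. The degree has dropped by one, which pays for the shorter list in the
            -- induction.
            on-overlap : ∀ {l} → k ≡ suc l → Acyclic l (Stage is ∩ (assign j i B ⊑_))
            on-overlap refl = boundsIn-mono to from
              (join-acyclic J J! (assign j i B)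
                (λ j′∈J → trans (lookup∘update′ (not-j j′∈J) B _) (B-free (there j′∈J)))
                (λ j′∈J → nonempty (there j′∈J)) k≤)
              where
              to : ∀ {σ} → (Stage is ∩ (assign j i B ⊑_)) σ → Above∩Hits (assign j i B) J σ
              to ((_ , inj₁ h) , le)                     = le , h
              to ((_ , inj₂ (i′ , i′∈is , eq , _)) , le) =
                contradiction (subst (_∈ is) (just-injective (trans (sym eq) (transfer le (lookup-assign B)))) i′∈is) i∉is
              from : ∀ {σ} → Above∩Hits (assign j i B) J σ → (Stage is ∩ (assign j i B ⊑_)) σ
              from (le , h) = (⊑-trans (⊑-assign (B-free (here refl))) le , inj₁ h) , le

      Within : (Fin n → Fin r → Set) → PartialMap → Set
      Within T σ = ∀ {j i} → lookup σ j ≡ just i → T j i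

      Cell : PartialMap → (Fin n → Fin r → Set) → PartialMap → Set
      Cell B T σ = B ⊑ σ × Within T σ

      -- `outside` and `inside` identify the part of `U` above `B` with the maps above `B` that
      -- leave `T`. As `B` stays within `T`, they leave it at a point that is free in `B`; by
      -- `proper` there is a value outside `T` at each such point, so this is a join of nonempty
      -- sets over `free B`.
      remove-cell : ∀ {U B T k} → (∀ {σ τ} → σ ⊑ τ → U σ → U τ) → Within T B → (∀ j → ∃ λ i → ¬ T j i) →
        (∀ {σ} → B ⊑ σ → ¬ Within T σ → U σ) → (∀ {σ} → Cell B T σ → ¬ U σ) →
        k ℕ.< length (free B) → Acyclic k (U ∪ Cell B T) → Acyclic k U
      remove-cell {U} {B} {T} {k} U-up T-B proper outside inside k< h =
        acyclic-part inj₁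
          (upset-splits U-up (λ σ⊑τ le → ⊑-trans le σ⊑τ)
            λ { (inj₁ u) → inj₁ u ; (inj₂ (B⊑σ , _)) → inj₂ B⊑σ })
          h
          (boundsIn-mono to from
            (join-acyclic (λ j i → ¬ T j i) (free B) (filter⁺ (free? B) (allFin⁺ n)) B
              (λ j∈ → proj₂ (∈-filter⁻ (free? B) {xs = allFin n} j∈)) (λ _ → proper _) k<))
        where
        to : ∀ {σ} → (U ∩ (B ⊑_)) σ → Above∩Hits (λ j i → ¬ T j i) B (free B) σ
        to {σ} (u , B⊑σ) with em {∃₂ λ j i → lookup σ j ≡ just i × ¬ T j i}
        ... | no none = contradiction u (inside (B⊑σ , λ {j} {i} eq →
                case em {T j i} of λ { (yes t) → t ; (no ¬t) → contradiction (j , i , eq , ¬t) none }))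
        ... | yes (j , i , eq , ¬t) = B⊑σ , j , ∈-filter⁺ (free? B) (∈-allFin j) (isFree (lookup B j) refl) , i , eq , ¬t
          where
          isFree : ∀ m → lookup B j ≡ m → lookup B j ≡ nothing
          isFree nothing   eq′ = eq′
          isFree (just i′) eq′ with refl ← just-injective (trans (sym eq) (transfer B⊑σ eq′)) = contradiction (T-B eq′) ¬t
        from : ∀ {σ} → Above∩Hits (λ j i → ¬ T j i) B (free B) σ → (U ∩ (B ⊑_)) σ
        from (B⊑σ , j , _ , i , eq , ¬t) = outside B⊑σ (λ w → ¬t (w eq)) , B⊑σ

-- Comparison of weak chains with the simplices of the order complex.

module StrictSimplices where

  open import Data.Bool.Base using (true; false; if_then_else_)
  open import Data.Fin.Base using (Fin; zero; suc; toℕ)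
  open import Data.Fin.Subset using (Subset)
  open import Data.List.Base as List using (List; []; _∷_; _++_; map; length; tabulate; allFin)
  open import Data.List.Membership.Propositional using (_∈_)
  open import Data.List.Membership.Propositional.Properties using (∈-filter⁻; ∈-map⁻; ∈-map⁺)
  open import Data.List.Properties as List using (map-tabulate; length-filter)
  open import Data.List.Relation.Unary.All as All using (All; []; _∷_)
  open import Data.List.Relation.Unary.Any using (here; there)
  open import Data.Nat.Base as ℕ using (ℕ; zero; suc; s≤s)
  open import Data.Nat.Properties as ℕ using ()
  open import Data.Product.Base using (∃; _×_; _,_; proj₁; proj₂; map₂)
  open import Data.Rational.Base using (ℚ; 0ℚ; 1ℚ; _+_; _*_; _-_; -_)
  open import Data.Rational.Properties as ℚ using ()
  open import Data.Rational.Solver using (module +-*-Solver)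
  open import Data.Sum.Base using (_⊎_; inj₁; inj₂)
  open import Data.Vec.Base as Vec using (Vec; []; _∷_; removeAt; toList)
  open import Data.Vec.Properties as Vec using ()
  open import Data.Vec.Relation.Binary.Pointwise.Inductive as Pointwise using (Pointwise; []; _∷_)
  open import Data.Vec.Relation.Unary.All as VecAll using ([]; _∷_)
  open import Data.Vec.Relation.Unary.AllPairs using (AllPairs; []; _∷_)
  open import Defs using (module OrderComplex; tuples)
  open import Function.Base using (_∘_; id)
  open import Function.Bundles using (mk⇔)
  open import Relation.Binary.Bundles using (DecPoset)
  import Relation.Binary.Construct.On as On
  open import Relation.Binary.Definitions using (DecidableEquality)
  open import Relation.Binary.PropositionalEquality using (_≡_; _≢_; refl; sym; trans; cong; cong₂; module ≡-Reasoning)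
  open import Relation.Nullary using (¬_; Dec; yes; no; does; contradiction)
  open import Relation.Nullary.Decidable using (does-⇔; ¬?; dec-false)
  open Chains
  open PosetHomology
  open FreeModule
  open Boundary

  module Coefficients {X : Set} (_≟_ : DecidableEquality X) where

    χ : X → X → ℚ
    χ x y = if does (y ≟ x) then 1ℚ else 0ℚ

    χ-≢ : ∀ {x y} → y ≢ x → χ x y ≡ 0ℚ
    χ-≢ {x} {y} y≢x = cong (if_then 1ℚ else 0ℚ) (dec-false (y ≟ x) y≢x)

    -- Any φ is φ x times the coefficient functional of x plus a functional that vanishes at x, and
    -- the latter sees only the entries different from x, a shorter list. Testing just the simplices
    -- that occur in `c` matters: `IsCycle` speaks of no lists other than simplices of the complex.
    coefficients-determine : ∀ c → (∀ {x} → x ∈ map proj₂ c → ⟪ c , χ x ⟫ ≡ 0ℚ) → c ≋ []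
    coefficients-determine c = go (length c) c ℕ.≤-refl
      where
      go : ∀ N c → length c ℕ.≤ N → (∀ {x} → x ∈ map proj₂ c → ⟪ c , χ x ⟫ ≡ 0ℚ) → c ≋ []
      go N       []            _   _     φ = refl
      go (suc N) c@((a , x) ∷ c′) (s≤s c≤) zeros φ = begin
        ⟪ c , φ ⟫                                               ≡⟨ ⟪⟫-cong c separate ⟩
        ⟪ c , (λ y → φ x * χ x y + indicator other φ y) ⟫       ≡⟨ ⟪⟫-+ c (λ y → φ x * χ x y) (indicator other φ) ⟩
        ⟪ c , (λ y → φ x * χ x y) ⟫ + ⟪ c , indicator other φ ⟫ ≡⟨ cong₂ _+_ (⟪⟫-* c (φ x) (χ x)) (sym (⟪⟫-restrict other c φ)) ⟩
        φ x * ⟪ c , χ x ⟫ + ⟪ restrict other c , φ ⟫            ≡⟨ cong₂ _+_ (cong (φ x *_) (zeros (here refl))) (rest φ) ⟩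
        φ x * 0ℚ + 0ℚ                                           ≡⟨ cong (_+ 0ℚ) (ℚ.*-zeroʳ (φ x)) ⟩
        0ℚ ∎
        where
        open ≡-Reasoning
        other : ∀ y → Dec (y ≢ x)
        other y = ¬? (y ≟ x)
        separate : ∀ y → φ y ≡ φ x * χ x y + indicator other φ y
        separate y with y ≟ x
        ... | yes refl = sym (trans (ℚ.+-identityʳ (φ x * 1ℚ)) (ℚ.*-identityʳ (φ x)))
        ... | no  _    = sym (trans (cong (_+ φ y) (ℚ.*-zeroʳ (φ x))) (ℚ.+-identityˡ (φ y)))
        shorter : length (restrict other c) ℕ.≤ N
        shorter with x ≟ x
        ... | yes _   = ℕ.≤-trans (length-filter (other ∘ proj₂) c′) c≤
        ... | no x≢x  = contradiction refl x≢x
        rest : restrict other c ≋ []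
        rest = go N (restrict other c) shorter λ {y} y∈ → rest-zero y (∈-map⁻ proj₂ y∈)
          where
          rest-zero : ∀ y → (∃ λ e → e ∈ restrict other c × y ≡ proj₂ e) → ⟪ restrict other c , χ y ⟫ ≡ 0ℚ
          rest-zero y ((b , .y) , e∈ , refl) with e∈c , y≢x ← ∈-filter⁻ (other ∘ proj₂) {xs = c} e∈ = begin
            ⟪ restrict other c , χ y ⟫    ≡⟨ ⟪⟫-restrict other c (χ y) ⟩
            ⟪ c , indicator other (χ y) ⟫ ≡⟨ ⟪⟫-cong c same ⟩
            ⟪ c , χ y ⟫                   ≡⟨ zeros (∈-map⁺ proj₂ e∈c) ⟩
            0ℚ ∎
            where
            same : ∀ w → indicator other (χ y) w ≡ χ y w
            same w with w ≟ x
            ... | yes refl = sym (χ-≢ (y≢x ∘ sym))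
            ... | no  _    = refl

  ⟪tabulate⟫-cong : ∀ {X Y : Set} {k} (f f′ : Fin k → ℚ) (g : Fin k → X) (g′ : Fin k → Y) φ φ′ →
    (∀ i → f i * φ (g i) ≡ f′ i * φ′ (g′ i)) →
    ⟪ tabulate (λ i → f i , g i) , φ ⟫ ≡ ⟪ tabulate (λ i → f′ i , g′ i) , φ′ ⟫
  ⟪tabulate⟫-cong {k = zero}  f f′ g g′ φ φ′ eq = refl
  ⟪tabulate⟫-cong {k = suc k} f f′ g g′ φ φ′ eq =
    cong₂ _+_ (eq zero) (⟪tabulate⟫-cong (f ∘ suc) (f′ ∘ suc) (g ∘ suc) (g′ ∘ suc) φ φ′ (eq ∘ suc))

  module _ {X : Set} where

    data Degenerate : List X → Set where
      here  : ∀ {x xs} → Degenerate (x ∷ x ∷ xs)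
      there : ∀ {x xs} → Degenerate xs → Degenerate (x ∷ xs)

    -- Dual form of the fact that degenerate chains span a subcomplex: the faces that delete one of
    -- two equal neighbours agree and have opposite signs, and all other faces are degenerate again.
    δ-degenerate : ∀ φ → (∀ {τ} → Degenerate τ → φ τ ≡ 0ℚ) → ∀ {τ} → Degenerate τ → δ φ τ ≡ 0ℚ
    δ-degenerate φ vanish {x ∷ x ∷ xs} here = begin
      φ (x ∷ xs) - (φ (x ∷ xs) - δ (φ ∘ (x ∷_) ∘ (x ∷_)) xs)  ≡⟨ cancel (φ (x ∷ xs)) (δ (φ ∘ (x ∷_) ∘ (x ∷_)) xs) ⟩
      δ (φ ∘ (x ∷_) ∘ (x ∷_)) xs                              ≡⟨ δ-cong (λ _ → vanish here) xs ⟩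
      δ (λ _ → 0ℚ) xs                                         ≡⟨ δ-zero xs ⟩
      0ℚ ∎
      where
      open ≡-Reasoning
      cancel : ∀ a b → a - (a - b) ≡ b
      cancel = solve 2 (λ a b → a :- (a :- b) := b) refl
        where open +-*-Solver
    δ-degenerate φ vanish {x ∷ xs} (there d) =
      cong₂ _-_ (vanish d) (δ-degenerate (φ ∘ (x ∷_)) (vanish ∘ there) d)

  module StrictChains {n r : ℕ} (IsVertex : Vec (Subset n) r → Set) where

    private
      module T = DecPoset (tuples n r)
      Tup = T.Carrier
      Vertex = ∃ IsVertex

      variable
        k : ℕ

    open OrderComplex (On.decPoset (tuples n r) (proj₁ {B = IsVertex})) renaming (∂ to ∂ᶜ)
    open WeakChains {Tup} T._≤_
    open Coefficients (List.≡-dec T._≟_)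

    underlying : Vec Vertex k → List Tup
    underlying vs = toList (Vec.map proj₁ vs)

    forget : Chain k → Comb (List Tup)
    forget = map (map₂ (underlying ∘ vertices))

    same? : (vs ws : Vec Vertex k) → Dec (Pointwise (λ v w → proj₁ v ≡ proj₁ w) vs ws)
    same? = Pointwise.decidable λ v w → proj₁ v T.≟ proj₁ w

    same⇒≡ : {vs ws : Vec Vertex k} → Pointwise (λ v w → proj₁ v ≡ proj₁ w) vs ws → underlying vs ≡ underlying ws
    same⇒≡ []        = refl
    same⇒≡ (eq ∷ eqs) = cong₂ _∷_ eq (same⇒≡ eqs)

    ≡⇒same : (vs ws : Vec Vertex k) → underlying vs ≡ underlying ws → Pointwise (λ v w → proj₁ v ≡ proj₁ w) vs ws
    ≡⇒same []       []       eq = []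
    ≡⇒same (v ∷ vs) (w ∷ ws) eq = List.∷-injectiveˡ eq ∷ ≡⇒same vs ws (List.∷-injectiveʳ eq)

    coefficient-forget : ∀ (c : Chain k) σ → coefficient c σ ≡ ⟪ forget c , χ (underlying (vertices σ)) ⟫
    coefficient-forget []            σ = refl
    coefficient-forget ((a , τ) ∷ c) σ = cong₂ _+_
      (trans (select (does (same? (vertices τ) (vertices σ))))
        (cong (λ b → a * (if b then 1ℚ else 0ℚ)) (does-⇔ (mk⇔ same⇒≡ (≡⇒same (vertices τ) (vertices σ)))
          (same? (vertices τ) (vertices σ)) (List.≡-dec T._≟_ (underlying (vertices τ)) (underlying (vertices σ))))))
      (coefficient-forget c σ)
      where
      select : ∀ b → (if b then a else 0ℚ) ≡ a * (if b then 1ℚ else 0ℚ)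
      select true  = sym (ℚ.*-identityʳ a)
      select false = sym (ℚ.*-zeroʳ a)

    -- Matches the closed alternating sum of faces with the recursive `δ`. The coefficient a is
    -- arbitrary because passing to the tail turns it into - a.
    alternating : ∀ (vs : Vec Vertex (suc k)) a φ →
      ⟪ tabulate (λ i → sign (toℕ i) * a , underlying (removeAt vs i)) , φ ⟫ ≡ a * δ φ (underlying vs)
    alternating {zero} (v ∷ []) a φ = only a (φ [])
      where
      only : ∀ a p → 1ℚ * a * p + 0ℚ ≡ a * (p - 0ℚ)
      only = solve 2 (λ a p → con 1ℚ :* a :* p :+ con 0ℚ := a :* (p :- con 0ℚ)) refl
        where open +-*-Solver
    alternating {suc k} (v ∷ vs@(_ ∷ _)) a φ = begin
      1ℚ * a * φ (underlying vs) + ⟪ tabulate (λ i → - sign (toℕ i) * a , proj₁ v ∷ underlying (removeAt vs i)) , φ ⟫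
        ≡⟨ cong (1ℚ * a * φ (underlying vs) +_)
             (⟪tabulate⟫-cong (λ i → - sign (toℕ i) * a) (λ i → sign (toℕ i) * (- a))
               (λ i → proj₁ v ∷ underlying (removeAt vs i)) (λ i → underlying (removeAt vs i)) φ (φ ∘ (proj₁ v ∷_))
               (λ i → move (sign (toℕ i)) a (φ (proj₁ v ∷ underlying (removeAt vs i))))) ⟩
      1ℚ * a * φ (underlying vs) + ⟪ tabulate (λ i → sign (toℕ i) * (- a) , underlying (removeAt vs i)) , φ ∘ (proj₁ v ∷_) ⟫
        ≡⟨ cong (1ℚ * a * φ (underlying vs) +_) (alternating vs (- a) (φ ∘ (proj₁ v ∷_))) ⟩
      1ℚ * a * φ (underlying vs) + - a * δ (φ ∘ (proj₁ v ∷_)) (underlying vs)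
        ≡⟨ collect a (φ (underlying vs)) (δ (φ ∘ (proj₁ v ∷_)) (underlying vs)) ⟩
      a * (φ (underlying vs) - δ (φ ∘ (proj₁ v ∷_)) (underlying vs)) ∎
      where
      open ≡-Reasoning
      move : ∀ s a p → - s * a * p ≡ s * (- a) * p
      move = solve 3 (λ s a p → (:- s) :* a :* p := s :* (:- a) :* p) refl
        where open +-*-Solver
      collect : ∀ a p q → 1ℚ * a * p + - a * q ≡ a * (p - q)
      collect = solve 3 (λ a p q → con 1ℚ :* a :* p :+ (:- a) :* q := a :* (p :- q)) refl
        where open +-*-Solver

    forget-∂ : ∀ (c : Chain (suc k)) φ → ⟪ forget (∂ᶜ c) , φ ⟫ ≡ ⟪ forget c , δ φ ⟫
    forget-∂ []                φ = refl
    forget-∂ {k} ((a , σ) ∷ c) φ = begin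
      ⟪ forget (faces ++ ∂ᶜ c) , φ ⟫
        ≡⟨ cong ⟪_, φ ⟫ (List.map-++ (map₂ (underlying ∘ vertices)) faces (∂ᶜ c)) ⟩
      ⟪ forget faces ++ forget (∂ᶜ c) , φ ⟫
        ≡⟨ ⟪⟫-++ (forget faces) (forget (∂ᶜ c)) φ ⟩
      ⟪ forget faces , φ ⟫ + ⟪ forget (∂ᶜ c) , φ ⟫
        ≡⟨ cong₂ _+_
             (trans (cong ⟪_, φ ⟫ (trans (cong forget (map-tabulate id signed)) (map-tabulate signed (map₂ (underlying ∘ vertices)))))
               (alternating (vertices σ) a φ))
             (forget-∂ c φ) ⟩
      a * δ φ (underlying (vertices σ)) + ⟪ forget c , δ φ ⟫ ∎
      where
      open ≡-Reasoning
      signed : Fin (suc k) → ℚ × Simplex k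
      signed i = sign (toℕ i) * a , face σ i
      faces : Chain k
      faces = map signed (allFin (suc k))

    forget-∈ : ∀ (c : Chain k) → Chain∈ IsVertex k (forget c)
    forget-∈ c = AllSupp-map (All.universal (λ (_ , σ) → increasing-∈ (increasing σ)) c)
      where
      All-≤ : ∀ {k v} {vs : Vec Vertex k} → VecAll.All (λ w → proj₁ v T.≤ proj₁ w × proj₁ v ≢ proj₁ w) vs → All (proj₁ v T.≤_) (underlying vs)
      All-≤ []            = []
      All-≤ {v = v} ((v≤ , _) ∷ vs≤) = v≤ ∷ All-≤ {v = v} vs≤
      increasing-∈ : ∀ {k} {vs : Vec Vertex k} → AllPairs (λ v w → proj₁ v T.≤ proj₁ w × proj₁ v ≢ proj₁ w) vs → Increasing IsVertex k (underlying vs)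
      increasing-∈ []                             = []
      increasing-∈ (_∷_ {x = v} v< vs<) = (proj₂ v , All-≤ {v = v} v<) ∷ increasing-∈ vs<

    cycle-forget : ∀ (z : Chain k) → IsCycle z → ∂ (forget z) ≋ []
    -- In degree -1 every chain is a cycle by decree; here this holds because the empty list has
    -- boundary 0.
    cycle-forget {zero}  z _  φ = trans (⟪∂⟫ (forget z) φ)
      (trans (⟪⟫-cong-on (All.map (λ { [] → refl }) (forget-∈ z))) (⟪⟫-zero (forget z)))
    cycle-forget {suc k} z ∂z φ = begin
      ⟪ ∂ (forget z) , φ ⟫    ≡⟨ ⟪∂⟫ (forget z) φ ⟩
      ⟪ forget z , δ φ ⟫      ≡⟨ forget-∂ z φ ⟨
      ⟪ forget (∂ᶜ z) , φ ⟫   ≡⟨ coefficients-determine (forget (∂ᶜ z)) (λ x∈ → zeros (∈-map⁻ proj₂ x∈)) φ ⟩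
      0ℚ ∎
      where
      open ≡-Reasoning
      zeros : ∀ {x} → (∃ λ e → e ∈ forget (∂ᶜ z) × x ≡ proj₂ e) → ⟪ forget (∂ᶜ z) , χ x ⟫ ≡ 0ℚ
      zeros (e , e∈ , refl) with (a , σ) , _ , refl ← ∈-map⁻ (map₂ (underlying ∘ vertices)) e∈ =
        trans (sym (coefficient-forget (∂ᶜ z) σ)) (∂z σ)

    strict-or-degenerate : ∀ {τ} → Increasing IsVertex k τ →
      (∃ λ (σ : Simplex k) → underlying (vertices σ) ≡ τ) ⊎ Degenerate τ
    strict-or-degenerate [] = inj₁ (simplex [] [] , refl)
    strict-or-degenerate (_∷_ {x = x} (v , x≤) vs) with strict-or-degenerate vs
    ... | inj₂ d = inj₂ (there d)
    ... | inj₁ (simplex ws ws< , refl) with compare ws x≤ ws<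
      where
      compare : ∀ {k} (ws : Vec Vertex k) → All (x T.≤_) (underlying ws) →
        AllPairs (λ v w → proj₁ v T.≤ proj₁ w × proj₁ v ≢ proj₁ w) ws →
        VecAll.All (λ w → x T.≤ proj₁ w × x ≢ proj₁ w) ws ⊎ Degenerate (x ∷ underlying ws)
      compare []       []         _ = inj₁ []
      compare (w ∷ ws) (x≤w ∷ _) (w< ∷ _) with x T.≟ proj₁ w
      ... | yes refl = inj₂ here
      ... | no x≢w   = inj₁ ((x≤w , x≢w) ∷ VecAll.map
        -- It is enough to compare x with its first successor w: if x equalled a later w′, then w
        -- would lie between equal tuples and x = w by antisymmetry.
        (λ {w′} (w≤ , _) → T.trans {x} {proj₁ w} {proj₁ w′} x≤w w≤ , λ { refl → x≢w (T.antisym x≤w w≤) }) w<)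
    ... | inj₁ x<  = inj₁ (simplex ((x , v) ∷ ws) (x< ∷ ws<) , refl)
    ... | inj₂ d   = inj₂ d

    strictly-increasing⇒¬degenerate : ∀ {vs : Vec Vertex k} →
      AllPairs (λ v w → proj₁ v T.≤ proj₁ w × proj₁ v ≢ proj₁ w) vs → ¬ Degenerate (underlying vs)
    strictly-increasing⇒¬degenerate vs< d = go _ vs< d refl
      where
      go : ∀ {k} (vs : Vec Vertex k) → AllPairs (λ v w → proj₁ v T.≤ proj₁ w × proj₁ v ≢ proj₁ w) vs →
        ∀ {τ} → Degenerate τ → τ ≢ underlying vs
      go (v ∷ w ∷ vs) (((_ , v≢w) ∷ _) ∷ _) here eq =
        v≢w (trans (sym (List.∷-injectiveˡ eq)) (List.∷-injectiveˡ (List.∷-injectiveʳ eq)))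
      go (v ∷ vs) (_ ∷ vs<) (there d) eq = go vs vs< d (List.∷-injectiveʳ eq)

    -- Degenerate chains have no counterpart among the simplices; functionals that vanish on them do
    -- not notice their removal.
    drop-degenerate : ∀ b → Chain∈ IsVertex k b →
      ∃ λ (c : Chain k) → ∀ ψ → (∀ {τ} → Degenerate τ → ψ τ ≡ 0ℚ) → ⟪ forget c , ψ ⟫ ≡ ⟪ b , ψ ⟫
    drop-degenerate []            []       = [] , λ _ _ → refl
    drop-degenerate ((a , τ) ∷ b) (v ∷ vs) with drop-degenerate b vs | strict-or-degenerate v
    ... | c , eq | inj₁ (σ , refl) = (a , σ) ∷ c , λ ψ vanish → cong (a * ψ τ +_) (eq ψ vanish)
    ... | c , eq | inj₂ d          = c , λ ψ vanish → trans (eq ψ vanish)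
          (sym (trans (cong (λ p → a * p + ⟪ b , ψ ⟫) (vanish d))
            (trans (cong (_+ ⟪ b , ψ ⟫) (ℚ.*-zeroʳ a)) (ℚ.+-identityˡ ⟪ b , ψ ⟫))))

    -- Fill the cycle by weak chains and drop the degenerate ones. The coefficient of a strict
    -- simplex vanishes on degenerate chains, hence so does its coboundary, and the boundary keeps
    -- the right coefficients.
    acyclic⇒boundary : Acyclic k IsVertex → ∀ (z : Chain k) → IsCycle z → IsBoundary z
    acyclic⇒boundary h z ∂z
      with b , b∈ , ∂b ← h (forget z) (forget-∈ z) (cycle-forget z ∂z)
      with c , eq ← drop-degenerate b b∈
      = c , λ σ →
        let S = underlying (vertices σ)
            vanish : ∀ {τ} → Degenerate τ → χ S τ ≡ 0ℚ
            vanish = λ {τ} d → χ-≢ {S} {τ} λ { refl → strictly-increasing⇒¬degenerate (increasing σ) d }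
        in begin
          coefficient (∂ᶜ c) σ        ≡⟨ coefficient-forget (∂ᶜ c) σ ⟩
          ⟪ forget (∂ᶜ c) , χ S ⟫     ≡⟨ forget-∂ c (χ S) ⟩
          ⟪ forget c , δ (χ S) ⟫      ≡⟨ eq (δ (χ S)) (δ-degenerate (χ S) vanish) ⟩
          ⟪ b , δ (χ S) ⟫             ≡⟨ ⟪∂⟫ b (χ S) ⟨
          ⟪ ∂ b , χ S ⟫               ≡⟨ ∂b (χ S) ⟩
          ⟪ forget z , χ S ⟫          ≡⟨ coefficient-forget z σ ⟨
          coefficient z σ ∎
      where open ≡-Reasoning

-- The Cauchy reals as an ordered field.

module RealField where

  open import Algebra.Bundles using (CommutativeRing)
  open import Algebra.Structures using (IsCommutativeRing)
  open import Axiom.ExcludedMiddle using (ExcludedMiddle)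
  open import Data.Nat.Base as ℕ using (ℕ; _⊔_)
  open import Data.Nat.Properties as ℕ using (m≤m⊔n; m≤n⊔m)
  open import Data.Product.Base using (∃; _×_; _,_; proj₁; proj₂)
  open import Data.Rational.Base as ℚ using (ℚ; 0ℚ; 1ℚ; ½; _+_; _*_; _-_; -_; _<_; _≤_; ∣_∣; 1/_; Positive; positive; nonNegative)
  open import Data.Rational.Properties as ℚ using (module ≤-Reasoning)
  open import Data.Rational.Solver using (module +-*-Solver)
  open import Data.Sum.Base using (_⊎_; inj₁; inj₂)
  open import Defs using (IsCauchy; ℝ; mkℝ; seq; cauchy; _≈ʳ_; _≤ʳ_; _+ʳ_; _*ʳ_; 0ʳ; 1ʳ; *-pos; scale; ∣*∣-bound; eventually-bounded)
  open import Function.Base using (_∘_)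
  open import Level using (0ℓ)
  open import Relation.Binary.Core using (Rel)
  open import Relation.Binary.PropositionalEquality using (_≡_; refl; sym; trans; cong; cong₂; subst; module ≡-Reasoning)
  open import Relation.Nullary using (¬_; Dec; yes; no; contradiction)

  -- The geometry takes place over an arbitrary field of this kind. The strict inequality x > y is
  -- written ¬ x ≼ y throughout.
  record OrderedField : Set₁ where
    field
      commutativeRing : CommutativeRing 0ℓ 0ℓ
    open CommutativeRing commutativeRing public renaming (_+_ to _⊕_; _*_ to _⊗_)
    infix 4 _≼_
    field
      _≼_          : Rel Carrier 0ℓ
      ≼-reflexive  : ∀ {x y} → x ≈ y → x ≼ y
      ≼-trans      : ∀ {x y z} → x ≼ y → y ≼ z → x ≼ z
      ≼-antisym    : ∀ {x y} → x ≼ y → y ≼ x → x ≈ y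
      ≼-total      : ∀ x y → x ≼ y ⊎ y ≼ x
      ⊕-monoˡ      : ∀ z {x y} → x ≼ y → x ⊕ z ≼ y ⊕ z
      ⊗-nonneg     : ∀ {x y} → 0# ≼ x → 0# ≼ y → 0# ≼ x ⊗ y
      inverse      : ∀ {x} → ¬ x ≈ 0# → ∃ λ y → x ⊗ y ≈ 1#
      0≼1          : 0# ≼ 1#
      1≉0          : ¬ 1# ≈ 0#

  Eventually : (ℕ → Set) → Set
  Eventually Q = ∃ λ N → ∀ n → N ℕ.≤ n → Q n

  eventually-zip : ∀ {P Q R : ℕ → Set} → (∀ n → P n → Q n → R n) → Eventually P → Eventually Q → Eventually R
  eventually-zip f (M , p) (N , q) =
    M ⊔ N , λ n le → f n (p n (ℕ.≤-trans (m≤m⊔n M N) le)) (q n (ℕ.≤-trans (m≤n⊔m M N) le))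

  eventually-map : ∀ {P Q : ℕ → Set} → (∀ n → P n → Q n) → Eventually P → Eventually Q
  eventually-map f (N , p) = N , λ n le → f n (p n le)

  Null : (ℕ → ℚ) → Set
  Null u = ∀ ε → 0ℚ < ε → Eventually λ n → ∣ u n ∣ < ε

  half : ∀ {ε} → 0ℚ < ε → 0ℚ < ½ * ε
  half {ε} = *-pos ½ ε

  ½+½ : ∀ ε → ½ * ε + ½ * ε ≡ ε
  ½+½ = solve 1 (λ ε → con ½ :* ε :+ con ½ :* ε := ε) refl
    where open +-*-Solver

  null-cong : ∀ {u v} → (∀ n → u n ≡ v n) → Null u → Null v
  null-cong eq h ε 0<ε = eventually-map (λ n → subst (λ p → ∣ p ∣ < ε) (eq n)) (h ε 0<ε)

  null-zero : Null (λ _ → 0ℚ)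
  null-zero ε 0<ε = 0 , λ _ _ → 0<ε

  null-neg : ∀ {u} → Null u → Null (λ n → - u n)
  null-neg {u} h ε 0<ε = eventually-map (λ n → subst (_< ε) (sym (ℚ.∣-p∣≡∣p∣ (u n)))) (h ε 0<ε)

  null-+ : ∀ {u v} → Null u → Null v → Null (λ n → u n + v n)
  null-+ {u} {v} hu hv ε 0<ε = eventually-zip
    (λ n p q → ℚ.≤-<-trans (ℚ.∣p+q∣≤∣p∣+∣q∣ (u n) (v n)) (subst (∣ u n ∣ + ∣ v n ∣ <_) (½+½ ε) (ℚ.+-mono-< p q)))
    (hu (½ * ε) (half 0<ε)) (hv (½ * ε) (half 0<ε))

  null-* : ∀ u v → IsCauchy u → Null v → Null (λ n → u n * v n)
  null-* u v cu hv ε 0<ε with B , N , B>0 , bounded ← eventually-bounded u cu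
    with η , 0<η , Bη≡ε ← scale B {{B>0}} ε 0<ε = eventually-zip
      (λ n p q → subst (∣ u n * v n ∣ <_) Bη≡ε (∣*∣-bound B {{B>0}} η (u n) (v n) p q))
      (N , bounded) (hv η 0<η)

  ∣p∣<ε⇒p<ε : ∀ {p ε} → ∣ p ∣ < ε → p < ε
  ∣p∣<ε⇒p<ε {p} h with ℚ.∣p∣≡p∨∣p∣≡-p p | ℚ.≤-total 0ℚ p
  ... | inj₁ eq | _       = subst (_< _) eq h
  ... | inj₂ eq | inj₁ 0≤p = subst (_< _) (ℚ.0≤p⇒∣p∣≡p 0≤p) h
  ... | inj₂ eq | inj₂ p≤0 = ℚ.≤-<-trans p≤0 (ℚ.≤-<-trans (ℚ.0≤∣p∣ p) h)

  p<ε⇒∣p∣<ε : ∀ {p ε} → p < ε → - p < ε → ∣ p ∣ < ε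
  p<ε⇒∣p∣<ε {p} h₁ h₂ with ℚ.∣p∣≡p∨∣p∣≡-p p
  ... | inj₁ eq = subst (_< _) (sym eq) h₁
  ... | inj₂ eq = subst (_< _) (sym eq) h₂

  shift : ∀ p q c {s t} → p + c ≡ s → q + c ≡ t → p ≤ q → s ≤ t
  shift p q c refl refl p≤q = ℚ.+-monoˡ-≤ c p≤q

  -ʳ_ : ℝ → ℝ
  -ʳ x = mkℝ (λ n → - seq x n) λ ε 0<ε → let N , h = cauchy x ε 0<ε in
    N , λ m n p q → subst (_< ε) (trans (sym (ℚ.∣-p∣≡∣p∣ (seq x m - seq x n))) (cong ∣_∣ (neg- (seq x m) (seq x n)))) (h m n p q)
    where
    neg- : ∀ a b → - (a - b) ≡ - a - - b
    neg- = solve 2 (λ a b → :- (a :- b) := :- a :- :- b) refl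
      where open +-*-Solver

  ≈ʳ-pointwise : ∀ x y → (∀ n → seq x n ≡ seq y n) → x ≈ʳ y
  ≈ʳ-pointwise x y eq = null-cong (λ n → sym (trans (cong (_- seq y n) (eq n)) (ℚ.+-inverseʳ (seq y n)))) null-zero

  ℝ-isCommutativeRing : IsCommutativeRing _≈ʳ_ _+ʳ_ _*ʳ_ -ʳ_ 0ʳ 1ʳ
  ℝ-isCommutativeRing = record
    { isRing = record
      { +-isAbelianGroup = record
        { isGroup = record
          { isMonoid = record
            { isSemigroup = record
              { isMagma = record
                { isEquivalence = record
                  { refl  = λ {x} → ≈ʳ-pointwise x x (λ _ → refl)
                  ; sym   = λ {x} {y} h → null-cong (λ n → flip (seq x n) (seq y n)) (null-neg h)
                  ; trans = λ {x} {y} {z} h k → null-cong (λ n → chain (seq x n) (seq y n) (seq z n)) (null-+ h k)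
                  }
                ; ∙-cong = λ {x} {x′} {y} {y′} h k →
                    null-cong (λ n → sums (seq x n) (seq x′ n) (seq y n) (seq y′ n)) (null-+ h k)
                }
              ; assoc = λ x y z → ≈ʳ-pointwise ((x +ʳ y) +ʳ z) (x +ʳ (y +ʳ z)) λ n → ℚ.+-assoc (seq x n) (seq y n) (seq z n)
              }
            ; identity = (λ x → ≈ʳ-pointwise (0ʳ +ʳ x) x λ n → ℚ.+-identityˡ (seq x n))
                       , (λ x → ≈ʳ-pointwise (x +ʳ 0ʳ) x λ n → ℚ.+-identityʳ (seq x n))
            }
          ; inverse = (λ x → ≈ʳ-pointwise ((-ʳ x) +ʳ x) 0ʳ λ n → ℚ.+-inverseˡ (seq x n))
                    , (λ x → ≈ʳ-pointwise (x +ʳ (-ʳ x)) 0ʳ λ n → ℚ.+-inverseʳ (seq x n))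
          ; ⁻¹-cong = λ {x} {y} h → null-cong (λ n → negs (seq x n) (seq y n)) (null-neg h)
          }
        ; comm = λ x y → ≈ʳ-pointwise (x +ʳ y) (y +ʳ x) λ n → ℚ.+-comm (seq x n) (seq y n)
        }
      ; *-cong = λ {x} {x′} {y} {y′} h k →
          null-cong (λ n → products (seq x n) (seq x′ n) (seq y n) (seq y′ n))
            (null-+ {λ n → seq x n * (seq y n - seq y′ n)} {λ n → seq y′ n * (seq x n - seq x′ n)}
              (null-* (seq x) (λ n → seq y n - seq y′ n) (cauchy x) k)
              (null-* (seq y′) (λ n → seq x n - seq x′ n) (cauchy y′) h))
      ; *-assoc = λ x y z → ≈ʳ-pointwise ((x *ʳ y) *ʳ z) (x *ʳ (y *ʳ z)) λ n → ℚ.*-assoc (seq x n) (seq y n) (seq z n)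
      ; *-identity = (λ x → ≈ʳ-pointwise (1ʳ *ʳ x) x λ n → ℚ.*-identityˡ (seq x n))
                   , (λ x → ≈ʳ-pointwise (x *ʳ 1ʳ) x λ n → ℚ.*-identityʳ (seq x n))
      ; distrib = (λ x y z → ≈ʳ-pointwise (x *ʳ (y +ʳ z)) (x *ʳ y +ʳ x *ʳ z) λ n → ℚ.*-distribˡ-+ (seq x n) (seq y n) (seq z n))
                , (λ x y z → ≈ʳ-pointwise ((y +ʳ z) *ʳ x) (y *ʳ x +ʳ z *ʳ x) λ n → ℚ.*-distribʳ-+ (seq x n) (seq y n) (seq z n))
      }
    ; *-comm = λ x y → ≈ʳ-pointwise (x *ʳ y) (y *ʳ x) λ n → ℚ.*-comm (seq x n) (seq y n)
    }
    where
    open +-*-Solver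
    flip : ∀ a b → - (a - b) ≡ b - a
    flip = solve 2 (λ a b → :- (a :- b) := b :- a) refl
    chain : ∀ a b c → (a - b) + (b - c) ≡ a - c
    chain = solve 3 (λ a b c → (a :- b) :+ (b :- c) := a :- c) refl
    sums : ∀ a a′ b b′ → (a - a′) + (b - b′) ≡ (a + b) - (a′ + b′)
    sums = solve 4 (λ a a′ b b′ → (a :- a′) :+ (b :- b′) := (a :+ b) :- (a′ :+ b′)) refl
    negs : ∀ a b → - (a - b) ≡ - a - - b
    negs = solve 2 (λ a b → :- (a :- b) := :- a :- :- b) refl
    products : ∀ a a′ b b′ → a * (b - b′) + b′ * (a - a′) ≡ a * b - a′ * b′
    products = solve 4 (λ a a′ b b′ → a :* (b :- b′) :+ b′ :* (a :- a′) := a :* b :- a′ :* b′) refl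

  ℝ-commutativeRing : CommutativeRing 0ℓ 0ℓ
  ℝ-commutativeRing = record { isCommutativeRing = ℝ-isCommutativeRing }

  module ℝ-Order (em : ExcludedMiddle 0ℓ) where

    private
      module R = CommutativeRing ℝ-commutativeRing

    SeparatedAbove SeparatedBelow : (ℕ → ℚ) → Set
    SeparatedAbove u = ∃ λ η → 0ℚ < η × Eventually λ n → η ≤ u n
    SeparatedBelow u = ∃ λ η → 0ℚ < η × Eventually λ n → u n ≤ - η

    -- A sequence that is not null has ∣ u n ∣ ≥ ε for arbitrarily late n. Once all terms are within
    -- ½ ε of each other, one such term keeps all later ones on its side of 0, at distance at least
    -- ½ ε. Totality of the order and inverses both rest on this.
    separated : ∀ u → IsCauchy u → ¬ Null u → SeparatedAbove u ⊎ SeparatedBelow u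
    separated u cu ¬null with em {∃ λ ε → 0ℚ < ε × ∀ N → ∃ λ n → N ℕ.≤ n × ε ≤ ∣ u n ∣}
    ... | no none = contradiction (λ ε 0<ε → find ε 0<ε) ¬null
      where
      find : ∀ ε → 0ℚ < ε → Eventually λ n → ∣ u n ∣ < ε
      find ε 0<ε with em {Eventually λ n → ∣ u n ∣ < ε}
      ... | yes h = h
      ... | no ¬h = contradiction (ε , 0<ε , λ N → large N) none
        where
        large : ∀ N → ∃ λ n → N ℕ.≤ n × ε ≤ ∣ u n ∣
        large N with em {∃ λ n → N ℕ.≤ n × ε ≤ ∣ u n ∣}
        ... | yes h = h
        ... | no ¬l = contradiction (N , λ n le → ℚ.≰⇒> λ ε≤ → ¬l (n , le , ε≤)) ¬h
    ... | yes (ε , 0<ε , large) with N , close ← cu (½ * ε) (half 0<ε)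
      with n , N≤n , ε≤ ← large N | ℚ.≤-total 0ℚ (u n)
    ... | inj₁ 0≤un = inj₁ (½ * ε , half 0<ε , N , λ m N≤m →
          let open ≤-Reasoning in begin
            ½ * ε                   ≡⟨ halves ε ⟩
            ε - ½ * ε               ≤⟨ ℚ.+-mono-≤ ε≤ (ℚ.neg-antimono-≤ (ℚ.<⇒≤ (∣p∣<ε⇒p<ε (close n m N≤n N≤m)))) ⟩
            ∣ u n ∣ - (u n - u m)   ≡⟨ cong (_- (u n - u m)) (ℚ.0≤p⇒∣p∣≡p 0≤un) ⟩
            u n - (u n - u m)       ≡⟨ cancel (u n) (u m) ⟩
            u m ∎)
      where
      open +-*-Solver
      halves : ∀ ε → ½ * ε ≡ ε - ½ * ε
      halves = solve 1 (λ ε → con ½ :* ε := ε :- con ½ :* ε) refl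
      cancel : ∀ a b → a - (a - b) ≡ b
      cancel = solve 2 (λ a b → a :- (a :- b) := b) refl
    ... | inj₂ un≤0 = inj₂ (½ * ε , half 0<ε , N , λ m N≤m →
          let open ≤-Reasoning in begin
            u m                     ≡⟨ cancel (u n) (u m) ⟩
            (u m - u n) - - u n     ≤⟨ ℚ.+-mono-≤ (ℚ.<⇒≤ (∣p∣<ε⇒p<ε (close m n N≤m N≤n)))
                                         (ℚ.neg-antimono-≤ (subst (ε ≤_) ∣un∣≡-un ε≤)) ⟩
            ½ * ε - ε               ≡⟨ halves ε ⟩
            - (½ * ε) ∎)
      where
      open +-*-Solver
      ∣un∣≡-un : ∣ u n ∣ ≡ - u n
      ∣un∣≡-un = trans (sym (ℚ.∣-p∣≡∣p∣ (u n))) (ℚ.0≤p⇒∣p∣≡p (ℚ.neg-antimono-≤ un≤0))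
      halves : ∀ ε → ½ * ε - ε ≡ - (½ * ε)
      halves = solve 1 (λ ε → con ½ :* ε :- ε := :- (con ½ :* ε)) refl
      cancel : ∀ a b → b ≡ (b - a) - - a
      cancel = solve 2 (λ a b → b := (b :- a) :- :- a) refl

    ≤ʳ-reflexive : ∀ {x y} → x ≈ʳ y → x ≤ʳ y
    ≤ʳ-reflexive {x} {y} h ε 0<ε = eventually-map
      (λ n p → shift (seq x n - seq y n) ε (seq y n) (back (seq x n) (seq y n)) (ℚ.+-comm ε (seq y n)) (ℚ.<⇒≤ (∣p∣<ε⇒p<ε p))) (h ε 0<ε)
      where
      back : ∀ a b → (a - b) + b ≡ a
      back = solve 2 (λ a b → (a :- b) :+ b := a) refl
        where open +-*-Solver

    ≤ʳ-trans : ∀ {x y z} → x ≤ʳ y → y ≤ʳ z → x ≤ʳ z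
    ≤ʳ-trans {x} {y} {z} h k ε 0<ε = eventually-zip
      (λ n p q → ℚ.≤-trans p (ℚ.≤-trans (ℚ.+-monoˡ-≤ (½ * ε) q)
        (ℚ.≤-reflexive (trans (ℚ.+-assoc (seq z n) (½ * ε) (½ * ε)) (cong (seq z n +_) (½+½ ε))))))
      (h (½ * ε) (half 0<ε)) (k (½ * ε) (half 0<ε))

    ≤ʳ-antisym : ∀ {x y} → x ≤ʳ y → y ≤ʳ x → x ≈ʳ y
    ≤ʳ-antisym {x} {y} h k ε 0<ε = eventually-zip
      (λ n p q → p<ε⇒∣p∣<ε
        (ℚ.≤-<-trans {seq x n - seq y n} (shift (seq x n) (seq y n + ½ * ε) (- seq y n) refl (cancel (seq y n) (½ * ε)) p) ½ε<ε)
        (ℚ.≤-<-trans { - (seq x n - seq y n)} (shift (seq y n) (seq x n + ½ * ε) (- seq x n) (swap (seq x n) (seq y n)) (cancel (seq x n) (½ * ε)) q) ½ε<ε))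
      (h (½ * ε) (half 0<ε)) (k (½ * ε) (half 0<ε))
      where
      open +-*-Solver
      cancel : ∀ a e → a + e + - a ≡ e
      cancel = solve 2 (λ a e → a :+ e :+ :- a := e) refl
      swap : ∀ a b → b + - a ≡ - (a - b)
      swap = solve 2 (λ a b → b :+ :- a := :- (a :- b)) refl
      ½ε<ε : ½ * ε < ε
      ½ε<ε = subst (_< ε) (ℚ.+-identityʳ (½ * ε)) (subst (½ * ε + 0ℚ <_) (½+½ ε) (ℚ.+-monoʳ-< (½ * ε) (half 0<ε)))

    separatedAbove⇒≤ʳ : ∀ x y → SeparatedAbove (λ n → seq x n - seq y n) → y ≤ʳ x
    separatedAbove⇒≤ʳ x y (η , 0<η , h) ε 0<ε = eventually-map
      (λ n p → shift 0ℚ (seq x n - seq y n + ε) (seq y n) (ℚ.+-identityˡ (seq y n)) (back (seq x n) (seq y n) ε)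
        (ℚ.+-mono-≤ (ℚ.≤-trans (ℚ.<⇒≤ 0<η) p) (ℚ.<⇒≤ 0<ε))) h
      where
      back : ∀ a b e → ((a - b) + e) + b ≡ a + e
      back = solve 3 (λ a b e → ((a :- b) :+ e) :+ b := a :+ e) refl
        where open +-*-Solver

    ≤ʳ-total : ∀ x y → x ≤ʳ y ⊎ y ≤ʳ x
    ≤ʳ-total x y = decide em
      where
      apart : SeparatedAbove (λ n → seq x n - seq y n) ⊎ SeparatedBelow (λ n → seq x n - seq y n) → x ≤ʳ y ⊎ y ≤ʳ x
      apart (inj₁ above)         = inj₂ (separatedAbove⇒≤ʳ x y above)
      apart (inj₂ (η , 0<η , h)) = inj₁ (separatedAbove⇒≤ʳ y x (η , 0<η , eventually-map (λ n → swap η (seq x n) (seq y n)) h))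
        where
        swap : ∀ η a b → a - b ≤ - η → η ≤ b - a
        swap η a b p = shift (a - b) (- η) (η + (b - a)) (left a b η) (right a b η) p
          where
          open +-*-Solver
          left : ∀ a b e → (a - b) + (e + (b - a)) ≡ e
          left = solve 3 (λ a b e → (a :- b) :+ (e :+ (b :- a)) := e) refl
          right : ∀ a b e → - e + (e + (b - a)) ≡ b - a
          right = solve 3 (λ a b e → :- e :+ (e :+ (b :- a)) := b :- a) refl

      decide : Dec (x ≈ʳ y) → x ≤ʳ y ⊎ y ≤ʳ x
      decide (yes x≈y) = inj₁ (≤ʳ-reflexive {x} {y} x≈y)
      decide (no x≉y)  = apart (separated (λ n → seq x n - seq y n) (cauchy (x +ʳ (-ʳ y))) x≉y)

    +ʳ-monoˡ : ∀ z {x y} → x ≤ʳ y → x +ʳ z ≤ʳ y +ʳ z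
    +ʳ-monoˡ z {x} {y} h ε 0<ε = eventually-map
      (λ n p → shift (seq x n) (seq y n + ε) (seq z n) refl (rotate (seq y n) ε (seq z n)) p) (h ε 0<ε)
      where
      rotate : ∀ a e c → a + e + c ≡ a + c + e
      rotate = solve 3 (λ a e c → a :+ e :+ c := a :+ c :+ e) refl
        where open +-*-Solver

    0≤ʳ∧≉0⇒separatedAbove : ∀ x → 0ʳ ≤ʳ x → ¬ x ≈ʳ 0ʳ → SeparatedAbove (seq x)
    0≤ʳ∧≉0⇒separatedAbove x 0≤x x≉0 with separated (seq x) (cauchy x) (x≉0 ∘ null-cong (λ n → sym (ℚ.+-identityʳ (seq x n))))
    ... | inj₁ above = above
    ... | inj₂ (η , 0<η , h) with N , p ← eventually-zip (λ n → _,_) h (0≤x (½ * η) (half 0<η)) =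
      contradiction (ℚ.<-≤-trans (half 0<η)
        (shift 0ℚ (- η + ½ * η) (½ * η) (ℚ.+-identityˡ (½ * η)) (zero-sum η)
          (ℚ.≤-trans (proj₂ (p N ℕ.≤-refl)) (ℚ.+-monoˡ-≤ (½ * η) (proj₁ (p N ℕ.≤-refl))))))
        (ℚ.<-irrefl refl)
      where
      zero-sum : ∀ η → - η + ½ * η + ½ * η ≡ 0ℚ
      zero-sum = solve 1 (λ η → :- η :+ con ½ :* η :+ con ½ :* η := con 0ℚ) refl
        where open +-*-Solver

    -- A nonnegative real may have negative terms, so the signs of the products of terms are not
    -- known. Unless a factor is 0, however, both sequences are eventually positive.
    *ʳ-nonneg : ∀ {x y} → 0ʳ ≤ʳ x → 0ʳ ≤ʳ y → 0ʳ ≤ʳ x *ʳ y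
    *ʳ-nonneg {x} {y} 0≤x 0≤y with em {x ≈ʳ 0ʳ} | em {y ≈ʳ 0ʳ}
    ... | yes x≈0 | _ = ≤ʳ-reflexive {0ʳ} {x *ʳ y} (R.sym {x *ʳ y} {0ʳ} (R.trans {x *ʳ y} {0ʳ *ʳ y} {0ʳ} (R.*-congʳ {y} {x} {0ʳ} x≈0) (R.zeroˡ y)))
    ... | no _ | yes y≈0 = ≤ʳ-reflexive {0ʳ} {x *ʳ y} (R.sym {x *ʳ y} {0ʳ} (R.trans {x *ʳ y} {x *ʳ 0ʳ} {0ʳ} (R.*-congˡ {x} {y} {0ʳ} y≈0) (R.zeroʳ x)))
    ... | no x≉0 | no y≉0
      with η , 0<η , h ← 0≤ʳ∧≉0⇒separatedAbove x 0≤x x≉0 | θ , 0<θ , k ← 0≤ʳ∧≉0⇒separatedAbove y 0≤y y≉0 =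
      λ ε 0<ε → eventually-zip
        (λ n p q → ℚ.+-mono-≤ (ℚ.nonNegative⁻¹ (seq x n * seq y n)
          {{ℚ.nonNeg*nonNeg⇒nonNeg (seq x n) {{nonNegative (ℚ.≤-trans (ℚ.<⇒≤ 0<η) p)}} (seq y n) {{nonNegative (ℚ.≤-trans (ℚ.<⇒≤ 0<θ) q)}}}})
          (ℚ.<⇒≤ 0<ε)) h k

    module _ (u : ℕ → ℚ) (cu : IsCauchy u) (η : ℚ) (0<η : 0ℚ < η) (h : Eventually λ n → η ≤ u n) where

      -- Truncating u from below by η makes every term invertible and changes
      -- only finitely many of them.
      private
        v : ℕ → ℚ
        v n = u n ℚ.⊔ η

        v>0 : ∀ n → Positive (v n)
        v>0 n = positive (ℚ.<-≤-trans 0<η (ℚ.p≤q⊔p (u n) η))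

        recip : ∀ p → Positive p → ℚ
        recip p p>0 = (1/ p) {{ℚ.pos⇒nonZero p {{p>0}}}}

        inv : ∀ p (p>0 : Positive p) → p * recip p p>0 ≡ 1ℚ
        inv p p>0 = ℚ.*-inverseʳ p {{ℚ.pos⇒nonZero p {{p>0}}}}

        recip>0 : ∀ p (p>0 : Positive p) → Positive (recip p p>0)
        recip>0 p p>0 = ℚ.1/pos⇒pos p {{p>0}}

        w : ℕ → ℚ
        w n = recip (v n) (v>0 n)

        K : ℚ
        K = recip η (positive 0<η)

        w≤K : ∀ n → ∣ w n ∣ ≤ K
        w≤K n = begin
          ∣ w n ∣           ≡⟨ ℚ.0≤p⇒∣p∣≡p 0≤wn ⟩
          w n               ≡⟨ ℚ.*-identityʳ (w n) ⟨
          w n * 1ℚ          ≡⟨ cong (w n *_) (inv η (positive 0<η)) ⟨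
          w n * (η * K)     ≤⟨ ℚ.*-monoˡ-≤-nonNeg (w n) {{nonNegative 0≤wn}}
                                 (ℚ.*-monoʳ-≤-nonNeg K {{ℚ.pos⇒nonNeg K {{recip>0 η (positive 0<η)}}}} (ℚ.p≤q⊔p (u n) η)) ⟩
          w n * (v n * K)   ≡⟨ regroup (w n) (v n) K ⟩
          (v n * w n) * K   ≡⟨ cong (_* K) (inv (v n) (v>0 n)) ⟩
          1ℚ * K            ≡⟨ ℚ.*-identityˡ K ⟩
          K ∎
          where
          open ≤-Reasoning
          0≤wn : 0ℚ ≤ w n
          0≤wn = ℚ.<⇒≤ (ℚ.positive⁻¹ (w n) {{recip>0 (v n) (v>0 n)}})
          regroup : ∀ a b c → a * (b * c) ≡ (b * a) * c
          regroup = solve 3 (λ a b c → a :* (b :* c) := (b :* a) :* c) refl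
            where open +-*-Solver

        difference : ∀ m n → w m - w n ≡ w m * (w n * (v n - v m))
        difference m n = begin
          w m - w n                                         ≡⟨ cong₂ _-_ (ℚ.*-identityʳ (w m)) (ℚ.*-identityʳ (w n)) ⟨
          w m * 1ℚ - w n * 1ℚ                               ≡⟨ cong₂ (λ s t → w m * s - w n * t) (inv (v n) (v>0 n)) (inv (v m) (v>0 m)) ⟨
          w m * (v n * w n) - w n * (v m * w m)             ≡⟨ regroup (w m) (v n) (w n) (v m) ⟩
          w m * (w n * (v n - v m)) ∎
          where
          open ≡-Reasoning
          regroup : ∀ a b c d → a * (b * c) - c * (d * a) ≡ a * (c * (b - d))
          regroup = solve 4 (λ a b c d → a :* (b :* c) :- c :* (d :* a) := a :* (c :* (b :- d))) refl
            where open +-*-Solver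

      reciprocal : ∃ λ (y : ℝ) → Eventually λ n → u n * seq y n ≡ 1ℚ
      reciprocal = mkℝ w w-cauchy , eventually-map (λ n p → trans (cong (_* w n) (sym (v≡u p))) (inv (v n) (v>0 n))) h
        where
        K>0 : Positive K
        K>0 = recip>0 η (positive 0<η)
        v≡u : ∀ {n} → η ≤ u n → v n ≡ u n
        v≡u = ℚ.p≥q⇒p⊔q≡p
        w-cauchy : IsCauchy w
        w-cauchy ε 0<ε
          -- By `difference` and the bound K on reciprocals, ∣ w m - w n ∣ is at most K² ∣ v n - v m
          -- ∣, so ε is divided by K twice.
          with ε₁ , 0<ε₁ , eq₁ ← scale K {{K>0}} ε 0<ε
          with ε₂ , 0<ε₂ , eq₂ ← scale K {{K>0}} ε₁ 0<ε₁
          with M , close ← cu ε₂ 0<ε₂ =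
          M ⊔ proj₁ h , λ m n p q →
            subst (λ t → ∣ t ∣ < ε) (sym (difference m n))
              (subst (∣ w m * (w n * (v n - v m)) ∣ <_) eq₁
                (∣*∣-bound K {{K>0}} ε₁ (w m) (w n * (v n - v m)) (w≤K m)
                  (subst (∣ w n * (v n - v m) ∣ <_) eq₂
                    (∣*∣-bound K {{K>0}} ε₂ (w n) (v n - v m) (w≤K n)
                      (subst (λ t → ∣ t ∣ < ε₂) (sym (cong₂ _-_ (v≡u (big M n q)) (v≡u (big M m p))))
                        (close n m (ℕ.≤-trans (m≤m⊔n M (proj₁ h)) q) (ℕ.≤-trans (m≤m⊔n M (proj₁ h)) p)))))))
          where
          big : ∀ M n → M ⊔ proj₁ h ℕ.≤ n → η ≤ u n
          big M n q = proj₂ h n (ℕ.≤-trans (m≤n⊔m M (proj₁ h)) q)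

    eventually⇒≈ʳ : ∀ x y → (Eventually λ n → seq x n ≡ seq y n) → x ≈ʳ y
    eventually⇒≈ʳ x y h ε 0<ε = eventually-map
      (λ n eq → subst (_< ε) (sym (cong ∣_∣ (trans (cong (_- seq y n) eq) (ℚ.+-inverseʳ (seq y n))))) 0<ε) h

    *ʳ-inverse : ∀ {x} → ¬ x ≈ʳ 0ʳ → ∃ λ y → x *ʳ y ≈ʳ 1ʳ
    *ʳ-inverse {x} x≉0 = invert (separated (seq x) (cauchy x) (x≉0 ∘ null-cong (λ n → sym (ℚ.+-identityʳ (seq x n)))))
      where
      move : ∀ a b → a * - b ≡ - a * b
      move = solve 2 (λ a b → a :* :- b := (:- a) :* b) refl
        where open +-*-Solver
      flip : ∀ η p → p ≤ - η → η ≤ - p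
      flip η p h = shift p (- η) (η - p) (left p η) (right p η) h
        where
        open +-*-Solver
        left : ∀ p e → p + (e - p) ≡ e
        left = solve 2 (λ p e → p :+ (e :- p) := e) refl
        right : ∀ p e → - e + (e - p) ≡ - p
        right = solve 2 (λ p e → :- e :+ (e :- p) := :- p) refl
      conclude⁺ : (∃ λ (y : ℝ) → Eventually λ n → seq x n * seq y n ≡ 1ℚ) → ∃ λ y → x *ʳ y ≈ʳ 1ʳ
      conclude⁺ (y , eq) = y , eventually⇒≈ʳ (x *ʳ y) 1ʳ eq
      conclude⁻ : (∃ λ (y : ℝ) → Eventually λ n → - seq x n * seq y n ≡ 1ℚ) → ∃ λ y → x *ʳ y ≈ʳ 1ʳ
      conclude⁻ (y , eq) = -ʳ y , eventually⇒≈ʳ (x *ʳ (-ʳ y)) 1ʳ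
        (eventually-map (λ n p → trans (move (seq x n) (seq y n)) p) eq)
      invert : SeparatedAbove (seq x) ⊎ SeparatedBelow (seq x) → ∃ λ y → x *ʳ y ≈ʳ 1ʳ
      invert (inj₁ (η , 0<η , h)) = conclude⁺ (reciprocal (seq x) (cauchy x) η 0<η h)
      invert (inj₂ (η , 0<η , h)) = conclude⁻ (reciprocal (seq (-ʳ x)) (cauchy (-ʳ x)) η 0<η
        (eventually-map (λ n → flip η (seq x n)) h))

    ℝ-orderedField : OrderedField
    ℝ-orderedField = record
      { commutativeRing = ℝ-commutativeRing
      ; _≼_ = _≤ʳ_
      ; ≼-reflexive = λ {x} {y} → ≤ʳ-reflexive {x} {y}
      ; ≼-trans = λ {x} {y} {z} → ≤ʳ-trans {x} {y} {z}
      ; ≼-antisym = λ {x} {y} → ≤ʳ-antisym {x} {y}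
      ; ≼-total = ≤ʳ-total
      ; ⊕-monoˡ = λ z {x} {y} → +ʳ-monoˡ z {x} {y}
      ; ⊗-nonneg = λ {x} {y} → *ʳ-nonneg {x} {y}
      ; inverse = λ {x} → *ʳ-inverse {x}
      ; 0≼1 = λ ε 0<ε → 0 , λ _ _ → ℚ.+-mono-≤ (ℚ.<⇒≤ (ℚ.positive⁻¹ 1ℚ)) (ℚ.<⇒≤ 0<ε)
      ; 1≉0 = λ h → let N , p = h 1ℚ (ℚ.positive⁻¹ 1ℚ) in ℚ.<-irrefl refl (p N ℕ.≤-refl)
      }

-- A ring solver with integer coefficients.

module IntegerSolver where

  open import Algebra.Bundles using (CommutativeRing)
  import Algebra.Solver.Ring as RingSolver
  open import Algebra.Solver.Ring.AlmostCommutativeRing using (fromCommutativeRing; _-Raw-AlmostCommutative⟶_)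
  open import Data.Integer.Base as ℤ using (ℤ; +_; -[1+_]; _⊖_; _◃_; +-*-rawRing)
  open import Data.Integer.Properties as ℤ using ([1+m]⊖[1+n]≡m⊖n)
  open import Data.Maybe.Base as Maybe using (Maybe)
  open import Data.Nat.Base as ℕ using (ℕ; zero; suc)
  open import Data.Nat.Properties as ℕ using ()
  open import Data.Sign.Base as Sign using ()
  open import Level using (0ℓ)
  open import Relation.Binary.Consequences using (dec⇒weaklyDec)
  open import Relation.Binary.PropositionalEquality as ≡ using (_≡_)

  module IntegerCoefficients (R : CommutativeRing 0ℓ 0ℓ) where

    open CommutativeRing R hiding (zero)
    open import Algebra.Properties.Semiring.Mult semiring using (_×_; ×-homo-+; ×1-homo-*; ×-homo-1)
    open import Algebra.Properties.Ring (CommutativeRing.ring R) using (-‿involutive; -0#≈0#; -‿+-comm; -‿distribˡ-*; -‿distribʳ-*)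
    open import Relation.Binary.Reasoning.Setoid setoid

    fromℕ : ℕ → Carrier
    fromℕ n = n × 1#

    fromℤ : ℤ → Carrier
    fromℤ (+ n)    = fromℕ n
    fromℤ -[1+ n ] = - fromℕ (suc n)

    fromℤ-⊖ : ∀ m n → fromℤ (m ⊖ n) ≈ fromℕ m - fromℕ n
    fromℤ-⊖ m       zero    = sym (trans (+-congˡ -0#≈0#) (+-identityʳ _))
    fromℤ-⊖ zero    (suc n) = sym (+-identityˡ _)
    fromℤ-⊖ (suc m) (suc n) = begin
      fromℤ (suc m ⊖ suc n)                          ≈⟨ reflexive (≡.cong fromℤ ([1+m]⊖[1+n]≡m⊖n m n)) ⟩
      fromℤ (m ⊖ n)                                  ≈⟨ fromℤ-⊖ m n ⟩
      fromℕ m - fromℕ n                              ≈⟨ +-identityˡ _ ⟨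
      0# + (fromℕ m - fromℕ n)                       ≈⟨ +-congʳ (-‿inverseʳ 1#) ⟨
      (1# - 1#) + (fromℕ m - fromℕ n)                ≈⟨ +-assoc _ _ _ ⟩
      1# + (- 1# + (fromℕ m - fromℕ n))              ≈⟨ +-congˡ (+-assoc _ _ _) ⟨
      1# + ((- 1# + fromℕ m) - fromℕ n)              ≈⟨ +-congˡ (+-congʳ (+-comm _ _)) ⟩
      1# + ((fromℕ m - 1#) - fromℕ n)                ≈⟨ +-congˡ (+-assoc _ _ _) ⟩
      1# + (fromℕ m + (- 1# - fromℕ n))              ≈⟨ +-assoc _ _ _ ⟨
      (1# + fromℕ m) + (- 1# - fromℕ n)              ≈⟨ +-congˡ (-‿+-comm 1# (fromℕ n)) ⟩
      (1# + fromℕ m) - (1# + fromℕ n) ∎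

    fromℤ-neg : ∀ i → fromℤ (ℤ.- i) ≈ - fromℤ i
    fromℤ-neg (+ zero)  = sym -0#≈0#
    fromℤ-neg (+ suc n) = refl
    fromℤ-neg -[1+ n ]  = sym (-‿involutive _)

    fromℤ-+ : ∀ i j → fromℤ (i ℤ.+ j) ≈ fromℤ i + fromℤ j
    fromℤ-+ (+ m)    (+ n)    = ×-homo-+ 1# m n
    fromℤ-+ (+ m)    -[1+ n ] = fromℤ-⊖ m (suc n)
    fromℤ-+ -[1+ m ] (+ n)    = trans (fromℤ-⊖ n (suc m)) (+-comm _ _)
    fromℤ-+ -[1+ m ] -[1+ n ] = begin
      - fromℕ (suc (suc (m ℕ.+ n)))           ≈⟨ -‿cong (reflexive (≡.cong (λ k → fromℕ (suc k)) (≡.sym (ℕ.+-suc m n)))) ⟩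
      - fromℕ (suc m ℕ.+ suc n)               ≈⟨ -‿cong (×-homo-+ 1# (suc m) (suc n)) ⟩
      - (fromℕ (suc m) + fromℕ (suc n))       ≈⟨ -‿+-comm _ _ ⟨
      - fromℕ (suc m) - fromℕ (suc n) ∎

    fromℤ-+◃ : ∀ n → fromℤ (Sign.+ ◃ n) ≈ fromℕ n
    fromℤ-+◃ zero    = refl
    fromℤ-+◃ (suc n) = refl

    fromℤ--◃ : ∀ n → fromℤ (Sign.- ◃ n) ≈ - fromℕ n
    fromℤ--◃ zero    = sym -0#≈0#
    fromℤ--◃ (suc n) = refl

    fromℤ-* : ∀ i j → fromℤ (i ℤ.* j) ≈ fromℤ i * fromℤ j
    fromℤ-* (+ m)    (+ n)    = trans (fromℤ-+◃ (m ℕ.* n)) (×1-homo-* m n)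
    fromℤ-* (+ m)    -[1+ n ] = trans (fromℤ--◃ (m ℕ.* suc n)) (trans (-‿cong (×1-homo-* m (suc n))) (-‿distribʳ-* _ _))
    fromℤ-* -[1+ m ] (+ n)    = trans (fromℤ--◃ (suc m ℕ.* n)) (trans (-‿cong (×1-homo-* (suc m) n)) (-‿distribˡ-* _ _))
    fromℤ-* -[1+ m ] -[1+ n ] = begin
      fromℕ (suc m ℕ.* suc n)                  ≈⟨ ×1-homo-* (suc m) (suc n) ⟩
      fromℕ (suc m) * fromℕ (suc n)            ≈⟨ -‿involutive _ ⟨
      - - (fromℕ (suc m) * fromℕ (suc n))      ≈⟨ -‿cong (-‿distribʳ-* _ _) ⟩
      - (fromℕ (suc m) * - fromℕ (suc n))      ≈⟨ -‿distribˡ-* _ _ ⟩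
      - fromℕ (suc m) * - fromℕ (suc n) ∎

    -- Normal forms cancel terms by comparing coefficients. Integers can be compared effectively,
    -- field elements cannot, so the coefficients are integers mapped into the ring.
    morphism : +-*-rawRing -Raw-AlmostCommutative⟶ fromCommutativeRing R
    morphism = record
      { ⟦_⟧ = fromℤ ; +-homo = fromℤ-+ ; *-homo = fromℤ-* ; -‿homo = fromℤ-neg ; 0-homo = refl ; 1-homo = ×-homo-1 1# }

    open RingSolver +-*-rawRing (fromCommutativeRing R) morphism
      (λ i j → Maybe.map (λ eq → reflexive (≡.cong fromℤ eq)) (dec⇒weaklyDec ℤ._≟_ i j)) public
      using (solve; _:=_; _:+_; _:*_; _:-_; :-_; con)

-- Linear algebra and least-norm optimisation over an ordered field.

module ConvexOptimisation where

  open import Axiom.ExcludedMiddle using (ExcludedMiddle)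
  open import Data.Fin.Base using (Fin; zero; suc)
  open import Data.Fin.Properties using (_≟_)
  open import Data.Integer.Base using (0ℤ)
  open import Data.List.Base using (List; []; _∷_; _++_)
  open import Data.List.Membership.Propositional using (_∈_; _∉_)
  open import Data.List.Membership.Propositional.Properties using (∈-++⁺ˡ; ∈-++⁺ʳ; ∈-++⁻)
  open import Data.List.Relation.Unary.All as All using (All; []; _∷_)
  open import Data.List.Relation.Unary.AllPairs using ([]; _∷_)
  open import Data.List.Relation.Unary.Any as Any using (here; there)
  open import Data.List.Relation.Unary.Unique.Propositional using (Unique)
  open import Data.Nat.Base using (ℕ; zero; suc)
  open import Data.Product.Base using (_,_)
  open import Data.Sum.Base as Sum using (_⊎_; inj₁; inj₂)
  open import Data.Vec.Functional using (Vector)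
  open import Function.Base using (_∘_)
  open import Level using (0ℓ)
  open import Relation.Binary.PropositionalEquality as ≡ using (_≡_; _≢_)
  open import Relation.Nullary using (¬_; Dec; yes; no; contradiction)
  open RealField using (OrderedField)
  open IntegerSolver using (module IntegerCoefficients)

  module FieldProperties (F : OrderedField) (em : ExcludedMiddle 0ℓ) where

    open OrderedField F hiding (zero)
    open import Algebra.Properties.Semiring.Sum semiring using (sum; sum-cong-≋; ∑-distrib-+; ∑-comm; sum-replicate-zero; *-distribˡ-sum)
    open import Algebra.Properties.Ring (OrderedField.ring F) using (-1*x≈-x)
    open import Relation.Binary.Reasoning.Setoid setoid

    open IntegerCoefficients commutativeRing using (solve; _:=_; _:+_; _:*_; _:-_; :-_; con)

    private variable
      m n : ℕ
      x y z : Carrier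

    ≼-refl : x ≼ x
    ≼-refl = ≼-reflexive refl

    ≼-resp : ∀ {x′ y′} → x ≈ x′ → y ≈ y′ → x ≼ y → x′ ≼ y′
    ≼-resp x≈x′ y≈y′ x≼y = ≼-trans (≼-reflexive (sym x≈x′)) (≼-trans x≼y (≼-reflexive y≈y′))

    ⋠⇒≽ : ¬ x ≼ y → y ≼ x
    ⋠⇒≽ {x} {y} x⋠y with ≼-total x y
    ... | inj₁ x≼y = contradiction x≼y x⋠y
    ... | inj₂ y≼x = y≼x

    ⊕-mono : ∀ {x x′ y y′} → x ≼ x′ → y ≼ y′ → x ⊕ y ≼ x′ ⊕ y′
    ⊕-mono {x} {x′} {y} {y′} p q =
      ≼-trans (⊕-monoˡ y p) (≼-resp (+-comm y x′) (+-comm y′ x′) (⊕-monoˡ x′ q))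

    0≼⊕ : 0# ≼ x → 0# ≼ y → 0# ≼ x ⊕ y
    0≼⊕ p q = ≼-resp (+-identityˡ 0#) refl (⊕-mono p q)

    ≼⇒0≼- : x ≼ y → 0# ≼ y - x
    ≼⇒0≼- {x} {y} p = ≼-resp (-‿inverseʳ x) refl (⊕-monoˡ (- x) p)

    0≼-⇒≼ : 0# ≼ y - x → x ≼ y
    0≼-⇒≼ {y} {x} p = ≼-resp (+-identityˡ x) (cancel y x) (⊕-monoˡ x p)
      where
      cancel : ∀ y x → (y - x) ⊕ x ≈ y
      cancel = solve 2 (λ y x → (y :- x) :+ x := y) refl

    -≈0⇒≈ : x - y ≈ 0# → x ≈ y
    -≈0⇒≈ {x} {y} p = trans (sym (cancel x y)) (trans (+-congʳ p) (+-identityˡ y))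
      where
      cancel : ∀ x y → (x - y) ⊕ y ≈ x
      cancel = solve 2 (λ x y → (x :- y) :+ y := x) refl

    ≈⇒-≈0 : x ≈ y → x - y ≈ 0#
    ≈⇒-≈0 {x} {y} p = trans (+-congʳ p) (-‿inverseʳ y)

    ≼0⇒0≼- : x ≼ 0# → 0# ≼ - x
    ≼0⇒0≼- p = ≼-resp refl (+-identityˡ _) (≼⇒0≼- p)

    0≼square : ∀ x → 0# ≼ x ⊗ x
    0≼square x with ≼-total 0# x
    ... | inj₁ p = ⊗-nonneg p p
    ... | inj₂ p = ≼-resp refl (neg² x) (⊗-nonneg (≼0⇒0≼- p) (≼0⇒0≼- p))
      where
      neg² : ∀ x → (- x) ⊗ (- x) ≈ x ⊗ x
      neg² = solve 1 (λ x → (:- x) :* (:- x) := x :* x) refl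

    ⊗-nonpos : x ≼ 0# → y ≼ 0# → 0# ≼ x ⊗ y
    ⊗-nonpos {x} {y} p q = ≼-resp refl (negs x y) (⊗-nonneg (≼0⇒0≼- p) (≼0⇒0≼- q))
      where
      negs : ∀ x y → (- x) ⊗ (- y) ≈ x ⊗ y
      negs = solve 2 (λ x y → (:- x) :* (:- y) := x :* y) refl

    ⊗≈0 : x ⊗ y ≈ 0# → x ≈ 0# ⊎ y ≈ 0#
    ⊗≈0 {x} {y} p with em {x ≈ 0#}
    ... | yes x≈0 = inj₁ x≈0
    ... | no x≉0 with x⁻¹ , xx⁻¹≈1 ← inverse x≉0 = inj₂ (begin
      y                ≈⟨ *-identityˡ y ⟨
      1# ⊗ y           ≈⟨ *-congʳ xx⁻¹≈1 ⟨
      (x ⊗ x⁻¹) ⊗ y    ≈⟨ rotate x x⁻¹ y ⟩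
      x⁻¹ ⊗ (x ⊗ y)    ≈⟨ *-congˡ p ⟩
      x⁻¹ ⊗ 0#         ≈⟨ zeroʳ x⁻¹ ⟩
      0# ∎)
      where
      rotate : ∀ x z y → (x ⊗ z) ⊗ y ≈ z ⊗ (x ⊗ y)
      rotate = solve 3 (λ x z y → (x :* z) :* y := z :* (x :* y)) refl

    0≼⊗⇒0≼ : 0# ≼ x ⊗ y → ¬ y ≼ 0# → 0# ≼ x
    0≼⊗⇒0≼ {x} {y} p y⋠0 with em {0# ≼ x}
    ... | yes 0≼x = 0≼x
    ... | no 0⋠x with ⊗≈0 (≼-antisym xy≼0 p)
      where
      x≼0 = ⋠⇒≽ 0⋠x
      0≼y = ⋠⇒≽ y⋠0
      move : ∀ x y → (- x) ⊗ y ≈ 0# - x ⊗ y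
      move = solve 2 (λ x y → (:- x) :* y := con 0ℤ :- x :* y) refl
      xy≼0 : x ⊗ y ≼ 0#
      xy≼0 = 0≼-⇒≼ (≼-resp refl (move x y) (⊗-nonneg (≼0⇒0≼- x≼0) 0≼y))
    ... | inj₁ x≈0 = contradiction (≼-reflexive (sym x≈0)) 0⋠x
    ... | inj₂ y≈0 = contradiction (≼-reflexive y≈0) y⋠0

    sum-nonneg : (f : Vector Carrier n) → (∀ i → 0# ≼ f i) → 0# ≼ sum f
    sum-nonneg {zero}  f h = ≼-refl
    sum-nonneg {suc n} f h = 0≼⊕ (h zero) (sum-nonneg (f ∘ suc) (h ∘ suc))

    sum-nonneg-≈0 : (f : Vector Carrier n) → (∀ i → 0# ≼ f i) → sum f ≈ 0# → ∀ i → f i ≈ 0#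
    sum-nonneg-≈0 {suc n} f h eq = λ where
        zero    → first
        (suc i) → sum-nonneg-≈0 (f ∘ suc) (h ∘ suc) (trans (sym (+-identityˡ _)) (trans (+-congʳ (sym first)) eq)) i
      where
      first : f zero ≈ 0#
      first = ≼-antisym (≼-resp (+-identityʳ (f zero)) eq
        (⊕-mono ≼-refl (sum-nonneg (f ∘ suc) (h ∘ suc)))) (h zero)

    sum-zero : (f : Vector Carrier n) → (∀ i → f i ≈ 0#) → sum f ≈ 0#
    sum-zero {n} f h = trans (sum-cong-≋ h) (sum-replicate-zero n)

    dot : Vector Carrier n → Vector Carrier n → Carrier
    dot u w = sum λ i → u i ⊗ w i

    dot-cong : ∀ {u u′ w w′ : Vector Carrier n} → (∀ i → u i ≈ u′ i) → (∀ i → w i ≈ w′ i) → dot u w ≈ dot u′ w′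
    dot-cong p q = sum-cong-≋ λ i → *-cong (p i) (q i)

    dot-comm : ∀ (u w : Vector Carrier n) → dot u w ≈ dot w u
    dot-comm u w = sum-cong-≋ λ i → *-comm (u i) (w i)

    dot-⊕ : ∀ (u u′ w : Vector Carrier n) → dot (λ i → u i ⊕ u′ i) w ≈ dot u w ⊕ dot u′ w
    dot-⊕ u u′ w = trans (sum-cong-≋ λ i → distribʳ (w i) (u i) (u′ i)) (∑-distrib-+ (λ i → u i ⊗ w i) (λ i → u′ i ⊗ w i))

    dot-⊗ : ∀ t (u w : Vector Carrier n) → dot (λ i → t ⊗ u i) w ≈ t ⊗ dot u w
    dot-⊗ t u w = trans (sum-cong-≋ λ i → *-assoc t (u i) (w i)) (sym (*-distribˡ-sum t λ i → u i ⊗ w i))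

    dot-minus : ∀ (u u′ w : Vector Carrier n) → dot (λ i → u i - u′ i) w ≈ dot u w - dot u′ w
    dot-minus u u′ w = begin
      dot (λ i → u i - u′ i) w                 ≈⟨ dot-cong (λ i → +-congˡ (neg (u′ i))) (λ _ → refl) ⟩
      dot (λ i → u i ⊕ (- 1#) ⊗ u′ i) w        ≈⟨ dot-⊕ u (λ i → (- 1#) ⊗ u′ i) w ⟩
      dot u w ⊕ dot (λ i → (- 1#) ⊗ u′ i) w    ≈⟨ +-congˡ (trans (dot-⊗ (- 1#) u′ w) (sym (neg (dot u′ w)))) ⟩
      dot u w - dot u′ w ∎
      where
      neg : ∀ x → - x ≈ (- 1#) ⊗ x
      neg = λ x → sym (-1*x≈-x x)

    dot-minusʳ : ∀ (u w w′ : Vector Carrier n) → dot u (λ i → w i - w′ i) ≈ dot u w - dot u w′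
    dot-minusʳ u w w′ = begin
      dot u (λ i → w i - w′ i)  ≈⟨ dot-comm u _ ⟩
      dot (λ i → w i - w′ i) u  ≈⟨ dot-minus w w′ u ⟩
      dot w u - dot w′ u        ≈⟨ +-cong (dot-comm w u) (-‿cong (dot-comm w′ u)) ⟩
      dot u w - dot u w′ ∎

    dot-zeroˡ : ∀ (u w : Vector Carrier n) → (∀ i → u i ≈ 0#) → dot u w ≈ 0#
    dot-zeroˡ u w h = sum-zero _ λ i → trans (*-congʳ (h i)) (zeroˡ (w i))

    dot-self-≈0 : ∀ (u : Vector Carrier n) → dot u u ≈ 0# → ∀ i → u i ≈ 0#
    dot-self-≈0 u h i with ⊗≈0 (sum-nonneg-≈0 (λ i → u i ⊗ u i) (λ i → 0≼square (u i)) h i)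
    ... | inj₁ p = p
    ... | inj₂ p = p

    unit : Fin n → Vector Carrier n
    unit i j with i ≟ j
    ... | yes _ = 1#
    ... | no  _ = 0#

    unit-same : ∀ (i : Fin n) → unit i i ≈ 1#
    unit-same i with i ≟ i
    ... | yes _  = refl
    ... | no i≢i = contradiction ≡.refl i≢i

    unit-other : ∀ {i j : Fin n} → i ≢ j → unit i j ≈ 0#
    unit-other {i = i} {j} i≢j with i ≟ j
    ... | yes i≡j = contradiction i≡j i≢j
    ... | no _    = refl

    unit-suc : ∀ (i j : Fin n) → unit (suc i) (suc j) ≈ unit i j
    unit-suc i j with i ≟ j
    ... | yes ≡.refl = refl
    ... | no _       = refl

    dot-unit : ∀ (i : Fin n) w → dot (unit i) w ≈ w i
    dot-unit zero w = begin
      1# ⊗ w zero ⊕ sum (λ j → 0# ⊗ w (suc j))  ≈⟨ +-cong (*-identityˡ _) (sum-zero _ λ j → zeroˡ (w (suc j))) ⟩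
      w zero ⊕ 0#                               ≈⟨ +-identityʳ _ ⟩
      w zero ∎
    dot-unit (suc i) w = begin
      0# ⊗ w zero ⊕ sum (λ j → unit (suc i) (suc j) ⊗ w (suc j))  ≈⟨ +-cong (zeroˡ _) (dot-cong (unit-suc i) (λ _ → refl)) ⟩
      0# ⊕ dot (unit i) (w ∘ suc)                                 ≈⟨ +-identityˡ _ ⟩
      dot (unit i) (w ∘ suc)                                      ≈⟨ dot-unit i (w ∘ suc) ⟩
      w (suc i) ∎

    lin : Vector Carrier n → (Fin n → Vector Carrier m) → Vector Carrier m
    lin μ v c = dot μ λ e → v e c

    dot-lin : ∀ (μ : Vector Carrier n) (v : Fin n → Vector Carrier m) w → dot (lin μ v) w ≈ dot μ (λ e → dot (v e) w)
    dot-lin μ v w = begin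
      (sum λ c → (sum λ e → μ e ⊗ v e c) ⊗ w c)      ≈⟨ sum-cong-≋ (λ c → trans (*-comm _ (w c)) (*-distribˡ-sum (w c) (λ e → μ e ⊗ v e c))) ⟩
      (sum λ c → sum λ e → w c ⊗ (μ e ⊗ v e c))      ≈⟨ ∑-comm (λ c e → w c ⊗ (μ e ⊗ v e c)) ⟩
      (sum λ e → sum λ c → w c ⊗ (μ e ⊗ v e c))      ≈⟨ sum-cong-≋ (λ e → trans (sum-cong-≋ λ c → rotate (w c) (μ e) (v e c)) (sym (*-distribˡ-sum (μ e) λ c → v e c ⊗ w c))) ⟩
      (sum λ e → μ e ⊗ sum λ c → v e c ⊗ w c) ∎
      where
      rotate : ∀ a b c → a ⊗ (b ⊗ c) ≈ b ⊗ (c ⊗ a)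
      rotate = solve 3 (λ a b c → a :* (b :* c) := b :* (c :* a)) refl

    SupportedOn : (Fin n → Set) → Vector Carrier n → Set
    SupportedOn S μ = ∀ {e} → ¬ S e → μ e ≈ 0#

    dot-cong-on : ∀ {S : Fin n → Set} {μ} → SupportedOn S μ → ∀ {h h′ : Vector Carrier n} →
      (∀ {e} → S e → h e ≈ h′ e) → dot μ h ≈ dot μ h′
    dot-cong-on {S = S} {μ} supp {h} {h′} eq = sum-cong-≋ λ e → term e em
      where
      term : ∀ e → Dec (S e) → μ e ⊗ h e ≈ μ e ⊗ h′ e
      term e (yes s) = *-congˡ (eq s)
      term e (no ¬s) = trans (trans (*-congʳ (supp ¬s)) (zeroˡ _)) (sym (trans (*-congʳ (supp ¬s)) (zeroˡ _)))

  module Optimisation (F : OrderedField) (em : ExcludedMiddle 0ℓ) {n D : ℕ}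
    (v : Fin n → Vector (OrderedField.Carrier F) D) where

    open OrderedField F hiding (zero)
    open FieldProperties F em
    open IntegerCoefficients commutativeRing using (solve; _:=_; _:+_; _:*_; _:-_; :-_; con)
    open import Algebra.Properties.Semiring.Sum semiring using (sum; sum-cong-≋; ∑-distrib-+)
    open import Algebra.Properties.Ring (OrderedField.ring F) using (-0#≈0#; -‿distribˡ-*)
    open import Relation.Binary.Reasoning.Setoid setoid

    lin-minus : ∀ μ ν c → lin (λ e → μ e - ν e) v c ≈ lin μ v c - lin ν v c
    lin-minus μ ν c = dot-minus μ ν (λ e → v e c)

    -- The Gram matrix of v applied to μ. The vectors u that occur lie in the span of v and are
    -- represented by their coefficients μ.
    value : Vector Carrier n → Fin n → Carrier
    value μ e = dot (lin μ v) (v e)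

    value-⊕⊗ : ∀ μ t κ e → value (λ e → μ e ⊕ t ⊗ κ e) e ≈ value μ e ⊕ t ⊗ value κ e
    value-⊕⊗ μ t κ e = begin
      dot (lin (λ e → μ e ⊕ t ⊗ κ e) v) (v e)              ≈⟨ dot-cong {w = v e} (λ c → trans (dot-⊕ μ (λ e → t ⊗ κ e) (λ e → v e c)) (+-congˡ (dot-⊗ t κ (λ e → v e c)))) (λ _ → refl) ⟩
      dot (λ c → lin μ v c ⊕ t ⊗ lin κ v c) (v e)          ≈⟨ dot-⊕ (lin μ v) (λ c → t ⊗ lin κ v c) (v e) ⟩
      value μ e ⊕ dot (λ c → t ⊗ lin κ v c) (v e)          ≈⟨ +-congˡ (dot-⊗ t (lin κ v) (v e)) ⟩
      value μ e ⊕ t ⊗ value κ e ∎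

    dot-linʳ : ∀ u g → dot u (lin g v) ≈ dot g (λ e → dot u (v e))
    dot-linʳ u g = begin
      dot u (lin g v)             ≈⟨ dot-comm u _ ⟩
      dot (lin g v) u             ≈⟨ dot-lin g v u ⟩
      dot g (λ e → dot (v e) u)   ≈⟨ dot-cong (λ _ → refl) (λ e → dot-comm (v e) u) ⟩
      dot g (λ e → dot u (v e)) ∎

    record EqSolution (c : Vector Carrier n) (B : List (Fin n)) : Set where
      field
        μ         : Vector Carrier n
        supported : SupportedOn (_∈ B) μ
        tight     : ∀ {b} → b ∈ B → value μ b ≈ c b

    record EqObstruction (c : Vector Carrier n) (B : List (Fin n)) : Set where
      field
        y         : Vector Carrier n
        supported : SupportedOn (_∈ B) y
        vanishing : ∀ i → lin y v i ≈ 0#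
        nonzero   : ¬ dot y c ≈ 0#

    -- A linear dependence among the v e also holds for their products with w, so right-hand sides
    -- of this kind are always consistent.
    obstruction-free : ∀ w B → ¬ EqObstruction (λ e → dot w (v e)) B
    obstruction-free w B O = nonzero (trans (sym (dot-linʳ w y)) (trans (dot-comm w _) (dot-zeroˡ _ w vanishing)))
      where open EqObstruction O

    -- The Fredholm alternative by Gram-Schmidt. Solving for the right-hand sides ⟨v b , v e⟩ gives
    -- the projection `lin g v` of v b to the span of `B`; p is the orthogonal remainder. If p = 0,
    -- then κ is a dependence: either c respects it and the new equation follows from the old ones,
    -- or κ is an obstruction. If p ≠ 0, moving along p solves the new equation.
    solve-equations : ∀ B c → EqSolution c B ⊎ EqObstruction c B
    solve-equations []      c = inj₁ (record { μ = λ _ → 0# ; supported = λ _ → refl ; tight = λ () })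
    solve-equations (b ∷ B) c with solve-equations B c | solve-equations B (λ e → dot (v b) (v e))
    ... | inj₂ O | _      = inj₂ (record { EqObstruction O ; supported = λ e∉ → EqObstruction.supported O (e∉ ∘ there) })
    ... | inj₁ _ | inj₂ O = contradiction O (obstruction-free (v b) B)
    ... | inj₁ S | inj₁ G = extend em em
      where
      open EqSolution S
      g = EqSolution.μ G
      κ p : Vector Carrier _
      κ e = unit b e - g e
      p = lin κ v
      g-supported : SupportedOn (_∈ B) g
      g-supported = EqSolution.supported G
      p≈ : ∀ i → p i ≈ v b i - lin g v i
      p≈ i = trans (lin-minus (unit b) g i) (+-congʳ (dot-unit b _))
      p⊥ : ∀ {e} → e ∈ B → dot p (v e) ≈ 0#
      p⊥ {e} e∈B = begin
        dot p (v e)                                  ≈⟨ dot-cong p≈ (λ _ → refl) ⟩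
        dot (λ i → v b i - lin g v i) (v e)          ≈⟨ dot-minus (v b) (lin g v) (v e) ⟩
        dot (v b) (v e) - value g e                  ≈⟨ +-congˡ (-‿cong (EqSolution.tight G e∈B)) ⟩
        dot (v b) (v e) - dot (v b) (v e)            ≈⟨ -‿inverseʳ _ ⟩
        0# ∎
      κ-supported : SupportedOn (_∈ b ∷ B) κ
      κ-supported e∉ = trans (+-cong (unit-other (λ b≡e → e∉ (here (≡.sym b≡e)))) (-‿cong (g-supported (e∉ ∘ there)))) (-‿inverseʳ 0#)
      vb≈ : ∀ i → v b i ≈ p i ⊕ lin g v i
      vb≈ i = begin
        v b i                              ≈⟨ solve 2 (λ x y → x := (x :- y) :+ y) refl (v b i) (lin g v i) ⟩
        (v b i - lin g v i) ⊕ lin g v i    ≈⟨ +-congʳ (p≈ i) ⟨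
        p i ⊕ lin g v i ∎
      dot-vb : ∀ u → dot u (v b) ≈ dot u p ⊕ dot g (λ e → dot u (v e))
      dot-vb u = begin
        dot u (v b)                                ≈⟨ dot-comm u (v b) ⟩
        dot (v b) u                                ≈⟨ dot-cong vb≈ (λ _ → refl) ⟩
        dot (λ i → p i ⊕ lin g v i) u              ≈⟨ dot-⊕ p (lin g v) u ⟩
        dot p u ⊕ dot (lin g v) u                  ≈⟨ +-cong (dot-comm p u) (trans (dot-comm (lin g v) u) (dot-linʳ u g)) ⟩
        dot u p ⊕ dot g (λ e → dot u (v e)) ∎
      extend : Dec (∀ i → p i ≈ 0#) → Dec (dot κ c ≈ 0#) → EqSolution c (b ∷ B) ⊎ EqObstruction c (b ∷ B)
      extend (yes p≈0) (no κc≉0) =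
        inj₂ (record { y = κ ; supported = κ-supported ; vanishing = p≈0 ; nonzero = κc≉0 })
      extend (yes p≈0) (yes κc≈0) =
        inj₁ (record { μ = μ ; supported = λ e∉ → supported (e∉ ∘ there) ; tight = λ { (here ≡.refl) → tight-b ; (there e∈) → tight e∈ } })
        where
        tight-b : value μ b ≈ c b
        tight-b = begin
          value μ b                              ≈⟨ dot-vb (lin μ v) ⟩
          dot (lin μ v) p ⊕ dot g (value μ)      ≈⟨ +-cong (trans (dot-comm _ p) (dot-zeroˡ p _ p≈0)) (dot-cong-on g-supported {value μ} {c} tight) ⟩
          0# ⊕ dot g c                           ≈⟨ +-identityˡ _ ⟩
          dot g c                                ≈⟨ -≈0⇒≈ (trans (+-congʳ (sym (dot-unit b c))) (trans (sym (dot-minus (unit b) g c)) κc≈0)) ⟨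
          c b ∎
      extend (no p≉0) _ with q⁻¹ , qq⁻¹≈1 ← inverse {dot p p} (p≉0 ∘ dot-self-≈0 p) =
        inj₁ (record
          { μ = λ e → μ e ⊕ t ⊗ κ e
          ; supported = λ e∉ → trans (+-cong (supported (e∉ ∘ there)) (trans (*-congˡ (κ-supported e∉)) (zeroʳ t))) (+-identityˡ 0#)
          ; tight = λ { (here ≡.refl) → tight-b ; (there e∈) → tight-e e∈ }
          })
        where
        -- As p is orthogonal to the vectors of `B`, the old equations survive, and ⟨p , v b⟩ = ⟨p ,
        -- p⟩; so the step is the defect divided by ⟨p , p⟩.
        t = (c b - value μ b) ⊗ q⁻¹
        tight-e : ∀ {e} → e ∈ B → value (λ e → μ e ⊕ t ⊗ κ e) e ≈ c e
        tight-e {e} e∈ = begin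
          value (λ e → μ e ⊕ t ⊗ κ e) e    ≈⟨ value-⊕⊗ μ t κ e ⟩
          value μ e ⊕ t ⊗ dot p (v e)      ≈⟨ +-cong (tight e∈) (trans (*-congˡ (p⊥ e∈)) (zeroʳ t)) ⟩
          c e ⊕ 0#                         ≈⟨ +-identityʳ _ ⟩
          c e ∎
        dot-p-vb : dot p (v b) ≈ dot p p
        dot-p-vb = begin
          dot p (v b)                               ≈⟨ dot-vb p ⟩
          dot p p ⊕ dot g (λ e → dot p (v e))       ≈⟨ +-congˡ (trans (dot-cong-on g-supported {λ e → dot p (v e)} {λ _ → 0#} p⊥) (trans (dot-comm g (λ _ → 0#)) (dot-zeroˡ (λ _ → 0#) g (λ _ → refl)))) ⟩
          dot p p ⊕ 0#                              ≈⟨ +-identityʳ _ ⟩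
          dot p p ∎
        tight-b : value (λ e → μ e ⊕ t ⊗ κ e) b ≈ c b
        tight-b = begin
          value (λ e → μ e ⊕ t ⊗ κ e) b                      ≈⟨ value-⊕⊗ μ t κ b ⟩
          value μ b ⊕ t ⊗ dot p (v b)                        ≈⟨ +-congˡ (*-congˡ dot-p-vb) ⟩
          value μ b ⊕ ((c b - value μ b) ⊗ q⁻¹) ⊗ dot p p    ≈⟨ solve 4 (λ a c q i → a :+ ((c :- a) :* i) :* q := a :+ (c :- a) :* (q :* i)) refl (value μ b) (c b) (dot p p) q⁻¹ ⟩
          value μ b ⊕ (c b - value μ b) ⊗ (dot p p ⊗ q⁻¹)    ≈⟨ +-congˡ (*-congˡ qq⁻¹≈1) ⟩
          value μ b ⊕ (c b - value μ b) ⊗ 1#                 ≈⟨ +-congˡ (*-identityʳ _) ⟩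
          value μ b ⊕ (c b - value μ b)                      ≈⟨ solve 2 (λ a c → a :+ (c :- a) := c) refl (value μ b) (c b) ⟩
          c b ∎

    project : ∀ w B → EqSolution (λ e → dot w (v e)) B
    project w B with solve-equations B (λ e → dot w (v e))
    ... | inj₁ S = S
    ... | inj₂ O = contradiction O (obstruction-free w B)

    -- Minimise |u|² subject to ⟨u, v a⟩ ≥ c a on A and ⟨u, v b⟩ = c b on B:
    -- either the optimality conditions can be solved by u = lin μ v, or there
    -- is a Farkas certificate of infeasibility.
    module _ (c : Vector Carrier n) where

      record Optimum (A B : List (Fin n)) : Set where
        field
          μ           : Vector Carrier n
          supported   : SupportedOn (_∈ A ++ B) μ
          feasible    : ∀ {a} → a ∈ A → c a ≼ value μ a
          nonnegative : ∀ {a} → a ∈ A → 0# ≼ μ a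
          slackness   : ∀ {a} → a ∈ A → μ a ≈ 0# ⊎ value μ a ≈ c a
          tight       : ∀ {b} → b ∈ B → value μ b ≈ c b

      record Certificate (A B : List (Fin n)) : Set where
        field
          y           : Vector Carrier n
          supported   : SupportedOn (_∈ A ++ B) y
          nonnegative : ∀ {a} → a ∈ A → 0# ≼ y a
          vanishing   : ∀ i → lin y v i ≈ 0#
          positive    : ¬ dot y c ≼ 0#

      private
        swap-∈ : ∀ {e a : Fin n} A {B} → e ∈ A ++ (a ∷ B) → e ∈ (a ∷ A) ++ B
        swap-∈ A e∈ with ∈-++⁻ A e∈
        ... | inj₁ e∈A          = there (∈-++⁺ˡ e∈A)
        ... | inj₂ (here e≡a)   = here e≡a
        ... | inj₂ (there e∈B)  = there (∈-++⁺ʳ A e∈B)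

      -- An active-set recursion. Solve without the constraint a. If the result satisfies a, give it
      -- multiplier 0. Otherwise a must be tight at the optimum, so move it to the equations `B`;
      -- what remains is to recover the sign of its multiplier, which equations leave free.
      optimise : ∀ A → Unique A → ∀ B → (∀ {a} → a ∈ A → a ∉ B) → Optimum A B ⊎ Certificate A B
      optimise [] _ B _ with solve-equations B c
      ... | inj₁ S = inj₁ (record { EqSolution S ; feasible = λ () ; nonnegative = λ () ; slackness = λ () })
      ... | inj₂ O = inj₂ (orient (≼-total (dot y c) 0#))
        where
        open EqObstruction O
        -- Signs are free on `B`, so y or its negative pairs positively with c.
        orient : dot y c ≼ 0# ⊎ 0# ≼ dot y c → Certificate [] B
        orient (inj₂ 0≼yc) = record { y = y ; supported = supported ; nonnegative = λ () ; vanishing = vanishing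
                                    ; positive = λ yc≼0 → nonzero (≼-antisym yc≼0 0≼yc) }
        orient (inj₁ yc≼0) = record
          { y = λ e → 0# - y e
          ; supported = λ e∉ → ≈⇒-≈0 (sym (supported e∉))
          ; nonnegative = λ ()
          ; vanishing = λ i → trans (lin-minus (λ _ → 0#) y i) (≈⇒-≈0 (trans (dot-zeroˡ (λ _ → 0#) (λ e → v e i) (λ _ → refl)) (sym (vanishing i))))
          ; positive = λ p → nonzero (≼-antisym yc≼0 (0≼-⇒≼ (≼-resp refl (negate (dot y c)) (≼0⇒0≼- (≼-resp (minus) refl p)))))
          }
          where
          minus : dot (λ e → 0# - y e) c ≈ 0# - dot y c
          minus = trans (dot-minus (λ _ → 0#) y c) (+-congʳ (dot-zeroˡ (λ _ → 0#) c (λ _ → refl)))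
          negate : ∀ x → - (0# - x) ≈ x - 0#
          negate = solve 1 (λ x → :- (con 0ℤ :- x) := x :- con 0ℤ) refl
      optimise (a ∷ A) (a∉A ∷ A!) B disjoint = insert (optimise A A! B (disjoint ∘ there))
        where
        outside : a ∉ A ++ B
        outside a∈ with ∈-++⁻ A a∈
        ... | inj₁ a∈A = All.lookup a∉A a∈A ≡.refl
        ... | inj₂ a∈B = disjoint (here ≡.refl) a∈B

        disjoint′ : ∀ {e} → e ∈ A → e ∉ a ∷ B
        disjoint′ e∈A (here ≡.refl) = All.lookup a∉A e∈A ≡.refl
        disjoint′ e∈A (there e∈B)   = disjoint (there e∈A) e∈B

        module Violated (O : Optimum A B) (violated : ¬ c a ≼ value (Optimum.μ O) a) where

          open Optimum O

          gap : Carrier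
          gap = c a - value μ a

          gap>0 : ¬ gap ≼ 0#
          gap>0 p = violated (0≼-⇒≼ (≼-resp refl (solve 2 (λ x y → :- (x :- y) := y :- x) refl (c a) (value μ a)) (≼0⇒0≼- p)))

          module _ (O′ : Optimum A (a ∷ B)) where

            private module ′ = Optimum O′

            h : Vector Carrier n
            h e = value ′.μ e - value μ e

            -- Where the old constraint is tight, h is the slack of the new optimum; otherwise the
            -- old multiplier is 0. On `B` both optima are tight.
            old-term : ∀ e → 0# ≼ μ e ⊗ h e
            old-term e with em {e ∈ A} | em {e ∈ B}
            ... | yes e∈A | _ with slackness e∈A
            ... | inj₁ μ≈0 = ≼-reflexive (sym (trans (*-congʳ μ≈0) (zeroˡ _)))
            ... | inj₂ eq  = ⊗-nonneg (nonnegative e∈A) (≼⇒0≼- (≼-resp (sym eq) refl (′.feasible e∈A)))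
            old-term e | no _ | yes e∈B =
              ≼-reflexive (sym (trans (*-congˡ (≈⇒-≈0 (trans (′.tight (there e∈B)) (sym (tight e∈B))))) (zeroʳ _)))
            old-term e | no e∉A | no e∉B =
              ≼-reflexive (sym (trans (*-congʳ (supported (Sum.[ e∉A , e∉B ] ∘ ∈-++⁻ A))) (zeroˡ _)))

            -- The same with the roles exchanged. The multiplier of a, whose sign is still unknown,
            -- is cancelled by the unit term, because h a = `gap`.
            new-term : ∀ e → 0# ≼ unit a e ⊗ (′.μ a ⊗ gap) - ′.μ e ⊗ h e
            new-term e with a ≟ e
            ... | yes ≡.refl = ≼-reflexive (sym (≈⇒-≈0 (trans (*-identityˡ _) (*-congˡ (+-congʳ (sym (′.tight (here ≡.refl))))))))
            ... | no a≢e = ≼-resp refl (solve 2 (λ g t → :- t := con 0ℤ :* g :- t) refl (′.μ a ⊗ gap) (′.μ e ⊗ h e)) (other em em)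
              where
              other : Dec (e ∈ A) → Dec (e ∈ B) → 0# ≼ - (′.μ e ⊗ h e)
              other (yes e∈A) _ with ′.slackness e∈A
              ... | inj₁ μ≈0 = ≼-reflexive (sym (trans (-‿cong (trans (*-congʳ μ≈0) (zeroˡ _))) -0#≈0#))
              ... | inj₂ eq  = ≼-resp refl (solve 3 (λ m p q → m :* (q :- p) := :- (m :* (p :- q))) refl (′.μ e) (value ′.μ e) (value μ e))
                                 (⊗-nonneg (′.nonnegative e∈A) (≼⇒0≼- (≼-resp (sym eq) refl (feasible e∈A))))
              other (no _) (yes e∈B) = ≼-reflexive (sym (trans
                (-‿cong (trans (*-congˡ (≈⇒-≈0 (trans (′.tight (there e∈B)) (sym (tight e∈B))))) (zeroʳ _))) -0#≈0#))
              other (no e∉A) (no e∉B) = ≼-reflexive (sym (trans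
                (-‿cong (trans (*-congʳ (′.supported (Sum.[ e∉A , Sum.[ (λ { ≡.refl → a≢e ≡.refl }) , e∉B ] ∘ Any.toSum ] ∘ ∈-++⁻ A))) (zeroˡ _))) -0#≈0#))

            Δ : Vector Carrier D
            Δ i = lin ′.μ v i - lin μ v i

            dot-Δ : ∀ ν → dot (lin ν v) Δ ≈ dot ν h
            dot-Δ ν = begin
              dot (lin ν v) Δ                                      ≈⟨ dot-minusʳ (lin ν v) (lin ′.μ v) (lin μ v) ⟩
              dot (lin ν v) (lin ′.μ v) - dot (lin ν v) (lin μ v)  ≈⟨ +-cong (swap ′.μ) (-‿cong (swap μ)) ⟩
              dot ν (value ′.μ) - dot ν (value μ)                  ≈⟨ dot-minusʳ ν (value ′.μ) (value μ) ⟨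
              dot ν h ∎
              where
              swap : ∀ μ → dot (lin ν v) (lin μ v) ≈ dot ν (value μ)
              swap μ = trans (dot-comm (lin ν v) (lin μ v)) (dot-linʳ (lin μ v) ν)

            -- Since ⟨Δ , Δ⟩ = ⟨′μ - μ , h⟩, the product of ′μ a with `gap` is ⟨Δ , Δ⟩ plus the sums
            -- of the old and new terms, hence nonnegative, and `gap` is positive.
            new-multiplier≽0 : 0# ≼ ′.μ a
            new-multiplier≽0 = 0≼⊗⇒0≼ (≼-resp refl collect (0≼⊕ (0≼⊕ (sum-nonneg _ new-term) (sum-nonneg _ old-term)) (sum-nonneg _ (λ i → 0≼square (Δ i))))) gap>0
              where
              g = ′.μ a ⊗ gap
              sum-new : (sum λ e → unit a e ⊗ g - ′.μ e ⊗ h e) ≈ g - dot ′.μ h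
              sum-new = begin
                (sum λ e → unit a e ⊗ g - ′.μ e ⊗ h e)              ≈⟨ sum-cong-≋ (λ e → +-congˡ (-‿distribˡ-* (′.μ e) (h e))) ⟩
                (sum λ e → unit a e ⊗ g ⊕ (- ′.μ e) ⊗ h e)          ≈⟨ ∑-distrib-+ (λ e → unit a e ⊗ g) (λ e → (- ′.μ e) ⊗ h e) ⟩
                dot (unit a) (λ _ → g) ⊕ dot (λ e → - ′.μ e) h      ≈⟨ +-cong (dot-unit a _) (dot-cong {w = h} (λ e → sym (+-identityˡ (- ′.μ e))) (λ _ → refl)) ⟩
                g ⊕ dot (λ e → 0# - ′.μ e) h                        ≈⟨ +-congˡ (dot-minus (λ _ → 0#) ′.μ h) ⟩
                g ⊕ (dot (λ _ → 0#) h - dot ′.μ h)                  ≈⟨ +-congˡ (trans (+-congʳ (dot-zeroˡ (λ _ → 0#) h (λ _ → refl))) (+-identityˡ _)) ⟩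
                g - dot ′.μ h ∎
              collect : ((sum λ e → unit a e ⊗ g - ′.μ e ⊗ h e) ⊕ dot μ h) ⊕ dot Δ Δ ≈ ′.μ a ⊗ gap
              collect = begin
                ((sum λ e → unit a e ⊗ g - ′.μ e ⊗ h e) ⊕ dot μ h) ⊕ dot Δ Δ
                  ≈⟨ +-cong (+-congʳ sum-new) (trans (dot-minus (lin ′.μ v) (lin μ v) Δ) (+-cong (dot-Δ ′.μ) (-‿cong (dot-Δ μ)))) ⟩
                ((g - dot ′.μ h) ⊕ dot μ h) ⊕ (dot ′.μ h - dot μ h)
                  ≈⟨ solve 3 (λ g p q → ((g :- p) :+ q) :+ (p :- q) := g) refl g (dot ′.μ h) (dot μ h) ⟩
                g ∎

          module _ (C : Certificate A (a ∷ B)) where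

            private module C = Certificate C

            -- If y a were negative, every y e (value μ e - c e) would be nonnegative, the one at a
            -- because a is violated. But their sum is - ⟨y , c⟩ < 0, as y is a dependence.
            certificate≽0 : 0# ≼ C.y a
            certificate≽0 with em {0# ≼ C.y a}
            ... | yes p = p
            ... | no ya<0 = contradiction (0≼-⇒≼ (≼-resp refl total (sum-nonneg _ term))) C.positive
              where
              term : ∀ e → 0# ≼ C.y e ⊗ (value μ e - c e)
              term e with a ≟ e
              ... | yes ≡.refl = ⊗-nonpos (⋠⇒≽ ya<0)
                    (0≼-⇒≼ (≼-resp refl (solve 2 (λ x y → y :- x := con 0ℤ :- (x :- y)) refl (value μ e) (c e)) (≼⇒0≼- (⋠⇒≽ violated))))
              ... | no a≢e with em {e ∈ A} | em {e ∈ B}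
              ... | yes e∈A | _ = ⊗-nonneg (C.nonnegative e∈A) (≼⇒0≼- (feasible e∈A))
              ... | no _ | yes e∈B = ≼-reflexive (sym (trans (*-congˡ (≈⇒-≈0 (tight e∈B))) (zeroʳ _)))
              ... | no e∉A | no e∉B = ≼-reflexive (sym (trans
                    (*-congʳ (C.supported (Sum.[ e∉A , Sum.[ (λ { ≡.refl → a≢e ≡.refl }) , e∉B ] ∘ Any.toSum ] ∘ ∈-++⁻ A))) (zeroˡ _)))
              total : dot C.y (λ e → value μ e - c e) ≈ 0# - dot C.y c
              total = trans (dot-minusʳ C.y (value μ) c)
                (+-congʳ (trans (sym (dot-linʳ (lin μ v) C.y)) (trans (dot-comm (lin μ v) _) (dot-zeroˡ _ _ C.vanishing))))

        insert : Optimum A B ⊎ Certificate A B → Optimum (a ∷ A) B ⊎ Certificate (a ∷ A) B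
        insert (inj₂ C) = inj₂ (record
          { y = y ; supported = λ e∉ → supported (e∉ ∘ there)
          ; nonnegative = λ { (here ≡.refl) → ≼-reflexive (sym (supported outside)) ; (there e∈) → nonnegative e∈ }
          ; vanishing = vanishing ; positive = positive })
          where open Certificate C
        insert (inj₁ O) = check em
          where
          open Optimum O
          activate : ¬ c a ≼ value μ a → Optimum A (a ∷ B) ⊎ Certificate A (a ∷ B) → Optimum (a ∷ A) B ⊎ Certificate (a ∷ A) B
          activate violated (inj₁ O′) = inj₁ (record
            { μ = ′.μ ; supported = λ e∉ → ′.supported (e∉ ∘ swap-∈ A)
            ; feasible = λ { (here ≡.refl) → ≼-reflexive (sym (′.tight (here ≡.refl))) ; (there e∈) → ′.feasible e∈ }
            ; nonnegative = λ { (here ≡.refl) → Violated.new-multiplier≽0 O violated O′ ; (there e∈) → ′.nonnegative e∈ }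
            ; slackness = λ { (here ≡.refl) → inj₂ (′.tight (here ≡.refl)) ; (there e∈) → ′.slackness e∈ }
            ; tight = λ e∈ → ′.tight (there e∈) })
            where module ′ = Optimum O′
          activate violated (inj₂ C) = inj₂ (record
            { y = C.y ; supported = λ e∉ → C.supported (e∉ ∘ swap-∈ A)
            ; nonnegative = λ { (here ≡.refl) → Violated.certificate≽0 O violated C ; (there e∈) → C.nonnegative e∈ }
            ; vanishing = C.vanishing ; positive = C.positive })
            where module C = Certificate C
          check : Dec (c a ≼ value μ a) → Optimum (a ∷ A) B ⊎ Certificate (a ∷ A) B
          check (yes p) = inj₁ (record
            { μ = μ ; supported = λ e∉ → supported (e∉ ∘ there)
            ; feasible = λ { (here ≡.refl) → p ; (there e∈) → feasible e∈ }
            ; nonnegative = λ { (here ≡.refl) → ≼-reflexive (sym (supported outside)) ; (there e∈) → nonnegative e∈ }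
            ; slackness = λ { (here ≡.refl) → inj₁ (supported outside) ; (there e∈) → slackness e∈ }
            ; tight = tight })
          check (no violated) = activate violated (optimise A A! (a ∷ B) disjoint′)

-- Avoiding finitely many hyperplanes, and linear dependence.

module GeneralPosition where

  open import Axiom.ExcludedMiddle using (ExcludedMiddle)
  open import Data.Fin.Base using (Fin; zero; suc)
  open import Data.Fin.Properties using (_≟_)
  open import Data.Integer.Base using (0ℤ)
  open import Data.List.Base using (List; []; _∷_; map; length; filter)
  open import Data.List.Membership.Propositional using (_∈_)
  open import Data.List.Membership.Propositional.Properties using (∈-filter⁻)
  open import Data.List.Properties using (filter-all)
  open import Data.List.Relation.Unary.All as All using (All; []; _∷_)
  open import Data.List.Relation.Unary.All.Properties as All using ()
  open import Data.List.Relation.Unary.AllPairs using ([]; _∷_)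
  open import Data.List.Relation.Unary.Any using (here)
  open import Data.List.Relation.Unary.Unique.Propositional using (Unique)
  import Data.List.Relation.Unary.Unique.Propositional.Properties as Unique
  open import Data.Nat.Base as ℕ using (ℕ; zero; suc; s≤s; z≤n)
  open import Data.Nat.Properties as ℕ using ()
  open import Data.Product.Base using (∃; _×_; _,_; proj₁; proj₂)
  open import Data.Vec.Functional as Vector using ()
  open import Data.Vec.Functional using (Vector)
  open import Function.Base using (_∘_)
  open import Level using (0ℓ)
  open import Relation.Binary.PropositionalEquality as ≡ using (_≡_; _≢_)
  open import Relation.Nullary using (¬_; Dec; yes; no; contradiction)
  open import Relation.Nullary.Decidable using (¬?)
  open RealField using (OrderedField)
  open IntegerSolver using (module IntegerCoefficients)
  open ConvexOptimisation using (module FieldProperties)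

  module GenericPosition (F : OrderedField) (em : ExcludedMiddle 0ℓ) where

    open OrderedField F hiding (zero)
    open FieldProperties F em
    open IntegerCoefficients commutativeRing using (solve; _:=_; _:+_; _:*_; _:-_; :-_; con)
    open import Algebra.Properties.Semiring.Sum semiring using (sum)
    open import Relation.Binary.Reasoning.Setoid setoid

    private
      1⋠0 : ¬ 1# ≼ 0#
      1⋠0 1≼0 = 1≉0 (≼-antisym 1≼0 0≼1)

      ⊕1-⋠ : ∀ {t s} → s ≼ t → ¬ t ⊕ 1# ≼ s
      ⊕1-⋠ {t} {s} s≼t p = 1⋠0 (≼-resp (solve 2 (λ t o → (t :+ o) :+ :- t := o) refl t 1#) (-‿inverseʳ t) (⊕-monoˡ (- t) (≼-trans p s≼t)))

    larger-than : ∀ ts → ∃ λ x → ¬ x ≼ 0# × All (λ t → ¬ x ≼ t) ts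
    larger-than []       = 1# , 1⋠0 , []
    larger-than (t ∷ ts) with larger-than ts
    ... | x , x>0 , x>ts with em {x ≼ t}
    ... | no x⋠t  = x , x>0 , x⋠t ∷ x>ts
    ... | yes x≼t = t ⊕ 1# , ⊕1-⋠ (≼-trans (⋠⇒≽ x>0) x≼t) , ⊕1-⋠ ≼-refl ∷ All.map (λ x⋠s → ⊕1-⋠ (≼-trans (⋠⇒≽ x⋠s) x≼t)) x>ts

    AffineForm : ℕ → Set
    AffineForm r = Vector Carrier r × Carrier

    NonzeroForm : ∀ {r} → AffineForm r → Set
    NonzeroForm (a , b) = ¬ ((∀ i → a i ≈ 0#) × b ≈ 0#)

    -- Coordinates are chosen from the last to the first. With the others fixed, a form with nonzero
    -- leading coefficient vanishes for a single value of the first one; a number larger than 0 and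
    -- all these roots is positive and avoids them.
    avoid : ∀ {r} (fs : List (AffineForm r)) → ∃ λ c → (∀ i → ¬ c i ≼ 0#) ×
      All (λ f → NonzeroForm f → ¬ dot (proj₁ f) c ⊕ proj₂ f ≈ 0#) fs
    avoid {zero} fs = (λ ()) , (λ ()) , All.universal (λ (_ , b) f≢0 p → f≢0 ((λ ()) , trans (sym (+-identityˡ b)) p)) fs
    avoid {suc r} fs with avoid (map (λ (a , b) → a ∘ suc , b) fs)
    ... | c , c>0 , avoided = extend (larger-than (map root fs))
      where
      rest : AffineForm (suc r) → Carrier
      rest (a , b) = dot (a ∘ suc) c ⊕ b
      root : AffineForm (suc r) → Carrier
      root f@(a , b) with em {a zero ≈ 0#}
      -- A default: a form that does not involve this coordinate has already been avoided by the
      -- other ones.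
      ... | yes _  = 0#
      ... | no a≉0 = (- rest f) ⊗ proj₁ (inverse a≉0)
      extend : (∃ λ x → ¬ x ≼ 0# × All (λ t → ¬ x ≼ t) (map root fs)) → ∃ λ c → (∀ i → ¬ c i ≼ 0#) ×
        All (λ f → NonzeroForm f → ¬ dot (proj₁ f) c ⊕ proj₂ f ≈ 0#) fs
      extend (x , x>0 , x>) = x Vector.∷ c , (λ { zero → x>0 ; (suc i) → c>0 i })
        , All.zipWith (λ {f} (p , q) → check f p q) (All.map⁻ x> , All.map⁻ avoided)
        where
        check : ∀ f → ¬ x ≼ root f → (NonzeroForm (proj₁ f ∘ suc , proj₂ f) → ¬ rest f ≈ 0#) →
          NonzeroForm f → ¬ dot (proj₁ f) (x Vector.∷ c) ⊕ proj₂ f ≈ 0#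
        check f@(a , b) x⋠root tail≉0 f≢0 eq with em {a zero ≈ 0#}
        ... | yes a≈0 = tail≉0 (λ (as≈0 , b≈0) → f≢0 ((λ { zero → a≈0 ; (suc i) → as≈0 i }) , b≈0)) (begin
          rest f                       ≈⟨ +-identityˡ _ ⟨
          0# ⊕ rest f                  ≈⟨ +-congʳ (trans (*-congʳ a≈0) (zeroˡ x)) ⟨
          a zero ⊗ x ⊕ rest f          ≈⟨ +-assoc _ _ _ ⟨
          a zero ⊗ x ⊕ _ ⊕ b           ≈⟨ eq ⟩
          0# ∎)
        ... | no a≉0 with inverse a≉0
        ... | a⁻¹ , aa⁻¹≈1 = x⋠root (≼-reflexive (begin
          x                                   ≈⟨ *-identityʳ x ⟨
          x ⊗ 1#                              ≈⟨ *-congˡ aa⁻¹≈1 ⟨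
          x ⊗ (a zero ⊗ a⁻¹)                  ≈⟨ solve 4 (λ x a i t → x :* (a :* i) := ((a :* x :+ t) :- t) :* i) refl x (a zero) a⁻¹ (rest f) ⟩
          ((a zero ⊗ x ⊕ rest f) - rest f) ⊗ a⁻¹   ≈⟨ *-congʳ (+-congʳ (trans (sym (+-assoc _ _ _)) eq)) ⟩
          (0# - rest f) ⊗ a⁻¹                 ≈⟨ *-congʳ (+-identityˡ _) ⟩
          (- rest f) ⊗ a⁻¹ ∎))

    MatrixForm : ℕ → ℕ → Set
    MatrixForm n r = (Fin n → Vector Carrier r) × Carrier

    evaluate : ∀ {n r} → MatrixForm n r → (Fin n → Vector Carrier r) → Carrier
    evaluate (a , b) c = (sum λ j → dot (a j) (c j)) ⊕ b

    -- The same induction by rows: with the later rows fixed, each form is affine in the first row,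
    -- with the value of the rest as its constant term. If the first row of the form vanishes, that
    -- constant is nonzero by induction.
    avoid-matrix : ∀ {n r} (fs : List (MatrixForm n r)) → ∃ λ c → (∀ j i → ¬ c j i ≼ 0#) ×
      All (λ (a , b) → ¬ ((∀ j i → a j i ≈ 0#) × b ≈ 0#) → ¬ evaluate (a , b) c ≈ 0#) fs
    avoid-matrix {zero} fs = (λ ()) , (λ ()) , All.universal (λ (_ , b) f≢0 p → f≢0 ((λ ()) , trans (sym (+-identityˡ b)) p)) fs
    avoid-matrix {suc n} fs with avoid-matrix (map (λ (a , b) → a ∘ suc , b) fs)
    ... | c , c>0 , avoided with avoid (map (λ (a , b) → a zero , evaluate (a ∘ suc , b) c) fs)
    ... | row , row>0 , row-avoided = row Vector.∷ c , (λ { zero → row>0 ; (suc j) → c>0 j })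
        , All.zipWith (λ {f} (p , q) → check f p q) (All.map⁻ row-avoided , All.map⁻ avoided)
      where
      check : ∀ ((a , b) : MatrixForm (suc n) _) →
        (NonzeroForm (a zero , evaluate (a ∘ suc , b) c) → ¬ dot (a zero) row ⊕ evaluate (a ∘ suc , b) c ≈ 0#) →
        (¬ ((∀ j i → a (suc j) i ≈ 0#) × b ≈ 0#) → ¬ evaluate (a ∘ suc , b) c ≈ 0#) →
        ¬ ((∀ j i → a j i ≈ 0#) × b ≈ 0#) → ¬ evaluate (a , b) (row Vector.∷ c) ≈ 0#
      check (a , b) row-ok tail-ok f≢0 eq =
        row-ok (λ (a₀≈0 , tail≈0) → tail-ok (λ (as≈0 , b≈0) → f≢0 ((λ { zero → a₀≈0 ; (suc j) → as≈0 j }) , b≈0)) tail≈0)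
          (trans (sym (+-assoc _ _ _)) eq)

    module _ {n : ℕ} where

      private
        ≢? : ∀ (p j : Fin n) → Dec (j ≢ p)
        ≢? p j = ¬? (j ≟ p)

        remove : Fin n → List (Fin n) → List (Fin n)
        remove p = filter (≢? p)

        length-remove : ∀ p {js} → Unique js → length js ℕ.≤ suc (length (remove p js))
        length-remove p []                    = z≤n
        length-remove p {j ∷ js} (j∉ ∷ js!) with j ≟ p
        ... | yes ≡.refl = s≤s (ℕ.≤-reflexive (≡.cong length (≡.sym (filter-all (≢? p) (All.map (λ j≢ eq → j≢ (≡.sym eq)) j∉)))))
        ... | no _       = s≤s (length-remove p js!)

      -- Gaussian elimination. A pivot p clears the first coordinate of the other vectors; a
      -- dependence among the reduced vectors becomes one among the originals by adjusting the
      -- coefficient at p, and a nonzero coefficient away from p survives.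
      dependent : ∀ {D} (w : Fin n → Vector Carrier D) js → Unique js → D ℕ.< length js →
        ∃ λ a → SupportedOn (_∈ js) a × (∃ λ j → j ∈ js × ¬ a j ≈ 0#) × (∀ i → lin a w i ≈ 0#)
      dependent {zero} w (j ∷ js) _ _ =
        unit j , (λ {e} e∉ → unit-other {i = j} {e} (λ { ≡.refl → e∉ (here ≡.refl) })) , (j , here ≡.refl , λ p → 1≉0 (trans (sym (unit-same j)) p)) , λ ()
      dependent {suc D} w js js! D<js with em {∃ λ p → p ∈ js × ¬ w p zero ≈ 0#}
      ... | no none with a , supp , nontrivial , vanish ← dependent (λ e → w e ∘ suc) js js! (ℕ.<-trans (ℕ.n<1+n D) D<js) =
        a , supp , nontrivial , λ where
          (suc i) → vanish i
          zero    → trans (dot-cong-on {S = _∈ js} {μ = a} supp {h = λ e → w e zero} {h′ = λ _ → 0#} (λ {e} e∈ → first-zero e∈ em)) (trans (dot-comm a (λ _ → 0#)) (dot-zeroˡ (λ _ → 0#) a (λ _ → refl)))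
        where
        first-zero : ∀ {e} → e ∈ js → Dec (w e zero ≈ 0#) → w e zero ≈ 0#
        first-zero e∈ (yes eq) = eq
        first-zero e∈ (no ne)  = contradiction (_ , e∈ , ne) none
      ... | yes (p , p∈ , wp≉0) with π , ππ≈1 ← inverse wp≉0
        with a , supp , (j , j∈ , aj≉0) , vanish ←
          dependent (λ e i → w e (suc i) - (w e zero ⊗ π) ⊗ w p (suc i)) (remove p js) (Unique.filter⁺ (≢? p) js!)
            (ℕ.≤-pred (ℕ.≤-trans D<js (length-remove p js!))) =
        (λ e → a e - s ⊗ unit p e)
        , (λ {e} e∉ → trans (+-cong (supp (e∉ ∘ proj₁ ∘ ∈-filter⁻ (≢? p) {xs = js})) (-‿cong (trans (*-congˡ (unit-other {i = p} {e} (λ { ≡.refl → e∉ p∈ }))) (zeroʳ s)))) (-‿inverseʳ 0#))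
        , (j , proj₁ (∈-filter⁻ (≢? p) {xs = js} j∈) , λ eq → aj≉0 (trans (sym (unchanged (proj₂ (∈-filter⁻ (≢? p) {xs = js} j∈)))) eq))
        , λ i → trans (expand i) (cancelled i)
        where
        s : Carrier
        -- This makes the first coordinate of the adjusted combination vanish; in the other
        -- coordinates it reproduces the eliminated terms.
        s = dot a (λ e → w e zero) ⊗ π
        unchanged : ∀ {j} → j ≢ p → a j - s ⊗ unit p j ≈ a j
        unchanged {j} j≢p = begin
          a j - s ⊗ unit p j    ≈⟨ +-congˡ (-‿cong (trans (*-congˡ (unit-other (j≢p ∘ ≡.sym))) (zeroʳ s))) ⟩
          a j - 0#              ≈⟨ solve 1 (λ x → x :- con 0ℤ := x) refl (a j) ⟩
          a j ∎
        expand : ∀ i → lin (λ e → a e - s ⊗ unit p e) w i ≈ lin a w i - s ⊗ w p i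
        expand i = begin
          dot (λ e → a e - s ⊗ unit p e) (λ e → w e i)               ≈⟨ dot-minus a (λ e → s ⊗ unit p e) (λ e → w e i) ⟩
          lin a w i - dot (λ e → s ⊗ unit p e) (λ e → w e i)         ≈⟨ +-congˡ (-‿cong (trans (dot-⊗ s (unit p) (λ e → w e i)) (*-congˡ (dot-unit p (λ e → w e i))))) ⟩
          lin a w i - s ⊗ w p i ∎
        cancelled : ∀ i → lin a w i - s ⊗ w p i ≈ 0#
        cancelled zero = begin
          lin a w zero - (lin a w zero ⊗ π) ⊗ w p zero    ≈⟨ solve 3 (λ l π q → l :- (l :* π) :* q := l :- l :* (q :* π)) refl (lin a w zero) π (w p zero) ⟩
          lin a w zero - lin a w zero ⊗ (w p zero ⊗ π)    ≈⟨ +-congˡ (-‿cong (trans (*-congˡ ππ≈1) (*-identityʳ _))) ⟩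
          lin a w zero - lin a w zero                     ≈⟨ -‿inverseʳ _ ⟩
          0# ∎
        cancelled (suc i) = begin
          lin a w (suc i) - (dot a (λ e → w e zero) ⊗ π) ⊗ w p (suc i)
            ≈⟨ +-congˡ (-‿cong (solve 3 (λ d π q → (d :* π) :* q := (π :* q) :* d) refl (dot a (λ e → w e zero)) π (w p (suc i)))) ⟩
          lin a w (suc i) - (π ⊗ w p (suc i)) ⊗ dot a (λ e → w e zero)
            ≈⟨ +-congˡ (-‿cong (trans (*-congˡ (dot-comm a (λ e → w e zero))) (sym (dot-⊗ (π ⊗ w p (suc i)) (λ e → w e zero) a)))) ⟩
          lin a w (suc i) - dot (λ e → (π ⊗ w p (suc i)) ⊗ w e zero) a
            ≈⟨ +-congˡ (-‿cong (dot-comm (λ e → (π ⊗ w p (suc i)) ⊗ w e zero) a)) ⟩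
          lin a w (suc i) - dot a (λ e → (π ⊗ w p (suc i)) ⊗ w e zero)
            ≈⟨ dot-minusʳ a (λ e → w e (suc i)) (λ e → (π ⊗ w p (suc i)) ⊗ w e zero) ⟨
          dot a (λ e → w e (suc i) - (π ⊗ w p (suc i)) ⊗ w e zero)
            ≈⟨ dot-cong {u = a} (λ _ → refl) (λ e → +-congˡ (-‿cong (solve 3 (λ π q x → (π :* q) :* x := (x :* π) :* q) refl π (w p (suc i)) (w e zero)))) ⟩
          dot a (λ e → w e (suc i) - (w e zero ⊗ π) ⊗ w p (suc i))
            ≈⟨ vanish i ⟩
          0# ∎

-- Generic bounds, bases, and the filtration by cells.

module CellDecomposition where

  open import Axiom.ExcludedMiddle using (ExcludedMiddle)
  open import Data.Fin.Base using (Fin; zero; suc)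
  open import Data.Fin.Properties using (_≟_)
  open import Data.Integer.Base using (0ℤ)
  open import Data.List.Base using (List; []; _∷_; map; length; filter; allFin; cartesianProductWith; cartesianProduct)
  open import Data.List.Membership.Propositional using (_∈_; _∉_)
  open import Data.List.Membership.Propositional.Properties using (∈-filter⁺; ∈-filter⁻; ∈-allFin; ∈-map⁺; ∈-cartesianProductWith⁺; ∈-cartesianProduct⁺; ∈-++⁻)
  open import Data.List.Properties using (length-tabulate)
  open import Data.List.Relation.Binary.Permutation.Propositional using (↭-sym)
  open import Data.List.Relation.Binary.Permutation.Propositional.Properties using (∈-resp-↭)
  open import Data.List.Relation.Unary.All as All using (All; []; _∷_)
  open import Data.List.Relation.Unary.All.Properties as All using ()
  open import Data.List.Relation.Unary.AllPairs using (AllPairs; []; _∷_)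
  open import Data.List.Relation.Unary.Any using (here; there)
  open import Data.List.Relation.Unary.Linked.Properties using (Linked⇒AllPairs)
  open import Data.List.Relation.Unary.Unique.Propositional using (Unique)
  import Data.List.Relation.Unary.Unique.Propositional.Properties as Unique
  open import Data.List.Sort using (sort; sort-↭; sort-↗)
  open import Data.Maybe.Base using (Maybe; just; nothing; maybe′)
  open import Data.Nat.Base as ℕ using (ℕ; zero; suc)
  open import Data.Nat.Properties as ℕ using ()
  open import Data.Product.Base using (∃; _×_; _,_; proj₁; proj₂)
  open import Data.Sum.Base as Sum using (_⊎_; inj₁; inj₂)
  open import Data.Unit.Base using (⊤; tt)
  open import Data.Vec.Base using ([]; _∷_; lookup; tabulate; replicate)
  open import Data.Vec.Functional using (Vector)
  open import Data.Vec.Properties using (lookup∘tabulate; lookup-replicate; lookup∘update′)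
  open import Function.Base using (_∘_; id)
  open import Level using (0ℓ)
  open import Relation.Binary.Bundles using (DecTotalOrder)
  import Relation.Binary.Construct.On as On
  open import Relation.Binary.PropositionalEquality as ≡ using (_≡_; _≢_)
  open import Relation.Nullary using (¬_; Dec; yes; no; contradiction)
  open RealField using (OrderedField)
  open IntegerSolver using (module IntegerCoefficients)
  open ConvexOptimisation using (module FieldProperties; module Optimisation)
  open GeneralPosition using (module GenericPosition)
  open PartialMaps

  module _ {n r : ℕ} where

    assigned? : (σ : PartialMap {n} {r}) → ∀ j → Dec (∃ λ i → lookup σ j ≡ just i)
    assigned? σ j with lookup σ j
    ... | nothing = no λ ()
    ... | just i  = yes (i , ≡.refl)

    dom : PartialMap → List (Fin n)
    dom σ = filter (assigned? σ) (allFin n)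

    ∈-dom⁺ : ∀ {σ j i} → lookup σ j ≡ just i → j ∈ dom σ
    ∈-dom⁺ {σ} {j} {i} eq = ∈-filter⁺ (assigned? σ) (∈-allFin j) (i , eq)

    ∈-dom⁻ : ∀ {σ j} → j ∈ dom σ → ∃ λ i → lookup σ j ≡ just i
    ∈-dom⁻ {σ} j∈ = proj₂ (∈-filter⁻ (assigned? σ) {xs = allFin n} j∈)

    dom-unique : ∀ σ → Unique (dom σ)
    dom-unique σ = Unique.filter⁺ (assigned? σ) (Unique.allFin⁺ n)

    ∣dom∣+∣free∣ : ∀ σ → length (dom σ) ℕ.+ length (free σ) ≡ n
    ∣dom∣+∣free∣ σ = ≡.trans (go (allFin n)) (length-tabulate id)
      where
      go : ∀ js → length (filter (assigned? σ) js) ℕ.+ length (filter (free? σ) js) ≡ length js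
      go []       = ≡.refl
      go (j ∷ js) with lookup σ j
      ... | just _  = ≡.cong suc (go js)
      ... | nothing = ≡.trans (ℕ.+-suc _ _) (≡.cong suc (go js))

  allMaps : ∀ n r → List (PartialMap {n} {r})
  allMaps zero    r = [] ∷ []
  allMaps (suc n) r = cartesianProductWith _∷_ (nothing ∷ map just (allFin r)) (allMaps n r)

  ∈-allMaps : ∀ {n r} (σ : PartialMap {n} {r}) → σ ∈ allMaps n r
  ∈-allMaps []            = here ≡.refl
  ∈-allMaps {suc n} {r} (m ∷ σ) =
    ∈-cartesianProductWith⁺ _∷_ {xs = nothing ∷ map just (allFin r)} {ys = allMaps n r} (value m) (∈-allMaps σ)
    where
    value : ∀ m → m ∈ nothing ∷ map just (allFin r)
    value nothing  = here ≡.refl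
    value (just i) = there (∈-map⁺ just (∈-allFin i))

  module Bases (F : OrderedField) (em : ExcludedMiddle 0ℓ) {n r D : ℕ}
    (vec : Fin n → Fin r → Vector (OrderedField.Carrier F) D) where

    open OrderedField F hiding (zero)
    open FieldProperties F em
    open GenericPosition F em
    open IntegerCoefficients commutativeRing using (solve; _:=_; _:+_; _:*_; _:-_; :-_; con)
    open import Algebra.Properties.Semiring.Sum semiring using (sum; sum-cong-≋; ∑-distrib-+)
    open import Relation.Binary.Reasoning.Setoid setoid

    private
      Map : Set
      Map = PartialMap {n} {r}

    -- A map selects at most one vector per point, so multipliers can be indexed by all points;
    -- unassigned points are excluded by the supports.
    at : Map → Fin n → Vector Carrier D
    at σ j = maybe′ (vec j) (λ _ → 0#) (lookup σ j)

    at-just : ∀ σ {j i} → lookup σ j ≡ just i → at σ j ≡ vec j i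
    at-just σ eq = ≡.cong (maybe′ _ _) eq

    module At (σ : Map) = Optimisation F em (at σ)

    bound : (Fin n → Vector Carrier r) → Map → Vector Carrier n
    bound c σ j = maybe′ (c j) 0# (lookup σ j)

    bound-just : ∀ c σ {j i} → lookup σ j ≡ just i → bound c σ j ≡ c j i
    bound-just c σ eq = ≡.cong (maybe′ _ _) eq

    projection : ∀ B j i → At.EqSolution B (λ e → dot (vec j i) (at B e)) (dom B)
    projection B j i = At.project B (vec j i) (dom B)

    coordinates : Map → Fin n → Fin r → Vector Carrier n
    coordinates B j i = At.EqSolution.μ {σ = B} (projection B j i)

    -- lin (coordinates B j i) (at B) is the orthogonal projection of vec j i to
    -- the span of B, so this says that the constraint (j , i) is not tight at a
    -- point of that span where all constraints of B are.
    Generic : (Fin n → Vector Carrier r) → Set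
    Generic c = ∀ B j i → lookup B j ≢ just i → ¬ c j i ≈ dot (coordinates B j i) (bound c B)

    module _ (B : Map) (j₀ : Fin n) (i₀ : Fin r) where

      private
        g : Vector Carrier n
        g = coordinates B j₀ i₀

        row : ∀ j → Maybe (Fin r) → Vector Carrier r
        row j m i = unit j₀ j ⊗ unit i₀ i - maybe′ (λ i′ → g j ⊗ unit i′ i) 0# m

      form : MatrixForm n r
      form = (λ j → row j (lookup B j)) , 0#

      -- The entry c j₀ i₀ has coefficient 1, because the subtracted part involves only the entries
      -- of c at the pairs in `B`.
      form-nonzero : lookup B j₀ ≢ just i₀ → ¬ ((∀ j i → proj₁ form j i ≈ 0#) × 0# ≈ 0#)
      form-nonzero j₀i₀∉B (zeros , _) = 1≉0 (trans (sym (entry (lookup B j₀) j₀i₀∉B)) (zeros j₀ i₀))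
        where
        entry : ∀ m → m ≢ just i₀ → row j₀ m i₀ ≈ 1#
        entry m m≢ = begin
          unit j₀ j₀ ⊗ unit i₀ i₀ - maybe′ (λ i′ → g j₀ ⊗ unit i′ i₀) 0# m
            ≈⟨ +-cong (trans (*-cong (unit-same j₀) (unit-same i₀)) (*-identityˡ 1#)) (-‿cong (zero-part m m≢)) ⟩
          1# - 0# ≈⟨ solve 1 (λ x → x :- con 0ℤ := x) refl 1# ⟩
          1# ∎
          where
          zero-part : ∀ m → m ≢ just i₀ → maybe′ (λ i′ → g j₀ ⊗ unit i′ i₀) 0# m ≈ 0#
          zero-part nothing   _  = refl
          zero-part (just i′) m≢ = trans (*-congˡ (unit-other {i = i′} {i₀} (m≢ ∘ ≡.cong just))) (zeroʳ _)

      evaluate-form : ∀ c → evaluate form c ≈ c j₀ i₀ - dot g (bound c B)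
      evaluate-form c = begin
        (sum λ j → dot (row j (lookup B j)) (c j)) ⊕ 0#                  ≈⟨ +-identityʳ _ ⟩
        (sum λ j → dot (row j (lookup B j)) (c j))                       ≈⟨ sum-cong-≋ (λ j → evaluate-row j (lookup B j)) ⟩
        (sum λ j → unit j₀ j ⊗ c j i₀ ⊕ (- g j) ⊗ bound c B j)           ≈⟨ ∑-distrib-+ (λ j → unit j₀ j ⊗ c j i₀) (λ j → (- g j) ⊗ bound c B j) ⟩
        dot (unit j₀) (λ j → c j i₀) ⊕ dot (λ j → - g j) (bound c B)     ≈⟨ +-cong (dot-unit j₀ (λ j → c j i₀)) (dot-neg (bound c B)) ⟩
        c j₀ i₀ - dot g (bound c B) ∎
        where
        dot-neg : ∀ w → dot (λ j → - g j) w ≈ - dot g w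
        dot-neg w = begin
          dot (λ j → - g j) w         ≈⟨ dot-cong {w = w} (λ j → sym (+-identityˡ (- g j))) (λ _ → refl) ⟩
          dot (λ j → 0# - g j) w      ≈⟨ dot-minus (λ _ → 0#) g w ⟩
          dot (λ _ → 0#) w - dot g w  ≈⟨ +-congʳ (dot-zeroˡ (λ _ → 0#) w (λ _ → refl)) ⟩
          0# - dot g w                ≈⟨ +-identityˡ _ ⟩
          - dot g w ∎
        evaluate-row : ∀ j m → dot (row j m) (c j) ≈ unit j₀ j ⊗ c j i₀ ⊕ (- g j) ⊗ maybe′ (c j) 0# m
        evaluate-row j m = begin
          dot (row j m) (c j)
            ≈⟨ dot-minus (λ i → unit j₀ j ⊗ unit i₀ i) (λ i → maybe′ (λ i′ → g j ⊗ unit i′ i) 0# m) (c j) ⟩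
          dot (λ i → unit j₀ j ⊗ unit i₀ i) (c j) - dot (λ i → maybe′ (λ i′ → g j ⊗ unit i′ i) 0# m) (c j)
            ≈⟨ +-cong (trans (dot-⊗ (unit j₀ j) (unit i₀) (c j)) (*-congˡ (dot-unit i₀ (c j)))) (-‿cong (second m)) ⟩
          unit j₀ j ⊗ c j i₀ - g j ⊗ maybe′ (c j) 0# m
            ≈⟨ solve 3 (λ a g b → a :- g :* b := a :+ (:- g) :* b) refl (unit j₀ j ⊗ c j i₀) (g j) (maybe′ (c j) 0# m) ⟩
          unit j₀ j ⊗ c j i₀ ⊕ (- g j) ⊗ maybe′ (c j) 0# m ∎
          where
          second : ∀ m → dot (λ i → maybe′ (λ i′ → g j ⊗ unit i′ i) 0# m) (c j) ≈ g j ⊗ maybe′ (c j) 0# m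
          second (just i′) = trans (dot-⊗ (g j) (unit i′) (c j)) (*-congˡ (dot-unit i′ (c j)))
          second nothing   = trans (dot-zeroˡ (λ _ → 0#) (c j) (λ _ → refl)) (sym (zeroʳ (g j)))

    generic-exists : ∃ λ c → (∀ j i → ¬ c j i ≼ 0#) × Generic c
    generic-exists with avoid-matrix (map (λ (B , j , i) → form B j i) positions)
      where
      positions : List (Map × Fin n × Fin r)
      positions = cartesianProduct (allMaps n r) (cartesianProduct (allFin n) (allFin r))
    ... | c , c>0 , avoided = c , c>0 , λ B j i ∉B eq →
      All.lookup (All.map⁻ avoided) (∈-cartesianProduct⁺ (∈-allMaps B) (∈-cartesianProduct⁺ (∈-allFin j) (∈-allFin i)))
        (form-nonzero B j i ∉B) (trans (evaluate-form B j i c) (≈⇒-≈0 eq))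

    module Cells (c : Fin n → Vector Carrier r) (generic : Generic c) where

      -- The optimality conditions of the least-norm problem with constraints `B`, all of them
      -- tight: u is the shortest vector satisfying these constraints.
      record Basis (B : Map) : Set where
        field
          μ           : Vector Carrier n
          supported   : SupportedOn (_∈ dom B) μ
          nonnegative : ∀ j → 0# ≼ μ j
        u : Vector Carrier D
        u = lin μ (at B)
        field
          tight : ∀ {j i} → lookup B j ≡ just i → dot u (vec j i) ≈ c j i

      T : Vector Carrier D → Fin n → Fin r → Set
      T u j i = c j i ≼ dot u (vec j i)

      dot-u : ∀ {B} (b : Basis B) w → dot (Basis.u b) w ≈ dot (Basis.μ b) (λ e → dot (at B e) w)
      dot-u {B} b w = dot-lin (Basis.μ b) (at B) w

      -- A vector in the span of `B` sees only the projection of vec j i, and on it takes the value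
      -- ⟨g , c⟩ prescribed by the tight constraints of `B`; genericity says that this is not c j i.
      not-tight : ∀ B μ → SupportedOn (_∈ dom B) μ → ∀ u → (∀ k → u k ≈ lin μ (at B) k) →
        (∀ {j i} → lookup B j ≡ just i → dot u (vec j i) ≈ c j i) →
        ∀ {j i} → lookup B j ≢ just i → ¬ dot u (vec j i) ≈ c j i
      not-tight B μ supp u u≈ tight {j} {i} ∉B eq = generic B j i ∉B (begin
        c j i                                     ≈⟨ eq ⟨
        dot u (vec j i)                           ≈⟨ dot-cong {w = vec j i} u≈ (λ _ → refl) ⟩
        dot (lin μ (at B)) (vec j i)              ≈⟨ dot-lin μ (at B) (vec j i) ⟩
        dot μ (λ e → dot (at B e) (vec j i))      ≈⟨ dot-cong-on {S = _∈ dom B} {μ} supp {λ e → dot (at B e) (vec j i)} {At.value B g}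
                                                       (λ {e} e∈ → trans (dot-comm (at B e) (vec j i)) (sym (At.EqSolution.tight {σ = B} (projection B j i) e∈))) ⟩
        dot μ (At.value B g)                      ≈⟨ At.dot-linʳ B (lin g (at B)) μ ⟨
        dot (lin g (at B)) (lin μ (at B))         ≈⟨ dot-comm (lin g (at B)) (lin μ (at B)) ⟩
        dot (lin μ (at B)) (lin g (at B))         ≈⟨ At.dot-linʳ B (lin μ (at B)) g ⟩
        dot g (At.value B μ)                      ≈⟨ dot-cong-on {S = _∈ dom B} {g} (At.EqSolution.supported {σ = B} (projection B j i)) {At.value B μ} {bound c B} on-B ⟩
        dot g (bound c B) ∎)
        where
        g = coordinates B j i
        on-B : ∀ {e} → e ∈ dom B → At.value B μ e ≈ bound c B e
        on-B {e} e∈ with i′ , eq′ ← ∈-dom⁻ {σ = B} e∈ = begin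
          dot (lin μ (at B)) (at B e)     ≈⟨ dot-cong {w′ = vec e i′} (λ k → sym (u≈ k)) (λ k → reflexive (≡.cong (λ w → w k) (at-just B eq′))) ⟩
          dot u (vec e i′)                ≈⟨ tight eq′ ⟩
          c e i′                          ≈⟨ reflexive (bound-just c B eq′) ⟨
          bound c B e ∎

      -- Removing a point on which a linear dependence is nonzero does not change
      -- the span, but the removed constraint stays tight.
      basis-size : ∀ {B} → Basis B → length (dom B) ℕ.≤ D
      basis-size {B} b with length (dom B) ℕ.≤? D
      ... | yes p = p
      ... | no ¬p = excluded (dependent (at B) (dom B) (dom-unique B) (ℕ.≰⇒> ¬p))
        where
        open Basis b
        excluded : (∃ λ a → SupportedOn (_∈ dom B) a × (∃ λ j → j ∈ dom B × ¬ a j ≈ 0#) × (∀ i → lin a (at B) i ≈ 0#)) → length (dom B) ℕ.≤ D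
        excluded (a , a-supp , (j , j∈ , aj≉0) , vanish) with inverse aj≉0 | ∈-dom⁻ {σ = B} j∈
        ... | a⁻¹ , aa⁻¹≈1 | i , eq = contradiction (tight eq)
          (not-tight (erase j B) ν ν-supp u (λ k → sym (ν-u k)) (λ eq′ → tight (transfer (erase-⊑ B) eq′)) λ eq′ → proj₁ (lookup-erase⁻ B eq′) ≡.refl)
          where
          s : Carrier
          s = μ j ⊗ a⁻¹
          ν : Vector Carrier n
          ν e = μ e - s ⊗ a e
          νj≈0 : ν j ≈ 0#
          νj≈0 = begin
            μ j - (μ j ⊗ a⁻¹) ⊗ a j   ≈⟨ solve 3 (λ m p q → m :- (m :* p) :* q := m :- m :* (q :* p)) refl (μ j) a⁻¹ (a j) ⟩
            μ j - μ j ⊗ (a j ⊗ a⁻¹)   ≈⟨ +-congˡ (-‿cong (trans (*-congˡ aa⁻¹≈1) (*-identityʳ _))) ⟩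
            μ j - μ j                 ≈⟨ -‿inverseʳ _ ⟩
            0# ∎
          ν-supp : SupportedOn (_∈ dom (erase j B)) ν
          ν-supp {e} e∉ with e ≟ j
          ... | yes ≡.refl = νj≈0
          ... | no e≢j = trans (+-cong (supported e∉B) (-‿cong (trans (*-congˡ (a-supp e∉B)) (zeroʳ s)))) (-‿inverseʳ 0#)
            where
            e∉B : e ∉ dom B
            e∉B e∈B = e∉ (∈-dom⁺ {σ = erase j B} (lookup-erase⁺ B e≢j (proj₂ (∈-dom⁻ {σ = B} e∈B))))
          ν-u : ∀ k → lin ν (at (erase j B)) k ≈ u k
          ν-u k = begin
            dot ν (λ e → at (erase j B) e k)                        ≈⟨ sum-cong-≋ same ⟩
            dot ν (λ e → at B e k)                                  ≈⟨ dot-minus μ (λ e → s ⊗ a e) (λ e → at B e k) ⟩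
            u k - dot (λ e → s ⊗ a e) (λ e → at B e k)              ≈⟨ +-congˡ (-‿cong (trans (dot-⊗ s a (λ e → at B e k)) (trans (*-congˡ (vanish k)) (zeroʳ s)))) ⟩
            u k - 0#                                                ≈⟨ solve 1 (λ x → x :- con 0ℤ := x) refl (u k) ⟩
            u k ∎
            where
            same : ∀ e → ν e ⊗ at (erase j B) e k ≈ ν e ⊗ at B e k
            same e with e ≟ j
            ... | yes ≡.refl = trans (trans (*-congʳ νj≈0) (zeroˡ _)) (sym (trans (*-congʳ νj≈0) (zeroˡ _)))
            ... | no e≢j     = *-congˡ (reflexive (≡.cong (λ m → maybe′ (vec e) (λ _ → 0#) m k) (lookup∘erase e≢j)))
              where
              lookup∘erase : e ≢ j → lookup (erase j B) e ≡ lookup B e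
              lookup∘erase e≢j = lookup∘update′ e≢j B nothing

      norm : ∀ {B} → Basis B → Carrier
      norm b = dot (Basis.u b) (Basis.u b)

      -- The variational inequality of the nearest point: u is a nonnegative combination of the
      -- vectors of `B`, whose products with u equal c while their products with u′ are at least c.
      norm≼dot : ∀ {B B′} (b : Basis B) (b′ : Basis B′) → Within em (T (Basis.u b′)) B → norm b ≼ dot (Basis.u b) (Basis.u b′)
      norm≼dot {B} b b′ B⊆T = 0≼-⇒≼ (≼-resp refl collect (sum-nonneg _ term))
        where
        open Basis b
        u′ = Basis.u b′
        term : ∀ e → 0# ≼ μ e ⊗ (dot (at B e) u′ - dot (at B e) u)
        term e with em {e ∈ dom B}
        ... | no e∉ = ≼-reflexive (sym (trans (*-congʳ (supported e∉)) (zeroˡ _)))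
        ... | yes e∈ with i , eq ← ∈-dom⁻ {σ = B} e∈ = ⊗-nonneg (nonnegative e) (≼⇒0≼- (≼-resp
                (trans (sym (tight eq)) (flip u)) (flip u′) (B⊆T eq)))
          where
          flip : ∀ w → dot w (vec e i) ≈ dot (at B e) w
          flip w = trans (dot-comm w (vec e i)) (dot-cong {w = w} (λ k → reflexive (≡.cong (λ v → v k) (≡.sym (at-just B eq)))) (λ _ → refl))
        collect : dot μ (λ e → dot (at B e) u′ - dot (at B e) u) ≈ dot u u′ - dot u u
        collect = trans (dot-minusʳ μ (λ e → dot (at B e) u′) (λ e → dot (at B e) u)) (+-cong (sym (dot-u b u′)) (-‿cong (sym (dot-u b u))))

      distance : ∀ (u u′ : Vector Carrier D) → dot (λ k → u′ k - u k) (λ k → u′ k - u k) ≈ (dot u′ u′ - dot u u) - (1# ⊕ 1#) ⊗ (dot u u′ - dot u u)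
      distance u u′ = begin
        dot Δ Δ                                                       ≈⟨ dot-minus u′ u Δ ⟩
        dot u′ Δ - dot u Δ                                            ≈⟨ +-cong (dot-minusʳ u′ u′ u) (-‿cong (dot-minusʳ u u′ u)) ⟩
        (dot u′ u′ - dot u′ u) - (dot u u′ - dot u u)                 ≈⟨ +-congʳ (+-congˡ (-‿cong (dot-comm u′ u))) ⟩
        (dot u′ u′ - dot u u′) - (dot u u′ - dot u u)                 ≈⟨ solve 4 (λ a b d o → (a :- b) :- (b :- d) := (a :- d) :- ((b :- d) :+ (b :- d))) refl (dot u′ u′) (dot u u′) (dot u u) 1# ⟩
        (dot u′ u′ - dot u u) - ((dot u u′ - dot u u) ⊕ (dot u u′ - dot u u))  ≈⟨ +-congˡ (-‿cong (sym (trans (distribʳ _ 1# 1#) (+-cong (*-identityˡ _) (*-identityˡ _))))) ⟩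
        (dot u′ u′ - dot u u) - (1# ⊕ 1#) ⊗ (dot u u′ - dot u u) ∎
        where
        Δ : Vector Carrier D
        Δ k = u′ k - u k

      module _ {B B′ : Map} (b : Basis B) (b′ : Basis B′) (B⊆T : Within em (T (Basis.u b′)) B) where

        private
          u = Basis.u b
          u′ = Basis.u b′
          d = dot u u′ - dot u u
          0≼2d : 0# ≼ (1# ⊕ 1#) ⊗ d
          0≼2d = ⊗-nonneg (0≼⊕ 0≼1 0≼1) (≼⇒0≼- (norm≼dot b b′ B⊆T))
          0≼Δ² : 0# ≼ dot (λ k → u′ k - u k) (λ k → u′ k - u k)
          0≼Δ² = sum-nonneg _ (λ k → 0≼square (u′ k - u k))

        norm-mono : norm b ≼ norm b′
        norm-mono = 0≼-⇒≼ (≼-resp refl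
          (trans (+-congʳ (distance u u′)) (solve 2 (λ x y → (x :- y) :+ y := x) refl (dot u′ u′ - dot u u) ((1# ⊕ 1#) ⊗ d)))
          (0≼⊕ 0≼Δ² 0≼2d))

        -- Uniqueness of the shortest vector: ∣u′∣² - ∣u∣² is ∣u′ - u∣² plus twice the nonnegative
        -- ⟨u , u′⟩ - ∣u∣², so it can be nonpositive only if u = u′.
        norm-reflects : norm b′ ≼ norm b → ∀ k → u k ≈ u′ k
        norm-reflects le k = sym (-≈0⇒≈ (dot-self-≈0 (λ k → u′ k - u k) (≼-antisym Δ²≼0 0≼Δ²) k))
          where
          Δ²≼0 : dot (λ k → u′ k - u k) (λ k → u′ k - u k) ≼ 0#
          Δ²≼0 = 0≼-⇒≼ (≼-resp refl
            (sym (trans (+-congˡ (-‿cong (distance u u′))) (solve 3 (λ x y z → con 0ℤ :- ((x :- y) :- z) := (y :- x) :+ z) refl (dot u′ u′) (dot u u) ((1# ⊕ 1#) ⊗ d))))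
            (0≼⊕ (≼⇒0≼- le) 0≼2d))

      T-cong : ∀ {u u′} → (∀ k → u k ≈ u′ k) → ∀ {j i} → T u j i → T u′ j i
      T-cong eq {j} {i} t = ≼-resp refl (dot-cong {w = vec j i} eq (λ _ → refl)) t

      -- By genericity a basis consists of all pairs that are tight at its u, so u determines it.
      same-u⇒⊑ : ∀ {B B′} (b : Basis B) (b′ : Basis B′) → (∀ k → Basis.u b k ≈ Basis.u b′ k) → B′ ⊑ B
      same-u⇒⊑ {B} {B′} b b′ eq = mk⊑ λ {j} {i} eq′ → decide j i eq′ em
        where
        decide : ∀ j i → lookup B′ j ≡ just i → Dec (lookup B j ≡ just i) → lookup B j ≡ just i
        decide j i eq′ (yes p) = p
        decide j i eq′ (no ∉B) = contradiction
          (trans (dot-cong {w = vec j i} eq (λ _ → refl)) (Basis.tight b′ eq′))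
          (not-tight B (Basis.μ b) (Basis.supported b) (Basis.u b) (λ _ → refl) (Basis.tight b) ∉B)

      within-self : ∀ {B} (b : Basis B) → Within em (T (Basis.u b)) B
      within-self b eq = ≼-reflexive (sym (Basis.tight b eq))

      within-⊑ : ∀ {u σ τ} → σ ⊑ τ → Within em (T u) τ → Within em (T u) σ
      within-⊑ σ⊑τ w eq = w (transfer σ⊑τ eq)

      InCell : ∃ Basis → Map → Set
      InCell (B , b) = Cell em B (T (Basis.u b))

      -- Keeping from σ only the points with nonzero multiplier does not change u, and slackness
      -- makes the constraints kept tight; feasibility puts σ within T. If the constraints of σ are
      -- infeasible, the Farkas certificate remains.
      find-cell : ∀ σ → (∃ λ b → InCell b σ) ⊎ At.Certificate σ (bound c σ) (dom σ) []
      find-cell σ with At.optimise σ (bound c σ) (dom σ) (dom-unique σ) [] (λ _ ())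
      ... | inj₂ C = inj₂ C
      ... | inj₁ O = inj₁ ((B , b) , B⊑σ , within)
        where
        module O = At.Optimum σ O
        keep : ∀ {P : Set} → Dec P → Maybe (Fin r) → Maybe (Fin r)
        keep (yes _) m = nothing
        keep (no _)  m = m
        B : Map
        B = tabulate λ j → keep (em {O.μ j ≈ 0#}) (lookup σ j)
        lookup-B : ∀ {j i} → lookup B j ≡ just i → ¬ O.μ j ≈ 0# × lookup σ j ≡ just i
        lookup-B {j} eq = go em (≡.trans (≡.sym (lookup∘tabulate _ j)) eq)
          where
          go : ∀ {P : Set} (d : Dec P) {m} {i} → keep d m ≡ just i → ¬ P × m ≡ just i
          go (no ¬p) eq = ¬p , eq
        lookup-σ : ∀ {j i} → ¬ O.μ j ≈ 0# → lookup σ j ≡ just i → lookup B j ≡ just i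
        lookup-σ {j} ≉0 eq = ≡.trans (lookup∘tabulate _ j) (go em)
          where
          go : ∀ d → keep d (lookup σ j) ≡ just _
          go (yes ≈0) = contradiction ≈0 ≉0
          go (no _)   = eq
        B⊑σ : B ⊑ σ
        B⊑σ = mk⊑ (proj₂ ∘ lookup-B)
        zero-outside : ∀ {j} → j ∉ dom σ → O.μ j ≈ 0#
        zero-outside j∉ = O.supported (Sum.[ j∉ , (λ ()) ] ∘ ∈-++⁻ (dom σ))
        zero-outside-B : SupportedOn (_∈ dom B) O.μ
        zero-outside-B {j} j∉ with em {O.μ j ≈ 0#}
        ... | yes p = p
        ... | no ≉0 with em {j ∈ dom σ}
        ... | no j∉σ  = zero-outside j∉σ
        ... | yes j∈σ = contradiction (∈-dom⁺ {σ = B} (lookup-σ ≉0 (proj₂ (∈-dom⁻ {σ = σ} j∈σ)))) j∉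
        same-u : ∀ k → lin O.μ (at B) k ≈ lin O.μ (at σ) k
        same-u k = dot-cong-on {S = _∈ dom B} {O.μ} zero-outside-B {λ e → at B e k} {λ e → at σ e k} λ e∈ →
          let i , eq = ∈-dom⁻ {σ = B} e∈ in
          reflexive (≡.cong (λ v → v k) (≡.trans (at-just B eq) (≡.sym (at-just σ (proj₂ (lookup-B eq))))))
        value-σ : ∀ {j i} → lookup σ j ≡ just i → At.value σ O.μ j ≈ dot (lin O.μ (at B)) (vec j i)
        value-σ eq = dot-cong (λ k → sym (same-u k)) (λ k → reflexive (≡.cong (λ v → v k) (at-just σ eq)))
        b : Basis B
        b = record
          { μ = O.μ
          ; supported = zero-outside-B
          ; nonnegative = λ j → nonneg j em
          ; tight = λ {j} {i} eq → let ≉0 , eq′ = lookup-B eq in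
              trans (sym (value-σ eq′)) (trans (is-tight ≉0 (O.slackness (∈-dom⁺ {σ = σ} eq′))) (reflexive (bound-just c σ eq′)))
          }
          where
          nonneg : ∀ j → Dec (j ∈ dom σ) → 0# ≼ O.μ j
          nonneg j (yes j∈) = O.nonnegative j∈
          nonneg j (no j∉)  = ≼-reflexive (sym (zero-outside j∉))
          is-tight : ∀ {j} → ¬ O.μ j ≈ 0# → O.μ j ≈ 0# ⊎ At.value σ O.μ j ≈ bound c σ j → At.value σ O.μ j ≈ bound c σ j
          is-tight ≉0 (inj₁ ≈0) = contradiction ≈0 ≉0
          is-tight ≉0 (inj₂ eq) = eq
        within : Within em (T (Basis.u b)) σ
        within eq = ≼-resp (reflexive (bound-just c σ eq)) (value-σ eq) (O.feasible (∈-dom⁺ {σ = σ} eq))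

      collect : List Map → List (∃ Basis)
      collect []       = []
      collect (B ∷ Bs) with em {Basis B}
      ... | yes b = (B , b) ∷ collect Bs
      ... | no _  = collect Bs

      ∈-collect : ∀ {Bs B} → B ∈ Bs → Basis B → ∃ λ b → (B , b) ∈ collect Bs
      ∈-collect {B ∷ Bs} (here ≡.refl) b with em {Basis B}
      ... | yes b′ = b′ , here ≡.refl
      ... | no ¬b  = contradiction b ¬b
      ∈-collect {B ∷ Bs} (there B∈) b with em {Basis B} | ∈-collect B∈ b
      ... | yes _ | b′ , b′∈ = b′ , there b′∈
      ... | no _  | b′ , b′∈ = b′ , b′∈

      decreasing : DecTotalOrder 0ℓ 0ℓ 0ℓ
      decreasing = On.decTotalOrder (record
        { Carrier = Carrier
        ; _≈_ = _≈_
        ; _≤_ = λ x y → y ≼ x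
        ; isDecTotalOrder = record
          { isTotalOrder = record
            { isPartialOrder = record
              { isPreorder = record
                { isEquivalence = isEquivalence ; reflexive = λ eq → ≼-reflexive (sym eq) ; trans = λ p q → ≼-trans q p }
              ; antisym = λ p q → ≼-antisym q p }
            ; total = λ x y → ≼-total y x }
          ; _≟_ = λ _ _ → em
          ; _≤?_ = λ _ _ → em } })
        (λ ((_ , b) : ∃ Basis) → norm b)

      module Filtration (P : Map → Set) (P-up : ∀ {σ τ} → σ ⊑ τ → P σ → P τ)
        (P-disjoint : ∀ {u σ} → Within em (T u) σ → ¬ P σ)
        (P-certified : ∀ {σ} → At.Certificate σ (bound c σ) (dom σ) [] → P σ)
        (T-proper : ∀ u j → ∃ λ i → ¬ T u j i) where

        Stage : List (∃ Basis) → Map → Set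
        Stage bs σ = P σ ⊎ ∃ λ b → b ∈ bs × InCell b σ

        -- The recursion runs up to the full poset, where `rest` is empty, and acyclicity is carried
        -- back on return: each call removes the first cell of `rest` from the next stage. The
        -- hypothesis on norms keeps every stage an upset.
        all-stages : ∀ {k} → k ℕ.+ D ℕ.< n → ∀ rest done →
          AllPairs (λ b b′ → norm (proj₂ b′) ≼ norm (proj₂ b)) rest →
          (∀ {b d} → b ∈ rest → d ∈ done → norm (proj₂ b) ≼ norm (proj₂ d)) →
          (∀ σ → P σ ⊎ ∃ λ b → (b ∈ done ⊎ b ∈ rest) × InCell b σ) →
          Acyclic k (Stage done)
        all-stages k<n [] done _ _ covers = boundsIn-mono {U = λ _ → ⊤} (λ _ → tt)
          (λ {σ} _ → everything (covers σ)) (cone {a = replicate n nothing} tt (λ {σ} _ → mk⊑ λ {j} eq →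
            contradiction (≡.trans (≡.sym (lookup-replicate j nothing)) eq) λ ()))
          where
          everything : ∀ {σ} → (P σ ⊎ ∃ λ b → (b ∈ done ⊎ b ∈ []) × InCell b σ) → Stage done σ
          everything (inj₁ p)                      = inj₁ p
          everything (inj₂ (b , inj₁ b∈ , cell))   = inj₂ (b , b∈ , cell)
        all-stages {k} k<n ((B , b) ∷ rest) done (b≽rest ∷ sorted) rest≼done covers = remove em
          where
          next : Acyclic k (Stage ((B , b) ∷ done))
          next = all-stages k<n rest ((B , b) ∷ done) sorted
            (λ { e∈ (here ≡.refl) → All.lookup b≽rest e∈ ; e∈ (there d∈) → rest≼done (there e∈) d∈ })
            (λ σ → Sum.map₂ (λ { (e , inj₁ e∈ , cell) → e , inj₁ (there e∈) , cell
                               ; (e , inj₂ (here ≡.refl) , cell) → e , inj₁ (here ≡.refl) , cell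
                               ; (e , inj₂ (there e∈) , cell) → e , inj₂ e∈ , cell }) (covers σ))

          -- Norms increase along ⊑, and the remaining cells have norm at most that
          -- of b′: passing to one of them cannot change u.
          later : ∀ {B′ τ} (b′ : Basis B′) {e} → (∀ {e} → e ∈ (B , b) ∷ rest → norm (proj₂ e) ≼ norm b′) →
            e ∈ (B , b) ∷ rest → B′ ⊑ τ → InCell e τ → Within em (T (Basis.u b′)) τ
          later b′ {_ , e} small e∈ B′⊑τ (_ , w) eq =
            T-cong (λ k → sym (norm-reflects b′ e (within-⊑ B′⊑τ w) (small e∈) k)) (w eq)

          stage-up : ∀ {σ τ} → σ ⊑ τ → Stage done σ → Stage done τ
          stage-up σ⊑τ (inj₁ p) = inj₁ (P-up σ⊑τ p)
          stage-up {σ} {τ} σ⊑τ (inj₂ ((B′ , b′) , d∈ , B′⊑σ , _)) with covers τ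
          ... | inj₁ p                        = inj₁ p
          ... | inj₂ (e , inj₁ e∈ , cell)     = inj₂ (e , e∈ , cell)
          ... | inj₂ (e , inj₂ e∈ , cell)     = inj₂ ((B′ , b′) , d∈ , B′⊑τ ,
                  later b′ (λ e∈ → rest≼done e∈ d∈) e∈ B′⊑τ cell)
            where
            B′⊑τ : B′ ⊑ τ
            B′⊑τ = ⊑-trans B′⊑σ σ⊑τ

          outside : ∀ {σ} → B ⊑ σ → ¬ Within em (T (Basis.u b)) σ → Stage done σ
          outside {σ} B⊑σ ¬w with covers σ
          ... | inj₁ p                    = inj₁ p
          ... | inj₂ (e , inj₁ e∈ , cell) = inj₂ (e , e∈ , cell)
          ... | inj₂ (e , inj₂ e∈ , cell) = contradiction
                  (λ {j} {i} → later b (λ { (here ≡.refl) → ≼-refl ; (there e∈) → All.lookup b≽rest e∈ }) e∈ B⊑σ cell {j} {i}) ¬w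

          -- The list of bases is not known to be free of repetitions. A basis whose u has occurred
          -- before has the same cell and leaves the stage unchanged.
          Repeated : Set
          Repeated = ∃ λ d → d ∈ done × (∀ k → Basis.u (proj₂ d) k ≈ Basis.u b k)

          remove : Dec Repeated → Acyclic k (Stage done)
          remove (yes ((B′ , b′) , d∈ , eq)) = boundsIn-mono
            (λ { (inj₁ p) → inj₁ p ; (inj₂ (e , e∈ , cell)) → inj₂ (e , there e∈ , cell) })
            (λ { (inj₁ p) → inj₁ p
               ; (inj₂ (e , there e∈ , cell)) → inj₂ (e , e∈ , cell)
               ; (inj₂ (_ , here ≡.refl , B⊑σ , w)) →
                   inj₂ ((B′ , b′) , d∈ , ⊑-trans (same-u⇒⊑ b b′ (λ k → sym (eq k))) B⊑σ , λ p → T-cong (λ k → sym (eq k)) (w p)) })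
            next
          remove (no new) = remove-cell em stage-up (within-self b) (T-proper (Basis.u b)) outside inside small
            (boundsIn-mono
              (λ { (inj₁ (inj₁ p)) → inj₁ p
                 ; (inj₁ (inj₂ (e , e∈ , cell))) → inj₂ (e , there e∈ , cell)
                 ; (inj₂ cell) → inj₂ ((B , b) , here ≡.refl , cell) })
              (λ { (inj₁ p) → inj₁ (inj₁ p)
                 ; (inj₂ (e , there e∈ , cell)) → inj₁ (inj₂ (e , e∈ , cell))
                 ; (inj₂ (_ , here ≡.refl , cell)) → inj₂ cell })
              next)
            where
            inside : ∀ {σ} → InCell (B , b) σ → ¬ Stage done σ
            inside (_ , w) (inj₁ p) = P-disjoint (λ {j} {i} → w {j} {i}) p
            -- A map in two cells contains each basis and satisfies the constraints of both vectors,
            -- so each norm is at most the other and the vectors agree.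
            inside (B⊑σ , w) (inj₂ ((B′ , b′) , d∈ , B′⊑σ , w′)) = new ((B′ , b′) , d∈ ,
              norm-reflects b′ b (within-⊑ B′⊑σ w) (norm-mono b b′ (within-⊑ B⊑σ w′)))
            small : k ℕ.< length (free B)
            small = ℕ.+-cancelʳ-< D k (length (free B)) (ℕ.≤-trans k<n (ℕ.≤-trans
              (ℕ.≤-reflexive (≡.trans (≡.sym (∣dom∣+∣free∣ B)) (ℕ.+-comm (length (dom B)) _)))
              (ℕ.+-monoʳ-≤ (length (free B)) (basis-size b))))

        acyclic : ∀ {k} → k ℕ.+ D ℕ.< n → Acyclic k P
        acyclic k<n = boundsIn-mono inj₁ (λ { (inj₁ p) → p ; (inj₂ (_ , () , _)) })
          (all-stages k<n bases [] (Linked⇒AllPairs (λ p q → ≼-trans q p) (sort-↗ decreasing (collect (allMaps n r)))) (λ _ ()) covers)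
          where
          bases : List (∃ Basis)
          bases = sort decreasing (collect (allMaps n r))
          covers : ∀ σ → P σ ⊎ ∃ λ b → (b ∈ [] ⊎ b ∈ bases) × InCell b σ
          covers σ with find-cell σ
          ... | inj₂ C = inj₁ (P-certified C)
          -- The list may hold another basis structure b′ on `B`. Both satisfy the constraints of
          -- `B`, so their vectors coincide.
          ... | inj₁ ((B , b) , B⊑σ , w) with b′ , b′∈ ← ∈-collect (∈-allMaps B) b =
            inj₂ ((B , b′) , inj₂ (∈-resp-↭ (↭-sym (sort-↭ decreasing (collect (allMaps n r)))) b′∈) , B⊑σ ,
              λ eq → T-cong (norm-reflects b b′ (within-self b′) (norm-mono b′ b (within-self b))) (w eq))

-- Sarkaria's vectors and intersecting hulls.

module SarkariaVectors where

  open import Axiom.ExcludedMiddle using (ExcludedMiddle)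
  open import Data.Fin.Base using (Fin; zero; suc; combine; quotient; remainder)
  open import Data.Fin.Properties using (remQuot-combine)
  open import Data.List.Base using ([])
  open import Data.List.Membership.Propositional using (_∈_)
  open import Data.List.Membership.Propositional.Properties using (∈-++⁻)
  open import Data.Maybe.Base using (Maybe; just; nothing; maybe′)
  open import Data.Nat.Base as ℕ using (ℕ; zero; suc)
  open import Data.Product.Base using (∃; _×_; _,_)
  open import Data.Sum.Base as Sum using (_⊎_; inj₁; inj₂)
  open import Data.Vec.Base using (lookup)
  open import Data.Vec.Functional using (Vector)
  open import Function.Base using (_∘_)
  open import Level using (0ℓ)
  open import Relation.Binary.PropositionalEquality as ≡ using (_≡_; _≢_)
  open import Relation.Nullary using (¬_; Dec; yes; no; contradiction)
  open RealField using (OrderedField)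
  open IntegerSolver using (module IntegerCoefficients)
  open ConvexOptimisation using (module FieldProperties)
  open CellDecomposition
  open PartialMaps

  module TverbergAcyclic (F : OrderedField) (em : ExcludedMiddle 0ℓ) {n d r : ℕ}
    (x : Fin n → Vector (OrderedField.Carrier F) d) where

    open OrderedField F hiding (zero)
    open FieldProperties F em
    open IntegerCoefficients commutativeRing using (solve; _:=_; _:*_; _:-_; :-_)
    open import Algebra.Properties.Semiring.Sum semiring using (sum; sum-cong-≋)
    open import Relation.Binary.Reasoning.Setoid setoid

    private
      Map : Set
      Map = PartialMap {n} {suc r}

    record Hull (σ : Map) (i : Fin (suc r)) (p : Vector Carrier d) : Set where
      field
        weight     : Vector Carrier n
        weight≥0   : ∀ j → 0# ≼ weight j
        supported  : ∀ j → lookup σ j ≢ just i → weight j ≈ 0#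
        weight-sum : sum weight ≈ 1#
        barycentre : ∀ k → dot weight (λ j → x j k) ≈ p k

    Intersecting : Map → Set
    Intersecting σ = ∃ λ p → ∀ i → Hull σ i p

    -- The leading 1 lets moments record total weights beside barycentres; it accounts for the
    -- factor d + 1 in the dimension.
    homogeneous : Vector Carrier d → Vector Carrier (suc d)
    homogeneous p zero    = 1#
    homogeneous p (suc k) = p k

    -- corner (b + 1) is the basis vector of index b, and corner 0 is minus the
    -- sum of the basis vectors.
    corner : Fin (suc r) → Vector Carrier r
    corner i b = unit i (suc b) - unit i zero

    -- The tensor product of `corner i` with the homogenised point, flattened to r (d + 1)
    -- coordinates.
    vec : Fin n → Fin (suc r) → Vector Carrier (r ℕ.* suc d)
    vec j i k = corner i (quotient (suc d) k) ⊗ homogeneous (x j) (remainder {r} (suc d) k)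

    unit-sym : ∀ {m} (i j : Fin m) → unit i j ≈ unit j i
    unit-sym i j with em {i ≡ j}
    ... | yes ≡.refl = refl
    ... | no i≢j     = trans (unit-other {i = i} {j} i≢j) (sym (unit-other {i = j} {i} (i≢j ∘ ≡.sym)))

    sum-corner : ∀ b → (sum λ i → corner i b) ≈ 0#
    sum-corner b = begin
      (sum λ i → corner i b)                                 ≈⟨ sum-cong-≋ (λ i → trans (+-cong (unit-sym i (suc b)) (-‿cong (unit-sym i zero))) (sym (*-identityʳ _))) ⟩
      dot (λ i → unit (suc b) i - unit zero i) (λ _ → 1#)    ≈⟨ dot-minus (unit (suc b)) (unit zero) (λ _ → 1#) ⟩
      dot (unit (suc b)) (λ _ → 1#) - dot (unit {suc r} zero) (λ _ → 1#) ≈⟨ +-cong (dot-unit (suc b) (λ _ → 1#)) (-‿cong (dot-unit {suc r} zero (λ _ → 1#))) ⟩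
      1# - 1#                                                ≈⟨ -‿inverseʳ 1# ⟩
      0# ∎

    -- The corners sum to 0, hence so do their tensors with any q, which is later both a point of
    -- the family and a common point of the hulls.
    balanced : ∀ (q : Vector Carrier (suc d)) u →
      (sum λ i → dot (λ k → corner i (quotient (suc d) k) ⊗ q (remainder {r} (suc d) k)) u) ≈ 0#
    balanced q u = begin
      (sum λ i → dot (L i) u)               ≈⟨ sum-cong-≋ (λ i → *-identityˡ (dot (L i) u)) ⟨
      dot (λ _ → 1#) (λ i → dot (L i) u)    ≈⟨ dot-lin (λ _ → 1#) L u ⟨
      dot (lin (λ _ → 1#) L) u              ≈⟨ dot-zeroˡ (lin (λ _ → 1#) L) u zeros ⟩
      0# ∎
      where
      L : Fin (suc r) → Vector Carrier (r ℕ.* suc d)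
      L i k = corner i (quotient (suc d) k) ⊗ q (remainder {r} (suc d) k)
      zeros : ∀ k → lin (λ _ → 1#) L k ≈ 0#
      zeros k = begin
        (sum λ i → 1# ⊗ (corner i b ⊗ q c))     ≈⟨ sum-cong-≋ (λ i → trans (*-identityˡ _) (*-comm (corner i b) (q c))) ⟩
        dot (λ _ → q c) (λ i → corner i b)      ≈⟨ dot-comm (λ _ → q c) (λ i → corner i b) ⟩
        dot (λ i → corner i b) (λ _ → q c)      ≈⟨ dot-cong {u = λ i → corner i b} (λ _ → refl) (λ _ → sym (*-identityʳ (q c))) ⟩
        dot (λ i → corner i b) (λ _ → q c ⊗ 1#) ≈⟨ dot-comm (λ i → corner i b) (λ _ → q c ⊗ 1#) ⟩
        dot (λ _ → q c ⊗ 1#) (λ i → corner i b) ≈⟨ dot-⊗ (q c) (λ _ → 1#) (λ i → corner i b) ⟩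
        q c ⊗ dot (λ _ → 1#) (λ i → corner i b) ≈⟨ *-congˡ (trans (sum-cong-≋ (λ i → *-identityˡ (corner i b))) (sum-corner b)) ⟩
        q c ⊗ 0#                                ≈⟨ zeroʳ (q c) ⟩
        0# ∎
        where
        b = quotient (suc d) k
        c = remainder {r} (suc d) k

    indicator : Maybe (Fin (suc r)) → Fin (suc r) → Carrier
    indicator m i = maybe′ (λ i′ → unit i′ i) 0# m

    indicator≥0 : ∀ m i → 0# ≼ indicator m i
    indicator≥0 nothing   i = ≼-refl
    indicator≥0 (just i′) i with em {i′ ≡ i}
    ... | yes ≡.refl = ≼-resp refl (sym (unit-same i)) 0≼1
    ... | no i′≢i    = ≼-reflexive (sym (unit-other {i = i′} {i} i′≢i))

    -- Coordinate (b , k) compares part b + 1 with part 0, so a combination of the vectors vanishes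
    -- when all parts have equal moments, and only then.
    vec-combine : ∀ j m b k →
      maybe′ (vec j) (λ _ → 0#) m (combine b k) ≈ (indicator m (suc b) - indicator m zero) ⊗ homogeneous (x j) k
    vec-combine j nothing  b k = sym (trans (*-congʳ (-‿inverseʳ 0#)) (zeroˡ (homogeneous (x j) k)))
    vec-combine j (just i) b k = reflexive (≡.cong (λ (b , k) → corner i b ⊗ homogeneous (x j) k) (remQuot-combine b k))

    weighted-vec : ∀ i (w : Vector Carrier n) (q : Vector Carrier (suc d)) →
      (∀ k → dot w (λ j → homogeneous (x j) k) ≈ q k) → ∀ u →
      dot w (λ j → dot (vec j i) u) ≈ dot (λ k → corner i (quotient (suc d) k) ⊗ q (remainder {r} (suc d) k)) u
    weighted-vec i w q moment u = trans (sym (dot-lin w (λ j → vec j i) u)) (dot-cong {w = u} coordinate (λ _ → refl))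
      where
      coordinate : ∀ k → lin w (λ j → vec j i) k ≈ corner i (quotient (suc d) k) ⊗ q (remainder {r} (suc d) k)
      coordinate k = begin
        dot w (λ j → s ⊗ homogeneous (x j) e)     ≈⟨ dot-comm w (λ j → s ⊗ homogeneous (x j) e) ⟩
        dot (λ j → s ⊗ homogeneous (x j) e) w     ≈⟨ dot-⊗ s (λ j → homogeneous (x j) e) w ⟩
        s ⊗ dot (λ j → homogeneous (x j) e) w     ≈⟨ *-congˡ (trans (dot-comm (λ j → homogeneous (x j) e) w) (moment e)) ⟩
        s ⊗ q e ∎
        where
        s = corner i (quotient (suc d) k)
        e = remainder {r} (suc d) k

    open Bases F em vec

    module _ (c : Fin n → Vector Carrier (suc r)) (c>0 : ∀ j i → ¬ c j i ≼ 0#) (generic : Generic c) where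

      open Cells c generic

      T-nonneg : ∀ {u j i} → T u j i → 0# ≼ dot (vec j i) u
      T-nonneg {u} {j} {i} t = ≼-resp refl (dot-comm u (vec j i)) (≼-trans (⋠⇒≽ (c>0 j i)) t)

      T-nonzero : ∀ {u j i} → T u j i → ¬ dot (vec j i) u ≈ 0#
      T-nonzero {u} {j} {i} t eq = c>0 j i (≼-trans t (≼-reflexive (trans (dot-comm u (vec j i)) eq)))

      -- Over i the products ⟨u , vec j i⟩ add up to 0, whereas membership of every (j , i) would
      -- make each of them at least c j i > 0.
      T-proper : ∀ u j → ∃ λ i → ¬ T u j i
      T-proper u j with em {∃ λ i → ¬ T u j i}
      ... | yes p   = p
      ... | no none = contradiction
        (sum-nonneg-≈0 (λ i → dot (vec j i) u) (λ i → T-nonneg {u} {j} {i} (all i em)) (balanced (homogeneous (x j)) u) zero) (T-nonzero {u} {j} {zero} (all zero em))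
        where
        all : ∀ i → Dec (T u j i) → T u j i
        all i (yes t) = t
        all i (no ¬t) = contradiction (i , ¬t) none

      -- If the hulls met in p, the weighted vectors of all parts would sum to the tensors of the
      -- corners with (1 , p), which is 0. Paired with u every summand is nonnegative, and positive
      -- wherever a weight is, so all weights vanish, although those of each part add up to 1.
      within⇒¬intersecting : ∀ {u σ} → Within em (T u) σ → ¬ Intersecting σ
      within⇒¬intersecting {u} {σ} within (p , hulls) =
        1≉0 (trans (sym (Hull.weight-sum (hulls zero))) (sum-zero (w zero) (all-zero zero)))
        where
        w : Fin (suc r) → Vector Carrier n
        w i = Hull.weight (hulls i)
        f : Fin (suc r) → Vector Carrier n
        f i j = w i j ⊗ dot (vec j i) u
        f≥0 : ∀ i j → Dec (lookup σ j ≡ just i) → 0# ≼ f i j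
        f≥0 i j (yes eq) = ⊗-nonneg (Hull.weight≥0 (hulls i) j) (T-nonneg {u} {j} {i} (within eq))
        f≥0 i j (no ne)  = ≼-reflexive (sym (trans (*-congʳ (Hull.supported (hulls i) j ne)) (zeroˡ (dot (vec j i) u))))
        moment : ∀ i k → dot (w i) (λ j → homogeneous (x j) k) ≈ homogeneous p k
        moment i zero    = trans (sum-cong-≋ (λ j → *-identityʳ (w i j))) (Hull.weight-sum (hulls i))
        moment i (suc k) = Hull.barycentre (hulls i) k
        sum≈0 : (sum λ i → sum (f i)) ≈ 0#
        sum≈0 = trans (sum-cong-≋ λ i → weighted-vec i (w i) (homogeneous p) (moment i) u) (balanced (homogeneous p) u)
        f≈0 : ∀ i j → f i j ≈ 0#
        f≈0 i = sum-nonneg-≈0 (f i) (λ j → f≥0 i j em)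
          (sum-nonneg-≈0 (λ i → sum (f i)) (λ i → sum-nonneg (f i) (λ j → f≥0 i j em)) sum≈0 i)
        all-zero : ∀ i j → w i j ≈ 0#
        all-zero i j = decide em (⊗≈0 (f≈0 i j))
          where
          decide : Dec (lookup σ j ≡ just i) → w i j ≈ 0# ⊎ dot (vec j i) u ≈ 0# → w i j ≈ 0#
          decide (no ne)  _        = Hull.supported (hulls i) j ne
          decide (yes eq) (inj₁ q) = q
          decide (yes eq) (inj₂ q) = contradiction q (T-nonzero {u} {j} {i} (within eq))

      -- Grouped by parts, the Farkas multipliers have equal moments in all parts, hence equal total
      -- weight s and, after division by s, equal barycentres.
      certificate⇒intersecting : ∀ {σ} → At.Certificate σ (bound c σ) (dom σ) [] → Intersecting σ
      certificate⇒intersecting {σ} C = normalise (inverse s≉0)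
        where
        module C = At.Certificate σ C
        part : Fin (suc r) → Vector Carrier n
        part i j = C.y j ⊗ indicator (lookup σ j) i
        y-outside : ∀ {j} → ¬ j ∈ dom σ → C.y j ≈ 0#
        y-outside j∉ = C.supported (Sum.[ j∉ , (λ ()) ] ∘ ∈-++⁻ (dom σ))
        y≥0 : ∀ j → 0# ≼ C.y j
        y≥0 j = decide em
          where
          decide : Dec (j ∈ dom σ) → 0# ≼ C.y j
          decide (yes j∈) = C.nonnegative j∈
          decide (no j∉)  = ≼-reflexive (sym (y-outside j∉))
        part≥0 : ∀ i j → 0# ≼ part i j
        part≥0 i j = ⊗-nonneg (y≥0 j) (indicator≥0 (lookup σ j) i)
        part-outside : ∀ i j → lookup σ j ≢ just i → part i j ≈ 0#
        part-outside i j = go (lookup σ j)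
          where
          go : ∀ m → m ≢ just i → C.y j ⊗ indicator m i ≈ 0#
          go nothing   _  = zeroʳ _
          go (just i′) ne = trans (*-congˡ (unit-other {i = i′} {i} (ne ∘ ≡.cong just))) (zeroʳ _)
        moment : Fin (suc r) → Vector Carrier (suc d)
        moment i k = dot (part i) (λ j → homogeneous (x j) k)
        moments-agree : ∀ i k → moment i k ≈ moment zero k
        moments-agree zero    k = refl
        moments-agree (suc b) k = -≈0⇒≈ (begin
          moment (suc b) k - moment zero k
            ≈⟨ dot-minus (part (suc b)) (part zero) (λ j → homogeneous (x j) k) ⟨
          (sum λ j → (part (suc b) j - part zero j) ⊗ homogeneous (x j) k)
            ≈⟨ sum-cong-≋ (λ j → regroup (C.y j) (indicator (lookup σ j) (suc b)) (indicator (lookup σ j) zero) (homogeneous (x j) k)) ⟩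
          (sum λ j → C.y j ⊗ ((indicator (lookup σ j) (suc b) - indicator (lookup σ j) zero) ⊗ homogeneous (x j) k))
            ≈⟨ sum-cong-≋ (λ j → *-congˡ (vec-combine j (lookup σ j) b k)) ⟨
          lin C.y (at σ) (combine b k)
            ≈⟨ C.vanishing (combine b k) ⟩
          0# ∎)
          where
          regroup : ∀ y p q h → (y ⊗ p - y ⊗ q) ⊗ h ≈ y ⊗ ((p - q) ⊗ h)
          regroup = solve 4 (λ y p q h → (y :* p :- y :* q) :* h := y :* ((p :- q) :* h)) refl
        s : Carrier
        s = moment zero zero
        mass : ∀ i → sum (part i) ≈ s
        mass i = trans (sum-cong-≋ (λ j → sym (*-identityʳ (part i j)))) (moments-agree i zero)
        -- If the common weight were 0, every part and so all of y would vanish, against ⟨y , c⟩ >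
        -- 0.
        s≉0 : ¬ s ≈ 0#
        s≉0 s≈0 = C.positive (≼-reflexive (dot-zeroˡ C.y (bound c σ) y≈0))
          where
          y≈0 : ∀ j → C.y j ≈ 0#
          y≈0 j = decide em
            where
            assigned : ∀ i → lookup σ j ≡ just i → C.y j ≈ 0#
            assigned i eq = begin
              C.y j               ≈⟨ *-identityʳ (C.y j) ⟨
              C.y j ⊗ 1#          ≈⟨ *-congˡ (unit-same i) ⟨
              C.y j ⊗ unit i i    ≈⟨ reflexive (≡.cong (λ m → C.y j ⊗ indicator m i) eq) ⟨
              part i j            ≈⟨ sum-nonneg-≈0 (part i) (part≥0 i) (trans (mass i) s≈0) j ⟩
              0# ∎
            decide : Dec (j ∈ dom σ) → C.y j ≈ 0#
            decide (no j∉)  = y-outside j∉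
            decide (yes j∈) = let i , eq = ∈-dom⁻ {σ = σ} j∈ in assigned i eq
        normalise : (∃ λ s⁻¹ → s ⊗ s⁻¹ ≈ 1#) → Intersecting σ
        normalise (s⁻¹ , ss⁻¹≈1) = (λ k → s⁻¹ ⊗ moment zero (suc k)) , λ i → record
          { weight     = λ j → s⁻¹ ⊗ part i j
          ; weight≥0   = λ j → ⊗-nonneg s⁻¹≥0 (part≥0 i j)
          ; supported  = λ j ne → trans (*-congˡ (part-outside i j ne)) (zeroʳ s⁻¹)
          ; weight-sum = begin
              (sum λ j → s⁻¹ ⊗ part i j)             ≈⟨ sum-cong-≋ (λ j → *-identityʳ (s⁻¹ ⊗ part i j)) ⟨
              dot (λ j → s⁻¹ ⊗ part i j) (λ _ → 1#)  ≈⟨ dot-⊗ s⁻¹ (part i) (λ _ → 1#) ⟩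
              s⁻¹ ⊗ moment i zero                    ≈⟨ *-congˡ (moments-agree i zero) ⟩
              s⁻¹ ⊗ s                                ≈⟨ *-comm s⁻¹ s ⟩
              s ⊗ s⁻¹                                ≈⟨ ss⁻¹≈1 ⟩
              1# ∎
          ; barycentre = λ k → trans (dot-⊗ s⁻¹ (part i) (λ j → x j k)) (*-congˡ (moments-agree i (suc k)))
          }
          where
          0≼s : 0# ≼ s
          0≼s = ≼-resp refl (mass zero) (sum-nonneg (part zero) (part≥0 zero))
          s⁻¹≥0 : 0# ≼ s⁻¹
          s⁻¹≥0 = 0≼⊗⇒0≼ (≼-resp refl (trans (sym ss⁻¹≈1) (*-comm s s⁻¹)) 0≼1) (λ s≼0 → s≉0 (≼-antisym s≼0 0≼s))

    intersecting-up : ∀ {σ τ} → σ ⊑ τ → Intersecting σ → Intersecting τ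
    intersecting-up σ⊑τ (p , hulls) = p , λ i → record
      { Hull (hulls i) ; supported = λ j ne → Hull.supported (hulls i) j (ne ∘ transfer σ⊑τ) }

    intersecting-acyclic : ∀ {k} → k ℕ.+ r ℕ.* suc d ℕ.< n → Acyclic k Intersecting
    intersecting-acyclic {k} k<n = conclude generic-exists
      where
      conclude : (∃ λ c → (∀ j i → ¬ c j i ≼ 0#) × Generic c) → Acyclic k Intersecting
      conclude (c , c>0 , generic) =
        Cells.Filtration.acyclic c generic Intersecting intersecting-up
          (λ {u} {σ} → within⇒¬intersecting c c>0 generic {u} {σ})
          (λ {σ} → certificate⇒intersecting c c>0 generic {σ})
          (T-proper c c>0 generic) k<n

open import Axiom.ExcludedMiddle using (ExcludedMiddle)
open import Data.Fin.Base using (Fin)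
open import Data.Fin.Properties using (any?; _≟_)
open import Data.Fin.Subset using (Subset; _∈_)
open import Data.Fin.Subset.Properties using (_∈?_; x∈p∩q⁺; x∈p∩q⁻)
open import Data.Integer.Base as ℤ using (+_; -[1+_]; 1ℤ) renaming (_-_ to _-ℤ_)
open import Data.List.Base using ([]; _∷_; map)
open import Data.List.Relation.Unary.All as All using (All; []; _∷_)
open import Data.List.Relation.Unary.All.Properties as All using ()
open import Data.Maybe.Base using (Maybe; just; nothing)
open import Data.Maybe.Properties using (just-injective; ≡-dec)
open import Data.Nat.Base using (ℕ; zero; suc; _+_; _*_; _∸_; _≤_; _<_; _≥_; z≤n; s≤s)
open import Data.Nat.Properties as ℕ using ()
open import Data.Product.Base using (∃; _,_; map₂)
open import Data.Unit.Base using (tt)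
open import Data.Vec.Base using (Vec; lookup; tabulate)
open import Data.Vec.Properties using (lookup∘tabulate; []=⇒lookup; lookup⇒[]=)
open import Defs
open import Function.Base using (_∘_)
open import Function.Definitions using (Injective)
open import Level using (0ℓ)
open import Relation.Binary.Bundles using (DecPoset)
open import Relation.Binary.Core using (Rel)
open import Relation.Binary.PropositionalEquality using (_≡_; refl; sym; trans; cong; cong₂; module ≡-Reasoning)
open import Relation.Nullary using (Dec; yes; no; does; contradiction)
open import Relation.Nullary.Decidable using (dec-true)
open Chains
open PosetHomology
open PartialMaps
open StrictSimplices
open RealField
open SarkariaVectors
open FreeModule
open Boundary

-- Transfer from partial maps to tuples of subsets, and the theorem.

module _ {X A : Set} (_≤ˣ_ : Rel X 0ℓ) (_≤ᵃ_ : Rel A 0ℓ) {U : X → Set} {V : A → Set} (f : X → A) (g : A → X)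
  (f-mono : ∀ {x y} → U x → U y → x ≤ˣ y → f x ≤ᵃ f y) (fU : ∀ {x} → U x → V (f x))
  (g-mono : ∀ {a b} → a ≤ᵃ b → g a ≤ˣ g b) (gV : ∀ {a} → V a → U (g a))
  (retract : ∀ {x} → U x → g (f x) ≡ x) where

  private
    module X = WeakChains _≤ˣ_
    module A = WeakChains _≤ᵃ_

    push : ∀ {k σ} → X.Increasing U k σ → A.Increasing V k (map f σ)
    push X.[]              = A.[]
    push ((u , x≤) X.∷ us) =
      (fU u , All.map⁺ (All.zipWith (λ (u′ , x≤y) → f-mono u u′ x≤y) (X.increasing-All us , x≤))) A.∷ push us

    pull : ∀ {k σ} → A.Increasing V k σ → X.Increasing U k (map g σ)
    pull A.[]              = X.[]
    pull ((v , a≤) A.∷ vs) = (gV v , All.map⁺ (All.map g-mono a≤)) X.∷ pull vs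

    round-trip : ∀ {σ} → All U σ → map g (map f σ) ≡ σ
    round-trip []       = refl
    round-trip (u ∷ us) = cong₂ _∷_ (retract u) (round-trip us)

  -- As g ∘ f is the identity on `U`, a cycle can be pushed to `V`, filled there and pulled back.
  -- Monotonicity of f is asked on `U` because `index` respects the order only for disjoint tuples.
  acyclic-retract : ∀ {k} → A.Acyclic k V → X.Acyclic k U
  acyclic-retract h z z∈ ∂z
    with b , b∈ , ∂b ← h (map (map₂ (map f)) z) (AllSupp-map (All.map push z∈)) (λ φ → trans (∂-map f z φ) (∂z (φ ∘ map f))) =
      map (map₂ (map g)) b , AllSupp-map (All.map pull b∈) , λ φ → begin
        ⟪ ∂ (map (map₂ (map g)) b) , φ ⟫       ≡⟨ ∂-map g b φ ⟩
        ⟪ ∂ b , φ ∘ map g ⟫                    ≡⟨ ∂b (φ ∘ map g) ⟩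
        ⟪ map (map₂ (map f)) z , φ ∘ map g ⟫   ≡⟨ ⟪⟫-map (map f) z (φ ∘ map g) ⟩
        ⟪ z , φ ∘ map g ∘ map f ⟫              ≡⟨ ⟪⟫-cong-on (All.map (λ us → cong φ (round-trip (X.increasing-All us))) z∈) ⟩
        ⟪ z , φ ⟫ ∎
    where open ≡-Reasoning

module _ {n r : ℕ} where

  private
    Tuple : Set
    Tuple = Vec (Subset n) r

    module T = DecPoset (tuples n r)

  Disjoint : Tuple → Set
  Disjoint X = ∀ {i i′ j} → j ∈ lookup X i → j ∈ lookup X i′ → i ≡ i′

  value? : (σ : PartialMap) (i : Fin r) (j : Fin n) → Dec (lookup σ j ≡ just i)
  value? σ i j = ≡-dec _≟_ (lookup σ j) (just i)

  fibres : PartialMap → Tuple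
  fibres σ = tabulate λ i → tabulate λ j → does (value? σ i j)

  lookup-fibres : ∀ σ i j → lookup (lookup (fibres σ) i) j ≡ does (value? σ i j)
  lookup-fibres σ i j = trans (cong (λ p → lookup p j) (lookup∘tabulate _ i)) (lookup∘tabulate _ j)

  ∈-fibres⁺ : ∀ σ {i j} → lookup σ j ≡ just i → j ∈ lookup (fibres σ) i
  ∈-fibres⁺ σ {i} {j} eq = lookup⇒[]= j (lookup (fibres σ) i) (trans (lookup-fibres σ i j) (dec-true (value? σ i j) eq))

  ∈-fibres⁻ : ∀ σ {i j} → j ∈ lookup (fibres σ) i → lookup σ j ≡ just i
  ∈-fibres⁻ σ {i} {j} j∈ with value? σ i j | trans (sym (lookup-fibres σ i j)) ([]=⇒lookup j∈)
  ... | yes eq | _  = eq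
  ... | no _   | ()

  witness : ∀ {P : Fin r → Set} → Dec (∃ P) → Maybe (Fin r)
  witness (yes (i , _)) = just i
  witness (no _)        = nothing

  index : Tuple → PartialMap
  index X = tabulate λ j → witness (any? λ i → j ∈? lookup X i)

  lookup-index⁻ : ∀ X {i j} → lookup (index X) j ≡ just i → j ∈ lookup X i
  lookup-index⁻ X {i} {j} eq = go (any? λ i → j ∈? lookup X i) (trans (sym (lookup∘tabulate _ j)) eq)
    where
    go : (p : Dec (∃ λ i → j ∈ lookup X i)) → witness p ≡ just i → j ∈ lookup X i
    go (yes (_ , j∈)) refl = j∈

  lookup-index⁺ : ∀ {X} → Disjoint X → ∀ {i j} → j ∈ lookup X i → lookup (index X) j ≡ just i
  lookup-index⁺ {X} disjoint {i} {j} j∈ = trans (lookup∘tabulate _ j) (go (any? λ i → j ∈? lookup X i))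
    where
    go : (p : Dec (∃ λ i → j ∈ lookup X i)) → witness p ≡ just i
    go (yes (_ , j∈′)) = cong just (disjoint j∈′ j∈)
    go (no none)       = contradiction (i , j∈) none

  index-mono : ∀ {X Y} → Disjoint Y → X T.≤ Y → index X ⊑ index Y
  index-mono {X} {Y} disjoint X≤Y = mk⊑ λ {j} {i} eq → lookup-index⁺ {X = Y} disjoint (X≤Y i (lookup-index⁻ X eq))

  fibres-mono : ∀ {σ τ : PartialMap} → σ ⊑ τ → fibres σ T.≤ fibres τ
  fibres-mono {σ} {τ} σ⊑τ i j∈ = ∈-fibres⁺ τ (transfer σ⊑τ (∈-fibres⁻ σ j∈))

  fibres-disjoint : ∀ σ → Disjoint (fibres σ)
  fibres-disjoint σ j∈ j∈′ = just-injective (trans (sym (∈-fibres⁻ σ j∈)) (∈-fibres⁻ σ j∈′))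

  fibres-index : ∀ {X} → Disjoint X → fibres (index X) ≡ X
  fibres-index {X} disjoint = T.antisym {fibres (index X)} {X}
    (λ i j∈ → lookup-index⁻ X (∈-fibres⁻ (index X) j∈))
    (λ i j∈ → ∈-fibres⁺ (index X) (lookup-index⁺ {X = X} disjoint j∈))

module _ (em : ExcludedMiddle 0ℓ) {d n r : ℕ} (x : Fin n → Point d) where

  open ℝ-Order em using (ℝ-orderedField)
  open TverbergAcyclic ℝ-orderedField em {r = r} x

  tverberg-disjoint : ∀ {X : Vec (Subset n) (suc r)} → IsTverberg x X → Disjoint X
  tverberg-disjoint {X} t {i} {i′} {j} j∈ j∈′ with i ≟ i′
  ... | yes eq = eq
  ... | no ne  = contradiction (j , x∈p∩q⁺ (j∈ , j∈′)) (IsTverberg.disjoint t i i′ ne)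

  tverberg⇒intersecting : ∀ {X} → IsTverberg x X → Intersecting (index X)
  tverberg⇒intersecting {X} t with p , hulls ← IsTverberg.intersecting t = p , λ i → record
    { weight     = InConv.weight (hulls i)
    ; weight≥0   = InConv.weight≥0 (hulls i)
    ; supported  = λ j ne → InConv.supported (hulls i) j (λ j∈ → ne (lookup-index⁺ {X = X} (tverberg-disjoint t) j∈))
    ; weight-sum = InConv.weight-sum (hulls i)
    ; barycentre = InConv.barycentre (hulls i)
    }

  intersecting⇒tverberg : ∀ {σ} → Intersecting σ → IsTverberg x (fibres σ)
  intersecting⇒tverberg {σ} (p , hulls) = record
    { disjoint = λ i i′ i≢i′ (j , j∈) → let j∈₁ , j∈₂ = x∈p∩q⁻ (lookup (fibres σ) i) (lookup (fibres σ) i′) j∈ in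
        i≢i′ (fibres-disjoint σ j∈₁ j∈₂)
    ; intersecting = p , λ i → record
      { weight     = Hull.weight (hulls i)
      ; weight≥0   = Hull.weight≥0 (hulls i)
      ; supported  = λ j j∉ → Hull.supported (hulls i) j (λ eq → j∉ (∈-fibres⁺ σ eq))
      ; weight-sum = Hull.weight-sum (hulls i)
      ; barycentre = Hull.barycentre (hulls i)
      }
    }

  tverberg-acyclic : ∀ {k} → k + r * suc d < n →
    WeakChains.Acyclic (DecPoset._≤_ (tuples n (suc r))) k (IsTverberg x)
  tverberg-acyclic k<n = acyclic-retract (DecPoset._≤_ (tuples n (suc r))) _⊑_ index fibres
    (λ {X} {Y} _ t X≤Y → index-mono {X = X} {Y} (tverberg-disjoint t) X≤Y)
    tverberg⇒intersecting (λ {σ} {τ} → fibres-mono {σ = σ} {τ}) intersecting⇒tverberg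
    (λ t → fibres-index (tverberg-disjoint t))
    (intersecting-acyclic k<n)

theorem7p13 : ExcludedMiddle 0ℓ →
    (d n : ℕ) (x : Fin n → Point d) → Injective _≡_ _≈ᵖ_ x →
    (r m : ℕ) → r ≥ 1 → n ≥ (d + 1) * (r ∸ 1) + m + 1 →
    OrderComplex.HomologicallyConnected (TverPoset x r) (+ m -ℤ 1ℤ)
theorem7p13 em d n x _ (suc r) m _ n≥ = connected
  where
  -- Here k counts vertices, so the degrees -1, ..., m - 1 are the cases k = 0, ..., m; the summand
  -- 1 in the hypothesis on n turns k ≤ m into the strict inequality k + r (d + 1) < n.
  vanishing : ∀ {k} → k ≤ m → ∀ z → OrderComplex.IsCycle (TverPoset x (suc r)) {k} z → OrderComplex.IsBoundary (TverPoset x (suc r)) z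
  vanishing {k} k≤m = StrictChains.acyclic⇒boundary (IsTverberg x) (tverberg-acyclic em x (ℕ.≤-trans bound n≥))
    where
    open ℕ.≤-Reasoning
    bound : suc (k + r * suc d) ≤ (d + 1) * r + m + 1
    bound = begin
      suc (k + r * suc d)      ≤⟨ s≤s (ℕ.+-monoˡ-≤ (r * suc d) k≤m) ⟩
      suc (m + r * suc d)      ≡⟨ cong suc (ℕ.+-comm m (r * suc d)) ⟩
      suc (r * suc d + m)      ≡⟨ cong (λ e → suc (e + m)) (ℕ.*-comm r (suc d)) ⟩
      suc (suc d * r + m)      ≡⟨ cong (λ e → suc (e * r + m)) (ℕ.+-comm 1 d) ⟩
      suc ((d + 1) * r + m)    ≡⟨ ℕ.+-comm 1 ((d + 1) * r + m) ⟩
      (d + 1) * r + m + 1 ∎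

  degree : ∀ {j} m → + j ℤ.≤ + m -ℤ 1ℤ → suc j ≤ m
  degree zero    ()
  degree (suc m) (ℤ.+≤+ j≤m) = s≤s j≤m

  connected : OrderComplex.HomologicallyConnected (TverPoset x (suc r)) (+ m -ℤ 1ℤ)
  connected (+ j)        _ j≤ = vanishing (degree m j≤)
  connected -[1+ zero ]  _ _  = vanishing z≤n
  connected -[1+ suc _ ] _ _  = tt
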